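{- Let $\hat a_n,\hat b_n,\hat c_n,\hat d_n,\hat e_n,\hat f_n,\hat g_n,\hat h_n,\hat k_n$ denote the sums of the values of the vertices of type $A,B,C,D,E,F,G,H,K$, respectively, on level $n$ of the hyperbolic Pascal simplex based on the hypercube mosaic $\{4,3,3,5\}$, and let $\hat s_n$ be the sum of the values of all vertices on level $n$. (1) Each of the ten sequences $\{\hat a_n\},\{\hat b_n\},\{\hat c_n\},\{\hat d_n\},\{\hat e_n\},\{\hat f_n\},\{\hat g_n\},\{\hat h_n\},\{\hat k_n\},\{\hat s_n\}$ satisfies, for all $n\ge 11$, the tenth order linear homogeneous recurrence $$\begin{aligned}\hat x_n={}&147\hat x_{n-1}-3635\hat x_{n-2}+36277\hat x_{n-3}-175292\hat x_{n-4}+445156\hat x_{n-5}-608920\hat x_{n-6}\\&+438532\hat x_{n-7}-151320\hat x_{n-8}+19344\hat x_{n-9}-288\hat x_{n-10},\end{aligned}$$ with the following initial values for $n=1,\dots,10$: - $\hat a_n$: $0, 12, 36, 108, 348, 1164, 3948, 13452, 45900, 156684$; - $\hat b_n$: $0, 0, 12, 60, 228, 804, 2772, 9492, 32436, 110772$; - $\hat c_n$: $0, 0, 24, 144, 840, 5808, 48552, 458736, 4588008, 46916592$; - $\hat d_n$: $0, 0, 0, 96, 1296, 14400, 152592, 1592448, 16530384, 171272832$; - $\hat e_n$: $0, 0, 0, 72, 1248, 15192, 166176, 1753080, 18264480, 189472440$; - $\hat f_n$: $0, 0, 0, 24, 240, 2280, 26880, 667944, 51411168, 5797305000$; - $\hat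 g_n$: $0, 0, 0, 0, 240, 5976, 255936, 24140328, 2793536160, 331243298952$; - $\hat h_n$: $0, 0, 0, 0, 360, 38400, 4458168, 528618816, 62831416920, 7469847072960$; - $\hat k_n$: $0, 0, 0, 0, 2256, 323592, 39296736, 4682378232, 556809369792, 66200381333976$; - $\hat s_n$: $4, 16, 76, 508, 7060, 407620, 44411764, 5239632532, 622525195252, 74007676940212$. (2) Each of the sequences $\{\hat a_n\},\{\hat b_n\},\{\hat c_n\},\{\hat d_n\},\{\hat e_n\}$ also satisfies $$\hat x_n=18\hat x_{n-1}-99\hat x_{n-2}+226\hat x_{n-3}-224\hat x_{n-4}+92\hat x_{n-5}-12\hat x_{n-6}\qquad(n\ge7).$$ (3) Each of the sequences $\{\hat a_n\},\{\hat b_n\}$ also satisfies $$\hat x_n=5\hat x_{n-1}-6\hat x_{n-2}+2\hat x_{n-3}\qquad(n\ge4).$$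
   Context: The mosaic $\{4,3,3,5\}$ is the regular tessellation of hyperbolic 4-space by 4-dimensional hypercubes $\{4,3,3\}$ with vertex figure the 600-cell $\{3,3,5\}$ (so 600 hypercubes and 120 edges meet at each vertex). Hyperbolic Pascal simplex. Fix a vertex $V_0$ of the mosaic. The value (sign) of a vertex is the number of shortest paths along mosaic edges from $V_0$ to that vertex (the value of $V_0$ is $1$). Define a convex part $\mathcal P$ of the mosaic as follows. Take one hypercube containing $V_0$ and let $V_1$ be its vertex opposite to $V_0$ (the vertex of this hypercube with the largest value, namely $24$). Next take all new hypercubes of the mosaic containing $V_1$, and in each of them the vertex with the largest value. Then take all hypercubes containing these vertices, and in each new one the vertex with the largest value, and so on without end. $\mathcal P$ is the set of all hypercubes obtained. The vertices and edges of $\mathcal P$, with each edge directed from its endpoint nearer to $V_0$ to its endpoint farther from $V_0$, form an infinite digraph called the hyperbolic Pascal simplex. Level $n$ is the set of its vertices whose edge-distance from $V_0$ along edges of $\mathcal P$ is $n$. An incoming edge of a vertex on level $n$ is an edge from a vertex on level $n-1$; the value of a vertex other than $V_0$ is the sum of the values of the starting points of its incoming edges. Vertex types. The boundary of $\mathcal P$ has the combinatorial shape of an infinite simplicial cone with apex $V_0$: four boundary rays, six 2-dimensional faces and four 3-dimensional faces. - Type $1$: vertices on the boundary rays (value $1$). They have degree $5$ in $\mathcal P$, except $V_0$, which has degree $4$. There are four of them on each level $n\ge1$. - Types $A$, $B$: vertices in the interior of a 2-dimensional face (degree $7$ in $\mathcal P$), with exactly two (type $A$) or one (type $B$) incoming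 edges. - Types $C$, $D$, $E$: vertices in the interior of a 3-dimensional face (degree $13$ in $\mathcal P$), with exactly three (type $C$), two (type $D$) or one (type $E$) incoming edges. - Types $F$, $G$, $H$, $K$: vertices in the interior of $\mathcal P$ (degree $120$), with exactly four (type $F$), three (type $G$), two (type $H$) or one (type $K$) incoming edges.
   Formalization: The convex part 𝒫 is the least set of hypercubes closed under the described process and under local convexity (three of the five hypercubes around a square force all five); the bare process is not convex: it gives some interior vertices degree 33, not 120. -}

module Defs where

open import Data.Nat.Base as ℕ using (ℕ; suc)
open import Data.Integer.Base as ℤ using (ℤ; +_)
open import Data.Fin.Base using (Fin; zero; suc)
open import Data.Vec.Base using (Vec; []; _∷_; zipWith; map; foldr′)
open import Data.List.Base as List using (List; []; _∷_; length; sum)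
open import Data.List.Membership.Propositional using (_∈_)
open import Data.List.Relation.Unary.Unique.Propositional using (Unique)
open import Data.List.Relation.Binary.Pointwise using (Pointwise)
open import Data.Product.Base using (∃-syntax; _×_)
open import Data.Unit.Base using (⊤)
open import Function.Bundles using (_⇔_)
open import Relation.Binary.PropositionalEquality using (_≡_; _≢_; refl)

------------------------------------------------------------------------
-- The ring ℤ[τ], τ = (1 + √5)/2, τ² = τ + 1.

-- [ a , b ] is a + b τ.
record ℤτ : Set where
  constructor [_,_]
  field
    rat irr : ℤ

open ℤτ public

infixl 6 _⊕_ _⊖_
infixl 7 _⊗_

_⊕_ _⊖_ _⊗_ : ℤτ → ℤτ → ℤτ
[ a , b ] ⊕ [ c , d ] = [ a ℤ.+ c , b ℤ.+ d ]
[ a , b ] ⊖ [ c , d ] = [ a ℤ.- c , b ℤ.- d ]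
[ a , b ] ⊗ [ c , d ] =
  [ a ℤ.* c ℤ.+ b ℤ.* d , a ℤ.* d ℤ.+ b ℤ.* c ℤ.+ b ℤ.* d ]

𝟘 𝟙 -𝟙 𝟚 𝟜 τ -τ τ² τ⁻¹ : ℤτ
𝟘   = [ + 0 , + 0 ]
𝟙   = [ + 1 , + 0 ]
-𝟙  = [ ℤ.- + 1 , + 0 ]
𝟚   = [ + 2 , + 0 ]
𝟜   = [ + 4 , + 0 ]
τ   = [ + 0 , + 1 ]
-τ  = [ + 0 , ℤ.- + 1 ]
τ²  = [ + 1 , + 1 ]
τ⁻¹ = [ ℤ.- + 1 , + 1 ]

------------------------------------------------------------------------
-- The mosaic {4,3,3,5} in the hyperboloid model: hyperbolic 4-space is the
-- set of rays with t > 0 on which the Lorentzian form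
--   ⟨x,x⟩ = x₁² + x₂² + x₃² + x₄² - τ⁻¹ t²
-- is negative; coordinates are listed as (t, x₁, x₂, x₃, x₄).  The symmetry group
-- [4,3,3,5] is generated by the reflections in the five sides of a
-- characteristic simplex {x : ⟨x , root i⟩ ≥ 0}.

Point : Set
Point = Vec ℤτ 5

⟨_,_⟩ : Point → Point → ℤτ
⟨ t ∷ x , s ∷ y ⟩ = foldr′ _⊕_ 𝟘 (zipWith _⊗_ x y) ⊖ τ⁻¹ ⊗ (t ⊗ s)

root : Fin 5 → Point
root zero                         = 𝟘  ∷ 𝟙  ∷ 𝟘  ∷ 𝟘  ∷ 𝟘  ∷ []
root (suc zero)                   = 𝟘  ∷ -𝟙 ∷ 𝟙  ∷ 𝟘  ∷ 𝟘  ∷ []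
root (suc (suc zero))             = 𝟘  ∷ 𝟘  ∷ -𝟙 ∷ 𝟙  ∷ 𝟘  ∷ []
root (suc (suc (suc zero)))       = 𝟘  ∷ 𝟘  ∷ 𝟘  ∷ -𝟙 ∷ 𝟙  ∷ []
root (suc (suc (suc (suc zero)))) = -𝟙 ∷ 𝟘  ∷ 𝟘  ∷ 𝟘  ∷ -τ ∷ []

-- 2 / ⟨root i , root i⟩
scale : Fin 5 → ℤτ
scale zero    = 𝟚
scale (suc _) = 𝟙

reflect : Fin 5 → Point → Point
reflect i x = zipWith _⊖_ x (map (scale i ⊗ ⟨ x , root i ⟩ ⊗_) (root i))

-- 4 cos² of the angle between the i-th and the j-th mirror.
4cos² : Fin 5 → Fin 5 → ℤτ
4cos² i j = scale i ⊗ scale j ⊗ (⟨ root i , root j ⟩ ⊗ ⟨ root i , root j ⟩)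

-- The angles are π/4, π/3, π/3, π/5 for consecutive mirrors, and π/2 for
-- the other pairs.
coxeter-diagram :
  List.map (λ i → List.map (4cos² i) (List.allFin 5)) (List.allFin 5) ≡
    (𝟜 ∷ 𝟚 ∷ 𝟘 ∷ 𝟘  ∷ 𝟘  ∷ []) ∷
    (𝟚 ∷ 𝟜 ∷ 𝟙 ∷ 𝟘  ∷ 𝟘  ∷ []) ∷
    (𝟘 ∷ 𝟙 ∷ 𝟜 ∷ 𝟙  ∷ 𝟘  ∷ []) ∷
    (𝟘 ∷ 𝟘 ∷ 𝟙 ∷ 𝟜  ∷ τ² ∷ []) ∷
    (𝟘 ∷ 𝟘 ∷ 𝟘 ∷ τ² ∷ 𝟜  ∷ []) ∷ []
coxeter-diagram = refl

-- A word in the generating reflections, acting on points.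
act : List (Fin 5) → Point → Point
act w x = List.foldr reflect x w

-- The centres of the faces of dimension 0, 1, 2, 3, 4 of one flag of the
-- mosaic; they lie on all the mirrors except the one of the same index.
-- So (τ²; 0, 0, 0, 0) is the centre of the hypercube with the vertices
-- (τ²; ±1, ±1, ±1, ±1).
centre : Fin 5 → Point
centre zero                         = τ² ∷ 𝟙 ∷ 𝟙 ∷ 𝟙 ∷ 𝟙 ∷ []
centre (suc zero)                   = τ² ∷ 𝟘 ∷ 𝟙 ∷ 𝟙 ∷ 𝟙 ∷ []
centre (suc (suc zero))             = τ² ∷ 𝟘 ∷ 𝟘 ∷ 𝟙 ∷ 𝟙 ∷ []
centre (suc (suc (suc zero)))       = τ² ∷ 𝟘 ∷ 𝟘 ∷ 𝟘 ∷ 𝟙 ∷ []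
centre (suc (suc (suc (suc zero)))) = τ² ∷ 𝟘 ∷ 𝟘 ∷ 𝟘 ∷ 𝟘 ∷ []

vertex square hypercube : Fin 5
vertex    = zero
square    = suc (suc zero)
hypercube = suc (suc (suc (suc zero)))

-- Faces of the mosaic are represented by their centres.  The group acts
-- simply transitively on flags, so two faces are incident iff some group
-- element takes the corresponding faces of the flag above to them.
Incident : Fin 5 → Fin 5 → Point → Point → Set
Incident i j x y = ∃[ w ] (act w (centre i) ≡ x × act w (centre j) ≡ y)

Edge : Point → Point → Set
Edge u v =
  ∃[ w ] (act w (centre vertex) ≡ u × act w (reflect zero (centre vertex)) ≡ v)

------------------------------------------------------------------------
-- Finite enumerations and paths

Enumerates : {A : Set} → List A → (A → Set) → Set
Enumerates xs P = Unique xs × (∀ x → (x ∈ xs) ⇔ P x)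

Card : {A : Set} → (A → Set) → ℕ → Set
Card P k = ∃[ xs ] (Enumerates xs P × length xs ≡ k)

-- Path R u p v: p lists the vertices of a path from u to v, omitting u.
data Path (R : Point → Point → Set) : Point → List Point → Point → Set where
  []  : ∀ {u} → Path R u [] u
  _∷_ : ∀ {u w p v} → R u w → Path R w p v → Path R u (w ∷ p) v

ShortestPath : (Point → Point → Set) → Point → Point → List Point → Set
ShortestPath R u v p =
  Path R u p v × (∀ q → Path R u q v → length p ℕ.≤ length q)

Distance : (Point → Point → Set) → Point → Point → ℕ → Set
Distance R u v n = ∃[ p ] (ShortestPath R u v p × length p ≡ n)

data VertexType : Set where
  A B C D E F G H K : VertexType

degree : VertexType → ℕ
degree A = 7
degree B = 7
degree C = 13
degree D = 13
degree E = 13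
degree F = 120
degree G = 120
degree H = 120
degree K = 120

indegree : VertexType → ℕ
indegree A = 2
indegree B = 1
indegree C = 3
indegree D = 2
indegree E = 1
indegree F = 4
indegree G = 3
indegree H = 2
indegree K = 1

data Class : Set where
  type : VertexType → Class
  all  : Class

------------------------------------------------------------------------
-- The hyperbolic Pascal simplex with apex V₀ and first hypercube Q₀

module Simplex (V₀ Q₀ : Point) where

  Value : Point → ℕ → Set
  Value v k = Card (ShortestPath Edge V₀ v) k

  LargestIn : Point → Point → Set
  LargestIn Q v =
    Incident vertex hypercube v Q ×
    ∃[ k ] (Value v k ×
            (∀ u → Incident vertex hypercube u Q → ∃[ j ] (Value u j × j ℕ.≤ k)))

  -- The convex part of the mosaic generated from Q₀ by passing to all the
  -- hypercubes around the vertex of largest value of a hypercube.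
  --
  -- Convexity has to be imposed: passing to hypercubes around largest
  -- vertices alone leaves wedge-shaped gaps (for instance, an interior vertex
  -- with one incoming edge would get degree 33 instead of 120).  Five
  -- hypercubes with dihedral angles 2π/5 surround each square; a convex
  -- set meets a neighbourhood of the square in an angle of at most π, i.e.
  -- in at most two of the five, or else contains all five.
  data 𝒫 : Point → Set where
    first  : 𝒫 Q₀
    next   : ∀ {Q v Q′} → 𝒫 Q → LargestIn Q v →
             Incident vertex hypercube v Q′ → 𝒫 Q′
    convex : ∀ {s Q₁ Q₂ Q₃ Q} → 𝒫 Q₁ → 𝒫 Q₂ → 𝒫 Q₃ →
             Q₁ ≢ Q₂ → Q₁ ≢ Q₃ → Q₂ ≢ Q₃ →
             Incident square hypercube s Q₁ →
             Incident square hypercube s Q₂ →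
             Incident square hypercube s Q₃ →
             Incident square hypercube s Q → 𝒫 Q

  𝒫Edge : Point → Point → Set
  𝒫Edge u v =
    Edge u v ×
    ∃[ Q ] (𝒫 Q × Incident vertex hypercube u Q × Incident vertex hypercube v Q)

  Level : ℕ → Point → Set
  Level n v = Distance 𝒫Edge V₀ v n

  -- Edges at v are identified with their other endpoints.
  Incoming : Point → Point → Set
  Incoming v u = 𝒫Edge u v × ∃[ n ] (Level n u × Level (suc n) v)

  -- The degree tells whether v is in the interior of a 2-dimensional face,
  -- of a 3-dimensional face, or of 𝒫.
  HasType : VertexType → Point → Set
  HasType T v = Card (𝒫Edge v) (degree T) × Card (Incoming v) (indegree T)

  InClass : Class → Point → Set
  InClass (type T) = HasType T
  InClass all      = λ _ → ⊤

  -- s is the sum of the values of the vertices of class c on level n.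
  LevelSum : Class → ℕ → ℕ → Set
  LevelSum c n s =
    ∃[ vs ] (Enumerates vs (λ v → Level n v × InClass c v) ×
             ∃[ ks ] (Pointwise Value vs ks × sum ks ≡ s))

{-# OPTIONS --safe #-}

-- The 1-skeleton of the mosaic is the Cayley graph of the right-angled reflection
-- group generated by the 120 reflections in the walls between V₀ and its neighbours;
-- two of them commute iff their roots are orthogonal, that is, adjacent vertices of the
-- 600-cell.  So shortest paths are reduced words, a vertex is determined by its word up
-- to commutations, and its incoming edges are the last letters of its reduced words;
-- they span a cell of the 600-cell.
--
-- A vertex of the convex part is reached by a word in which every letter lies in
-- the star of the cell spanned by those directions of Q₀ that are still unused before it.
-- The numbers of unused directions and of last letters determine the type of the vertex and
-- the types of its successors.  Hence the sum of the values of the vertices of one type is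
-- the number of reduced words of this type, and the vector of these numbers is multiplied
-- by a constant matrix from level to level.
module Submission where

-- The argument rests on one sign. For a root `t` and a reduced word `w`, `z w t` is negative
-- exactly if `t` is a last letter of `w`. Distinct roots have inner product 0 or at most -τ, and
-- this gap carries the signs from letter to letter; positivity in ℤ[τ] is expressed by nonnegative
-- coefficients of 1 and τ. Cells of equal size are equivalent under the stabiliser of the base
-- vertex, which turns facts about the 120 roots into finite checks at standard cells. The main
-- obstacle is to match the inductively defined `𝒫` with the cubes described by words. `next` refers
-- to values and yields only the cubes at the far vertex of a cube; the other cubes come from
-- `convex`, whose effect spreads over the links of the 600-cell from triangle to triangle.
-- Conversely, `convex` adds nothing inadmissible because a triangle lies in only two cells.

open import Defs
open import Algebra.Bundles using (CommutativeRing)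
open import Data.Bool.Base using (true; false; if_then_else_)
open import Data.Empty using (⊥; ⊥-elim)
open import Data.Fin.Base using (Fin; zero; suc)
import Data.Fin.Properties as Fin
open import Data.Integer.Base as ℤ using (ℤ; +_; -[1+_]; _+_; _-_; _*_)
import Data.Integer.Properties as ℤ
open import Data.Integer.Tactic.RingSolver using (solve-∀)
open import Data.List.Base as List
  using (List; []; _∷_; _++_; _∷ʳ_; applyUpTo; concat; deduplicate; drop; filter; length; map; reverse; take; upTo)
import Data.List.Properties as List
open import Data.List.Membership.Propositional using (_∈_; _∉_; find)
open import Data.List.Membership.Propositional.Properties
  using (∈-filter⁺; ∈-filter⁻; ∈-map⁺; ∈-map⁻; ∈-∃++; ∈-++⁻; ∈-++⁺ˡ; ∈-++⁺ʳ; ∈-concat⁺′; ∈-concat⁻′;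
         ∈-deduplicate⁺; ∈-deduplicate⁻; ∈-upTo⁺)
open import Data.List.Membership.Propositional.Properties.WithK using (unique∧set⇒bag)
open import Data.List.Membership.DecPropositional (Fin._≟_ {5}) using () renaming (_∈?_ to _∈ᶠ?_)
open import Data.List.Relation.Binary.BagAndSetEquality using (∼bag⇒↭)
open import Data.List.Relation.Binary.Permutation.Propositional
  using (_↭_; prep; swap) renaming (refl to ↭-refl; trans to ↭-trans)
open import Data.List.Relation.Binary.Permutation.Propositional.Properties
  using (filter-↭; ↭-length) renaming (map⁺ to map-↭)
open import Data.List.Relation.Binary.Pointwise using (Pointwise; []; _∷_)
open import Data.List.Relation.Binary.Subset.Propositional using (_⊆_)
open import Data.List.Relation.Unary.All as All using (All; []; _∷_; all?)
import Data.List.Relation.Unary.All.Properties as All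
open import Data.List.Relation.Unary.AllPairs as AllPairs using (AllPairs; []; _∷_)
import Data.List.Relation.Unary.AllPairs.Properties as AllPairs
open import Data.List.Relation.Unary.Any as Any using (here; there; any?)
import Data.List.Relation.Unary.Any.Properties as Any
open import Data.List.Relation.Unary.Unique.Propositional using (Unique)
import Data.List.Relation.Unary.Unique.Propositional.Properties as Unique
open import Data.Maybe.Base using (just; nothing)
open import Data.Nat.Base as ℕ using (ℕ; zero; suc; _∸_; _≤_; _<_; _≥_; z≤n; s≤s)
open import Data.Nat.ListAction using (sum)
open import Data.Nat.ListAction.Properties using (sum-++; sum-↭)
import Data.Nat.Properties as ℕ
import Data.Nat.Tactic.RingSolver as ℕSolver
open import Data.Product.Base using (Σ-syntax; ∃-syntax; _×_; _,_; proj₁; proj₂)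
import Data.Product.Properties as Product
open import Data.Sum.Base using (_⊎_; inj₁; inj₂)
open import Data.Unit.Base using (⊤; tt)
open import Data.Vec.Base as Vec using (Vec; []; _∷_; toList)
import Data.Vec.Properties as Vec
open import Function.Base using (_∘_)
open import Function.Bundles using (_⇔_; mk⇔; Equivalence)
open import Level using (0ℓ)
open import Relation.Binary.Definitions using (DecidableEquality)
open import Relation.Binary.PropositionalEquality hiding ([_])
open import Relation.Nullary.Decidable
  using (Dec; yes; no; does; True; toWitness; toWitnessFalse; map′; ¬?; _×-dec_; _⊎-dec_; _→-dec_;
         decidable-stable; dec-true; dec-false)
open import Relation.Nullary.Negation using (¬_)
open import Relation.Unary using (Decidable)
open import Tactic.RingSolver using () renaming (solve-∀ to solve-∀-in)
open import Tactic.RingSolver.Core.AlmostCommutativeRing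
  using (AlmostCommutativeRing; fromCommutativeRing)
open import Algebra.Properties.CommutativeSemigroup ℕ.+-commutativeSemigroup
  using () renaming (interchange to ℕ-interchange)

-- The ring ℤ[τ]

infix 4 _≟τ_ _≟ᴾ_

_≟τ_ : DecidableEquality ℤτ
[ a , b ] ≟τ [ c , d ] =
  map′ (λ { (refl , refl) → refl }) (λ { refl → refl , refl })
       ((a ℤ.≟ c) ×-dec (b ℤ.≟ d))

_≟ᴾ_ : DecidableEquality Point
_≟ᴾ_ = Vec.≡-dec _≟τ_

open import Data.List.Membership.DecPropositional _≟ᴾ_ using (_∈?_; _∉?_)
open import Data.List.Relation.Unary.Unique.DecPropositional _≟ᴾ_ using (unique?)
open import Data.List.Relation.Unary.Unique.DecPropositional.Properties _≟ᴾ_ using (deduplicate-!)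

⊝_ : ℤτ → ℤτ
⊝ [ a , b ] = [ ℤ.- a , ℤ.- b ]

ℤτ-commutativeRing : CommutativeRing 0ℓ 0ℓ
ℤτ-commutativeRing = record
  { _+_ = _⊕_ ; _*_ = _⊗_ ; -_ = ⊝_ ; 0# = 𝟘 ; 1# = 𝟙
  ; isCommutativeRing = record
    { isRing = record
      { +-isAbelianGroup = record
        { isGroup = record
          { isMonoid = record
            { isSemigroup = record
              { isMagma = isMagma _⊕_
              ; assoc = λ { [ a , b ] [ c , d ] [ e , f ] →
                  cong₂ [_,_] (ℤ.+-assoc a c e) (ℤ.+-assoc b d f) }
              }
            ; identity = (λ { [ a , b ] → cong₂ [_,_] (ℤ.+-identityˡ a) (ℤ.+-identityˡ b) })
                       , (λ { [ a , b ] → cong₂ [_,_] (ℤ.+-identityʳ a) (ℤ.+-identityʳ b) })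
            }
          ; inverse = (λ { [ a , b ] → cong₂ [_,_] (ℤ.+-inverseˡ a) (ℤ.+-inverseˡ b) })
                    , (λ { [ a , b ] → cong₂ [_,_] (ℤ.+-inverseʳ a) (ℤ.+-inverseʳ b) })
          ; ⁻¹-cong = cong ⊝_
          }
        ; comm = λ { [ a , b ] [ c , d ] → cong₂ [_,_] (ℤ.+-comm a c) (ℤ.+-comm b d) }
        }
      ; *-cong = cong₂ _⊗_
      ; *-assoc = λ { [ a , b ] [ c , d ] [ e , f ] →
          cong₂ [_,_] (assoc-rat a b c d e f) (assoc-irr a b c d e f) }
      ; *-identity = (λ { [ a , b ] → cong₂ [_,_] (idˡ-rat a b) (idˡ-irr a b) })
                   , (λ { [ a , b ] → cong₂ [_,_] (idʳ-rat a b) (idʳ-irr a b) })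
      ; distrib = (λ { [ a , b ] [ c , d ] [ e , f ] →
                       cong₂ [_,_] (distˡ-rat a b c d e f) (distˡ-irr a b c d e f) })
                , (λ { [ a , b ] [ c , d ] [ e , f ] →
                       cong₂ [_,_] (distʳ-rat a b c d e f) (distʳ-irr a b c d e f) })
      }
    ; *-comm = λ { [ a , b ] [ c , d ] → cong₂ [_,_] (comm-rat a b c d) (comm-irr a b c d) }
    }
  }
  where
  assoc-rat : ∀ a b c d e f →
    (a * c + b * d) * e + (a * d + b * c + b * d) * f ≡
    a * (c * e + d * f) + b * (c * f + d * e + d * f)
  assoc-rat = solve-∀
  assoc-irr : ∀ a b c d e f →
    (a * c + b * d) * f + (a * d + b * c + b * d) * e + (a * d + b * c + b * d) * f ≡
    a * (c * f + d * e + d * f) + b * (c * e + d * f) + b * (c * f + d * e + d * f)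
  assoc-irr = solve-∀
  idˡ-rat : ∀ a b → (+ 1) * a + (+ 0) * b ≡ a
  idˡ-rat = solve-∀
  idˡ-irr : ∀ a b → (+ 1) * b + (+ 0) * a + (+ 0) * b ≡ b
  idˡ-irr = solve-∀
  idʳ-rat : ∀ a b → a * (+ 1) + b * (+ 0) ≡ a
  idʳ-rat = solve-∀
  idʳ-irr : ∀ a b → a * (+ 0) + b * (+ 1) + b * (+ 0) ≡ b
  idʳ-irr = solve-∀
  distˡ-rat : ∀ a b c d e f →
    a * (c + e) + b * (d + f) ≡ a * c + b * d + (a * e + b * f)
  distˡ-rat = solve-∀
  distˡ-irr : ∀ a b c d e f →
    a * (d + f) + b * (c + e) + b * (d + f) ≡
    a * d + b * c + b * d + (a * f + b * e + b * f)
  distˡ-irr = solve-∀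
  distʳ-rat : ∀ a b c d e f →
    (c + e) * a + (d + f) * b ≡ c * a + d * b + (e * a + f * b)
  distʳ-rat = solve-∀
  distʳ-irr : ∀ a b c d e f →
    (c + e) * b + (d + f) * a + (d + f) * b ≡
    c * b + d * a + d * b + (e * b + f * a + f * b)
  distʳ-irr = solve-∀
  comm-rat : ∀ a b c d → a * c + b * d ≡ c * a + d * b
  comm-rat = solve-∀
  comm-irr : ∀ a b c d → a * d + b * c + b * d ≡ c * b + d * a + d * b
  comm-irr = solve-∀

-- Identities for the solver are stated with `⊕ ⊝` for `⊖`, with `𝟙 ⊕ 𝟙` for `𝟚` and with a variable
-- for τ or its inverse; at the point of use these forms agree by computation.
ℤτ-ring : AlmostCommutativeRing 0ℓ 0ℓ
ℤτ-ring = fromCommutativeRing ℤτ-commutativeRing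
  λ { [ + 0 , + 0 ] → just refl ; _ → nothing }

-- Isometries

infixl 6 _⊟_
infixr 8 _·_

_·_ : ∀ {n} → ℤτ → Vec ℤτ n → Vec ℤτ n
a · x = Vec.map (a ⊗_) x

_⊟_ : ∀ {n} → Vec ℤτ n → Vec ℤτ n → Vec ℤτ n
_⊟_ = Vec.zipWith _⊖_

⊟-0· : ∀ {n} (x s : Vec ℤτ n) → x ⊟ 𝟘 · s ≡ x
⊟-0· [] [] = refl
⊟-0· (x ∷ xs) (s ∷ ss) = cong₂ _∷_ (lemma x s) (⊟-0· xs ss)
  where
  lemma : ∀ x s → x ⊕ ⊝ (𝟘 ⊗ s) ≡ x
  lemma = solve-∀-in ℤτ-ring

⊟-merge : ∀ {n} a b (x s : Vec ℤτ n) → x ⊟ a · s ⊟ b · s ≡ x ⊟ (a ⊕ b) · s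
⊟-merge a b [] [] = refl
⊟-merge a b (x ∷ xs) (s ∷ ss) = cong₂ _∷_ (lemma a b x s) (⊟-merge a b xs ss)
  where
  lemma : ∀ a b x s → x ⊕ ⊝ (a ⊗ s) ⊕ ⊝ (b ⊗ s) ≡ x ⊕ ⊝ ((a ⊕ b) ⊗ s)
  lemma = solve-∀-in ℤτ-ring

⊟-swap : ∀ {n} a b (x s t : Vec ℤτ n) → x ⊟ a · s ⊟ b · t ≡ x ⊟ b · t ⊟ a · s
⊟-swap a b [] [] [] = refl
⊟-swap a b (x ∷ xs) (s ∷ ss) (t ∷ ts) = cong₂ _∷_ (lemma a b x s t) (⊟-swap a b xs ss ts)
  where
  lemma : ∀ a b x s t → x ⊕ ⊝ (a ⊗ s) ⊕ ⊝ (b ⊗ t) ≡ x ⊕ ⊝ (b ⊗ t) ⊕ ⊝ (a ⊗ s)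
  lemma = solve-∀-in ℤτ-ring

⊟-exchange : ∀ {n} a p q (x y s : Vec ℤτ n) →
  x ⊟ a · y ⊟ (p ⊖ a ⊗ q) · s ≡ x ⊟ p · s ⊟ a · (y ⊟ q · s)
⊟-exchange a p q [] [] [] = refl
⊟-exchange a p q (x ∷ xs) (y ∷ ys) (s ∷ ss) =
  cong₂ _∷_ (lemma a p q x y s) (⊟-exchange a p q xs ys ss)
  where
  lemma : ∀ a p q x y s → x ⊕ ⊝ (a ⊗ y) ⊕ ⊝ ((p ⊕ ⊝ (a ⊗ q)) ⊗ s) ≡
                          x ⊕ ⊝ (p ⊗ s) ⊕ ⊝ (a ⊗ (y ⊕ ⊝ (q ⊗ s)))
  lemma = solve-∀-in ℤτ-ring

dotτ : ∀ {n} → Vec ℤτ n → Vec ℤτ n → ℤτ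
dotτ x y = Vec.foldr′ _⊕_ 𝟘 (Vec.zipWith _⊗_ x y)

dotτ-comm : ∀ {n} (x y : Vec ℤτ n) → dotτ x y ≡ dotτ y x
dotτ-comm [] [] = refl
dotτ-comm (x ∷ xs) (y ∷ ys) = cong₂ _⊕_ (lemma x y) (dotτ-comm xs ys)
  where
  lemma : ∀ x y → x ⊗ y ≡ y ⊗ x
  lemma = solve-∀-in ℤτ-ring

dotτ-linear : ∀ {n} a (x y z : Vec ℤτ n) → dotτ (x ⊟ a · y) z ≡ dotτ x z ⊖ a ⊗ dotτ y z
dotτ-linear a [] [] [] = lemma a
  where
  lemma : ∀ a → 𝟘 ≡ 𝟘 ⊕ ⊝ (a ⊗ 𝟘)
  lemma = solve-∀-in ℤτ-ring
dotτ-linear a (x ∷ xs) (y ∷ ys) (z ∷ zs) =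
  trans (cong ((x ⊖ a ⊗ y) ⊗ z ⊕_) (dotτ-linear a xs ys zs)) (lemma a x y z (dotτ xs zs) (dotτ ys zs))
  where
  lemma : ∀ a x y z d e → (x ⊕ ⊝ (a ⊗ y)) ⊗ z ⊕ (d ⊕ ⊝ (a ⊗ e)) ≡
                          x ⊗ z ⊕ d ⊕ ⊝ (a ⊗ (y ⊗ z ⊕ e))
  lemma = solve-∀-in ℤτ-ring

⟨⟩-comm : ∀ x y → ⟨ x , y ⟩ ≡ ⟨ y , x ⟩
⟨⟩-comm (t ∷ x) (s ∷ y) = cong₂ _⊖_ (dotτ-comm x y) (lemma t s τ⁻¹)
  where
  lemma : ∀ t s c → c ⊗ (t ⊗ s) ≡ c ⊗ (s ⊗ t)
  lemma = solve-∀-in ℤτ-ring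

⟨⟩-linear : ∀ a x y z → ⟨ x ⊟ a · y , z ⟩ ≡ ⟨ x , z ⟩ ⊖ a ⊗ ⟨ y , z ⟩
⟨⟩-linear a (t ∷ x) (u ∷ y) (s ∷ z) =
  trans (cong (_⊖ τ⁻¹ ⊗ ((t ⊖ a ⊗ u) ⊗ s)) (dotτ-linear a x y z))
        (lemma a t u s τ⁻¹ (dotτ x z) (dotτ y z))
  where
  lemma : ∀ a t u s c d e → d ⊕ ⊝ (a ⊗ e) ⊕ ⊝ (c ⊗ ((t ⊕ ⊝ (a ⊗ u)) ⊗ s)) ≡
                            d ⊕ ⊝ (c ⊗ (t ⊗ s)) ⊕ ⊝ (a ⊗ (e ⊕ ⊝ (c ⊗ (u ⊗ s))))
  lemma = solve-∀-in ℤτ-ring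

⟨⟩-linearʳ : ∀ a x y z → ⟨ z , x ⊟ a · y ⟩ ≡ ⟨ z , x ⟩ ⊖ a ⊗ ⟨ z , y ⟩
⟨⟩-linearʳ a x y z = begin
  ⟨ z , x ⊟ a · y ⟩         ≡⟨ ⟨⟩-comm z (x ⊟ a · y) ⟩
  ⟨ x ⊟ a · y , z ⟩         ≡⟨ ⟨⟩-linear a x y z ⟩
  ⟨ x , z ⟩ ⊖ a ⊗ ⟨ y , z ⟩ ≡⟨ cong₂ (λ b c → b ⊖ a ⊗ c) (⟨⟩-comm x z) (⟨⟩-comm y z) ⟩
  ⟨ z , x ⟩ ⊖ a ⊗ ⟨ z , y ⟩ ∎
  where open ≡-Reasoning

-- Linearity is recorded only for the combination that occurs in `mirror`; this is enough to
-- conjugate reflections.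
record Isometry (f : Point → Point) : Set where
  field
    form   : ∀ x y → ⟨ f x , f y ⟩ ≡ ⟨ x , y ⟩
    linear : ∀ a x y → f (x ⊟ a · y) ≡ f x ⊟ a · f y

id-isometry : Isometry (λ x → x)
id-isometry = record { form = λ _ _ → refl ; linear = λ _ _ _ → refl }

∘-isometry : ∀ {f g} → Isometry f → Isometry g → Isometry (f ∘ g)
∘-isometry {f} {g} isoᶠ isoᵍ = record
  { form   = λ x y → trans (Isometry.form isoᶠ (g x) (g y)) (Isometry.form isoᵍ x y)
  ; linear = λ a x y → trans (cong f (Isometry.linear isoᵍ a x y)) (Isometry.linear isoᶠ a (g x) (g y))
  }

-- The reflection in the hyperplane orthogonal to s, if c = 2 / ⟨ s , s ⟩.
mirror : ℤτ → Point → Point → Point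
mirror c s x = x ⊟ (c ⊗ ⟨ x , s ⟩) · s

module _ {c s} (norm : c ⊗ ⟨ s , s ⟩ ≡ 𝟚) where

  ⟨mirror,s⟩ : ∀ x → ⟨ mirror c s x , s ⟩ ≡ ⊝ ⟨ x , s ⟩
  ⟨mirror,s⟩ x = begin
    ⟨ mirror c s x , s ⟩                      ≡⟨ ⟨⟩-linear (c ⊗ ⟨ x , s ⟩) x s s ⟩
    ⟨ x , s ⟩ ⊖ c ⊗ ⟨ x , s ⟩ ⊗ ⟨ s , s ⟩     ≡⟨ lemma c ⟨ x , s ⟩ ⟨ s , s ⟩ ⟩
    ⟨ x , s ⟩ ⊖ c ⊗ ⟨ s , s ⟩ ⊗ ⟨ x , s ⟩     ≡⟨ cong (λ d → ⟨ x , s ⟩ ⊖ d ⊗ ⟨ x , s ⟩) norm ⟩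
    ⟨ x , s ⟩ ⊖ 𝟚 ⊗ ⟨ x , s ⟩                 ≡⟨ lemma′ ⟨ x , s ⟩ ⟩
    ⊝ ⟨ x , s ⟩                               ∎
    where
    open ≡-Reasoning
    lemma : ∀ c p q → p ⊕ ⊝ (c ⊗ p ⊗ q) ≡ p ⊕ ⊝ (c ⊗ q ⊗ p)
    lemma = solve-∀-in ℤτ-ring
    lemma′ : ∀ p → p ⊕ ⊝ ((𝟙 ⊕ 𝟙) ⊗ p) ≡ ⊝ p
    lemma′ = solve-∀-in ℤτ-ring

  mirror-involutive : ∀ x → mirror c s (mirror c s x) ≡ x
  mirror-involutive x = begin
    x ⊟ a · s ⊟ (c ⊗ ⟨ mirror c s x , s ⟩) · s ≡⟨ cong (λ d → x ⊟ a · s ⊟ (c ⊗ d) · s) (⟨mirror,s⟩ x) ⟩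
    x ⊟ a · s ⊟ (c ⊗ ⊝ ⟨ x , s ⟩) · s          ≡⟨ ⊟-merge a (c ⊗ ⊝ ⟨ x , s ⟩) x s ⟩
    x ⊟ (a ⊕ c ⊗ ⊝ ⟨ x , s ⟩) · s              ≡⟨ cong (λ d → x ⊟ d · s) (lemma c ⟨ x , s ⟩) ⟩
    x ⊟ 𝟘 · s                                  ≡⟨ ⊟-0· x s ⟩
    x                                          ∎
    where
    open ≡-Reasoning
    a = c ⊗ ⟨ x , s ⟩
    lemma : ∀ c p → c ⊗ p ⊕ c ⊗ ⊝ p ≡ 𝟘
    lemma = solve-∀-in ℤτ-ring

  mirror-isometry : Isometry (mirror c s)
  mirror-isometry = record { form = form′ ; linear = linear′ }
    where
    open ≡-Reasoning
    form′ : ∀ x y → ⟨ mirror c s x , mirror c s y ⟩ ≡ ⟨ x , y ⟩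
    form′ x y = begin
      ⟨ mirror c s x , mirror c s y ⟩
        ≡⟨ ⟨⟩-linearʳ (c ⊗ ⟨ y , s ⟩) y s (mirror c s x) ⟩
      ⟨ mirror c s x , y ⟩ ⊖ c ⊗ ⟨ y , s ⟩ ⊗ ⟨ mirror c s x , s ⟩
        ≡⟨ cong₂ (λ p q → p ⊖ c ⊗ ⟨ y , s ⟩ ⊗ q) (⟨⟩-linear (c ⊗ ⟨ x , s ⟩) x s y) (⟨mirror,s⟩ x) ⟩
      ⟨ x , y ⟩ ⊖ c ⊗ ⟨ x , s ⟩ ⊗ ⟨ s , y ⟩ ⊖ c ⊗ ⟨ y , s ⟩ ⊗ ⊝ ⟨ x , s ⟩
        ≡⟨ cong (λ p → ⟨ x , y ⟩ ⊖ c ⊗ ⟨ x , s ⟩ ⊗ p ⊖ c ⊗ ⟨ y , s ⟩ ⊗ ⊝ ⟨ x , s ⟩) (⟨⟩-comm s y) ⟩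
      ⟨ x , y ⟩ ⊖ c ⊗ ⟨ x , s ⟩ ⊗ ⟨ y , s ⟩ ⊖ c ⊗ ⟨ y , s ⟩ ⊗ ⊝ ⟨ x , s ⟩
        ≡⟨ lemma ⟨ x , y ⟩ c ⟨ x , s ⟩ ⟨ y , s ⟩ ⟩
      ⟨ x , y ⟩ ∎
      where
      lemma : ∀ a c p q → a ⊕ ⊝ (c ⊗ p ⊗ q) ⊕ ⊝ (c ⊗ q ⊗ ⊝ p) ≡ a
      lemma = solve-∀-in ℤτ-ring
    linear′ : ∀ a x y → mirror c s (x ⊟ a · y) ≡ mirror c s x ⊟ a · mirror c s y
    linear′ a x y = begin
      x ⊟ a · y ⊟ (c ⊗ ⟨ x ⊟ a · y , s ⟩) · s
        ≡⟨ cong (λ d → x ⊟ a · y ⊟ (c ⊗ d) · s) (⟨⟩-linear a x y s) ⟩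
      x ⊟ a · y ⊟ (c ⊗ (⟨ x , s ⟩ ⊖ a ⊗ ⟨ y , s ⟩)) · s
        ≡⟨ cong (λ d → x ⊟ a · y ⊟ d · s) (lemma c ⟨ x , s ⟩ a ⟨ y , s ⟩) ⟩
      x ⊟ a · y ⊟ (c ⊗ ⟨ x , s ⟩ ⊖ a ⊗ (c ⊗ ⟨ y , s ⟩)) · s
        ≡⟨ ⊟-exchange a (c ⊗ ⟨ x , s ⟩) (c ⊗ ⟨ y , s ⟩) x y s ⟩
      mirror c s x ⊟ a · mirror c s y ∎
      where
      lemma : ∀ c p a q → c ⊗ (p ⊕ ⊝ (a ⊗ q)) ≡ c ⊗ p ⊕ ⊝ (a ⊗ (c ⊗ q))
      lemma = solve-∀-in ℤτ-ring

mirror-conj : ∀ {f} → Isometry f → ∀ c s x → f (mirror c s x) ≡ mirror c (f s) (f x)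
mirror-conj {f} iso c s x =
  trans (Isometry.linear iso (c ⊗ ⟨ x , s ⟩) x s) (cong (λ d → f x ⊟ (c ⊗ d) · f s) (sym (Isometry.form iso x s)))

mirror-fix : ∀ c {s x} → ⟨ x , s ⟩ ≡ 𝟘 → mirror c s x ≡ x
mirror-fix c {s} {x} orth = begin
  x ⊟ (c ⊗ ⟨ x , s ⟩) · s ≡⟨ cong (λ d → x ⊟ (c ⊗ d) · s) orth ⟩
  x ⊟ (c ⊗ 𝟘) · s         ≡⟨ cong (λ d → x ⊟ d · s) (lemma c) ⟩
  x ⊟ 𝟘 · s               ≡⟨ ⊟-0· x s ⟩
  x                       ∎
  where
  open ≡-Reasoning
  lemma : ∀ c → c ⊗ 𝟘 ≡ 𝟘
  lemma = solve-∀-in ℤτ-ring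

reflect-norm : ∀ i → scale i ⊗ ⟨ root i , root i ⟩ ≡ 𝟚
reflect-norm zero = refl
reflect-norm (suc zero) = refl
reflect-norm (suc (suc zero)) = refl
reflect-norm (suc (suc (suc zero))) = refl
reflect-norm (suc (suc (suc (suc zero)))) = refl

reflect-isometry : ∀ i → Isometry (reflect i)
reflect-isometry i = mirror-isometry {scale i} {root i} (reflect-norm i)

reflect-involutive : ∀ i x → reflect i (reflect i x) ≡ x
reflect-involutive i = mirror-involutive {scale i} {root i} (reflect-norm i)

act-isometry : ∀ w → Isometry (act w)
act-isometry []      = id-isometry
act-isometry (i ∷ w) = ∘-isometry (reflect-isometry i) (act-isometry w)

act-++ : ∀ v w x → act (v ++ w) x ≡ act v (act w x)
act-++ v w x = List.foldr-++ reflect x v w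

act-reverse : ∀ w x → act (reverse w) (act w x) ≡ x
act-reverse []      x = refl
act-reverse (i ∷ w) x = begin
  act (reverse (i ∷ w)) (act (i ∷ w) x)             ≡⟨ cong (λ v → act v (act (i ∷ w) x)) (List.unfold-reverse i w) ⟩
  act (reverse w ++ i ∷ []) (act (i ∷ w) x)         ≡⟨ act-++ (reverse w) (i ∷ []) (act (i ∷ w) x) ⟩
  act (reverse w) (reflect i (reflect i (act w x))) ≡⟨ cong (act (reverse w)) (reflect-involutive i (act w x)) ⟩
  act (reverse w) (act w x)                         ≡⟨ act-reverse w x ⟩
  x                                                 ∎
  where open ≡-Reasoning

act-reverse′ : ∀ w x → act w (act (reverse w) x) ≡ x
act-reverse′ w x =
  trans (cong (λ v → act v (act (reverse w) x)) (sym (List.reverse-involutive w))) (act-reverse (reverse w) x)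

-- The 600-cell

infix 4 _≤τ_

-- The cone of nonnegative coefficients replaces the real order: it is closed under sums and
-- products and is recognised by its constructor. The integer bound on the sum of the coefficients
-- makes positivity discrete, which later allows counting.
data _≤τ_ (n : ℕ) : ℤτ → Set where
  weight : ∀ a b → n ≤ a ℕ.+ b → n ≤τ [ + a , + b ]

NonNeg Pos : ℤτ → Set
NonNeg = 0 ≤τ_
Pos    = 1 ≤τ_

nonNeg? : Decidable NonNeg
nonNeg? [ + a , + b ]       = yes (weight a b z≤n)
nonNeg? [ + _ , -[1+ _ ] ]  = no λ ()
nonNeg? [ -[1+ _ ] , _ ]    = no λ ()

Adj : Point → Point → Set
Adj s t = ⟨ s , t ⟩ ≡ 𝟘

adj? : ∀ s t → Dec (Adj s t)
adj? s t = ⟨ s , t ⟩ ≟τ 𝟘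

opaque
  c₀ : Point
  c₀ = centre vertex

  c₀≡ : c₀ ≡ centre vertex
  c₀≡ = refl

-- The directions of the four edges of the hypercube at its vertex c₀.
e : ℕ → Point
e 0 = 𝟘 ∷ 𝟙 ∷ 𝟘 ∷ 𝟘 ∷ 𝟘 ∷ []
e 1 = 𝟘 ∷ 𝟘 ∷ 𝟙 ∷ 𝟘 ∷ 𝟘 ∷ []
e 2 = 𝟘 ∷ 𝟘 ∷ 𝟘 ∷ 𝟙 ∷ 𝟘 ∷ []
e _ = 𝟘 ∷ 𝟘 ∷ 𝟘 ∷ 𝟘 ∷ 𝟙 ∷ []

std : ℕ → List Point
std zero    = []
std (suc k) = e k ∷ std k

Fixes : List Point → Fin 5 → Set
Fixes xs i = All (λ x → reflect i x ≡ x) xs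

fixes? : ∀ xs → Decidable (Fixes xs)
fixes? xs i = all? (λ x → reflect i x ≟ᴾ x) xs

act-fixes : ∀ {xs w x} → All (Fixes xs) w → x ∈ xs → act w x ≡ x
act-fixes []       x∈ = refl
act-fixes {w = i ∷ w} (f ∷ fs) x∈ = trans (cong (reflect i) (act-fixes fs x∈)) (All.lookup f x∈)

Orbit : List (Fin 5) → Point → Point → Set
Orbit is x y = ∃[ w ] (All (_∈ is) w × act w x ≡ y)

module _ (is : List (Fin 5)) where

  -- Breadth-first search, of which only soundness is proved; completeness comes afterwards from
  -- `roots-closed` and `neighbours-transitive`. Each unit of fuel treats one vertex, so 120 units
  -- suffice for the 600-cell.
  explore : ℕ → List Point → List Point → List Point
  explore zero    queue       seen = seen
  explore (suc k) []          seen = seen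
  explore (suc k) (x ∷ queue) seen = explore k (queue ++ new) (seen ++ new)
    where new = deduplicate _≟ᴾ_ (filter (_∉? seen) (List.map (λ i → reflect i x) is))

  explore-orbit : ∀ {x} k {queue seen} → All (Orbit is x) queue → All (Orbit is x) seen →
                  All (Orbit is x) (explore k queue seen)
  explore-orbit zero    qs ss = ss
  explore-orbit (suc k) []       ss = ss
  explore-orbit {x} (suc k) {y ∷ queue} {seen} (q ∷ qs) ss =
    explore-orbit k (All.++⁺ qs new) (All.++⁺ ss new)
    where
    images : All (Orbit is x) (List.map (λ i → reflect i y) is)
    images = All.map⁺ (All.tabulate λ {i} i∈ → let w , w⊆ , eq = q in
      i ∷ w , i∈ ∷ w⊆ , cong (reflect i) eq)
    new : All (Orbit is x) (deduplicate _≟ᴾ_ (filter (_∉? seen) (List.map (λ i → reflect i y) is)))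
    new = All.tabulate λ z∈ → All.lookup images
      (proj₁ (∈-filter⁻ (_∉? seen) (∈-deduplicate⁻ _≟ᴾ_ _ z∈)))

-- For `k ≤ 3` these generators fix `c₀` and `std k`. So `orbit k` consists of roots completing
-- `std k` to a larger clique: the 120 vertices of the 600-cell, then the 12, 5 and 2 vertices of
-- the links of a vertex, an edge and a triangle.
gens : ℕ → List (Fin 5)
gens k = drop (suc k) (List.allFin 5)

Root : Point → Set
Root = Orbit (gens 0) (e 0)

opaque
  orbit : ℕ → List Point
  orbit k = explore (gens k) 120 (e k ∷ []) (e k ∷ [])

  ∈orbit⇒Orbit : ∀ k {x} → x ∈ orbit k → Orbit (gens k) (e k) x
  ∈orbit⇒Orbit k = All.lookup (explore-orbit (gens k) 120 (([] , [] , refl) ∷ []) (([] , [] , refl) ∷ []))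

roots : List Point
roots = orbit 0

opaque
  unfolding orbit

  e0∈roots : e 0 ∈ roots
  e0∈roots = toWitness {a? = e 0 ∈? roots} _

  roots-closed : All (λ x → All (λ i → reflect i x ∈ roots) (gens 0)) roots
  roots-closed = toWitness {a? = check roots} _
    where
    -- The list is a parameter so that its evaluation is shared by all the membership tests.
    check : ∀ xs → Dec (All (λ x → All (λ i → reflect i x ∈ xs) (gens 0)) xs)
    check xs = all? (λ x → all? (λ i → reflect i x ∈? xs) (gens 0)) xs

  roots-unique : Unique roots
  roots-unique = toWitness {a? = unique? roots} _

  neighbours-in? : ∀ k xs ys → Dec (All (λ t → All (Adj t) (std k) → t ∈ ys) xs)
  neighbours-in? k xs ys = all? (λ t → all? (adj? t) (std k) →-dec t ∈? ys) xs

  -- The inductive step of flag transitivity: the generators fixing `std k` already act transitively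
  -- on its common neighbours.
  neighbours-transitive : ∀ k → k ≤ 3 →
    All (λ t → All (Adj t) (std k) → t ∈ orbit k) roots
  neighbours-transitive 0 _ = toWitness {a? = neighbours-in? 0 roots (orbit 0)} _
  neighbours-transitive 1 _ = toWitness {a? = neighbours-in? 1 roots (orbit 1)} _
  neighbours-transitive 2 _ = toWitness {a? = neighbours-in? 2 roots (orbit 2)} _
  neighbours-transitive 3 _ = toWitness {a? = neighbours-in? 3 roots (orbit 3)} _
  neighbours-transitive (suc (suc (suc (suc _)))) (s≤s (s≤s (s≤s ())))

  no-5-cliques : All (λ t → ¬ All (Adj t) (std 4)) roots
  no-5-cliques = toWitness {a? = all? (λ t → ¬? (all? (adj? t) (std 4))) roots} _

  -- Two walls cross at right angles or diverge. Since the roots form one orbit, `e 0` represents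
  -- the general case; the gap between 0 and -τ drives the induction on signs.
  gram-cases : All (λ t → e 0 ≡ t ⊎ Adj (e 0) t ⊎ NonNeg (⊝ ⟨ e 0 , t ⟩ ⊖ τ)) roots
  gram-cases = toWitness {a? = all? (λ t → (e 0 ≟ᴾ t) ⊎-dec adj? (e 0) t ⊎-dec nonNeg? (⊝ ⟨ e 0 , t ⟩ ⊖ τ)) roots} _

Root⇒∈roots : ∀ {x} → Root x → x ∈ roots
Root⇒∈roots ([]    , _       , refl) = e0∈roots
Root⇒∈roots (i ∷ w , i∈ ∷ w⊆ , refl) =
  All.lookup (All.lookup roots-closed (Root⇒∈roots (w , w⊆ , refl))) i∈

∈roots⇒Root : ∀ {x} → x ∈ roots → Root x
∈roots⇒Root = ∈orbit⇒Orbit 0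

-- Words in the generators of the stabiliser of c₀.
Isotropy : List (Fin 5) → Set
Isotropy = All (_∈ gens 0)

Isotropy-reverse : ∀ {w} → Isotropy w → Isotropy (reverse w)
Isotropy-reverse {w} w⊆ = All.tabulate λ i∈ → All.lookup w⊆ (Any.reverse⁻ i∈)

opaque
  unfolding c₀

  gens-fix-c₀ : All (Fixes (c₀ ∷ [])) (gens 0)
  gens-fix-c₀ = toWitness {a? = all? (fixes? (c₀ ∷ [])) (gens 0)} _

  ⟨c₀,e0⟩ : ⟨ c₀ , e 0 ⟩ ≡ 𝟙
  ⟨c₀,e0⟩ = refl

Isotropy-c₀ : ∀ {w} → Isotropy w → act w c₀ ≡ c₀
Isotropy-c₀ w⊆ = act-fixes {c₀ ∷ []} (All.map (All.lookup gens-fix-c₀) w⊆) (here refl)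

act-Root : ∀ {w x} → Isotropy w → Root x → Root (act w x)
act-Root {w} w⊆ (v , v⊆ , refl) = w ++ v , All.++⁺ w⊆ v⊆ , act-++ w v (e 0)

Root-e : ∀ k → Root (e k)
Root-e 0 = ∈roots⇒Root e0∈roots
Root-e 1 = suc zero ∷ [] , here refl ∷ [] , refl
Root-e 2 = suc (suc zero) ∷ suc zero ∷ [] , there (here refl) ∷ here refl ∷ [] , refl
Root-e (suc (suc (suc _))) =
  suc (suc (suc zero)) ∷ suc (suc zero) ∷ suc zero ∷ [] ,
  there (there (here refl)) ∷ there (here refl) ∷ here refl ∷ [] , refl

act-form : ∀ w x y → ⟨ act w x , act w y ⟩ ≡ ⟨ x , y ⟩
act-form w = Isometry.form (act-isometry w)

Root-norm : ∀ {s} → Root s → ⟨ s , s ⟩ ≡ 𝟙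
Root-norm (w , _ , refl) = act-form w (e 0) (e 0)

⟨c₀,root⟩ : ∀ {s} → Root s → ⟨ c₀ , s ⟩ ≡ 𝟙
⟨c₀,root⟩ (w , w⊆ , refl) =
  trans (cong (λ x → ⟨ x , act w (e 0) ⟩) (sym (Isotropy-c₀ w⊆))) (trans (act-form w c₀ (e 0)) ⟨c₀,e0⟩)

Adj-sym : ∀ {s t} → Adj s t → Adj t s
Adj-sym {s} {t} adj = trans (⟨⟩-comm t s) adj

act-Adj⁻ : ∀ w {s t} → Adj (act w s) (act w t) → Adj s t
act-Adj⁻ w {s} {t} adj = trans (sym (act-form w s t)) adj

act-Adj : ∀ w {s t} → Adj s t → Adj (act w s) (act w t)
act-Adj w {s} {t} adj = trans (act-form w s t) adj

Root-irrefl : ∀ {s} → Root s → ¬ Adj s s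
Root-irrefl r adj with () ← trans (sym adj) (Root-norm r)

gram : ∀ {s t} → Root s → Root t → s ≡ t ⊎ Adj s t ⊎ NonNeg (⊝ ⟨ s , t ⟩ ⊖ τ)
gram {s} {t} (w , w⊆ , refl) t-root
  with All.lookup gram-cases (Root⇒∈roots (act-Root (Isotropy-reverse w⊆) t-root))
... | inj₁ eq = inj₁ (trans (cong (act w) eq) (act-reverse′ w t))
... | inj₂ (inj₁ adj) = inj₂ (inj₁ (trans (sym (transport)) adj))
  where
  transport : ⟨ e 0 , act (reverse w) t ⟩ ≡ ⟨ act w (e 0) , t ⟩
  transport = trans (sym (act-form w _ _)) (cong (λ x → ⟨ act w (e 0) , x ⟩) (act-reverse′ w t))
... | inj₂ (inj₂ pos) = inj₂ (inj₂ (subst (λ p → NonNeg (⊝ p ⊖ τ)) transport pos))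
  where
  transport : ⟨ e 0 , act (reverse w) t ⟩ ≡ ⟨ act w (e 0) , t ⟩
  transport = trans (sym (act-form w _ _)) (cong (λ x → ⟨ act w (e 0) , x ⟩) (act-reverse′ w t))

record Clique (c : List Point) : Set where
  constructor clique
  field
    areRoots  : All Root c
    adjacents : AllPairs Adj c

open Clique public

gens-fix-std : ∀ k → k ≤ 3 → All (λ i → i ∈ gens 0 × Fixes (std k) i) (gens k)
gens-fix-std 0 _ = toWitness {a? = all? (λ i → (i ∈ᶠ? gens 0) ×-dec fixes? (std 0) i) (gens 0)} _
gens-fix-std 1 _ = toWitness {a? = all? (λ i → (i ∈ᶠ? gens 0) ×-dec fixes? (std 1) i) (gens 1)} _
gens-fix-std 2 _ = toWitness {a? = all? (λ i → (i ∈ᶠ? gens 0) ×-dec fixes? (std 2) i) (gens 2)} _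
gens-fix-std 3 _ = toWitness {a? = all? (λ i → (i ∈ᶠ? gens 0) ×-dec fixes? (std 3) i) (gens 3)} _
gens-fix-std (suc (suc (suc (suc _)))) (s≤s (s≤s (s≤s ())))

-- Cliques are ordered lists, so this is transitivity on flags. Once the tail is in standard
-- position, the head is a common neighbour of `std k` and is moved to `e k` by generators fixing
-- `std k`. The bound 4 holds because `std 4` has no common neighbour.
homogeneous : ∀ {c} → Clique c →
  length c ≤ 4 × ∃[ w ] (Isotropy w × c ≡ List.map (act w) (std (length c)))
homogeneous {[]}    _ = z≤n , [] , [] , refl
homogeneous {x ∷ c} (clique (x-root ∷ c-roots) (x-adj ∷ adjs))
  with c≤4 , w , w⊆ , c≡ ← homogeneous (clique c-roots adjs) =
  s≤s c≤3 , w ++ v , All.++⁺ w⊆ (All.map (λ i∈ → proj₁ (All.lookup fixing i∈)) v⊆) ,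
  cong₂ _∷_ x≡ (trans c≡ (List.map-cong-local (All.tabulate λ {y} y∈ →
    sym (trans (act-++ w v y)
      (cong (act w) (act-fixes (All.map (λ i∈ → proj₂ (All.lookup fixing i∈)) v⊆) y∈))))))
  where
  k = length c
  t = act (reverse w) x
  act-t : act w t ≡ x
  act-t = act-reverse′ w x
  t∈ : t ∈ roots
  t∈ = Root⇒∈roots (act-Root (Isotropy-reverse w⊆) x-root)
  t-adj : All (Adj t) (std k)
  t-adj = All.tabulate λ {y} y∈ → act-Adj⁻ w (subst (λ z → Adj z (act w y)) (sym act-t)
    (All.lookup x-adj (subst (act w y ∈_) (sym c≡) (∈-map⁺ (act w) y∈))))
  c≤3 : k ≤ 3
  c≤3 with ℕ.m≤n⇒m<n∨m≡n c≤4
  ... | inj₁ (s≤s k≤3) = k≤3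
  ... | inj₂ k≡4       = ⊥-elim (All.lookup no-5-cliques t∈ (subst (λ n → All (Adj t) (std n)) k≡4 t-adj))
  fixing = gens-fix-std k c≤3
  t-orbit : Orbit (gens k) (e k) t
  t-orbit = ∈orbit⇒Orbit k (All.lookup (neighbours-transitive k c≤3) t∈ t-adj)
  v = proj₁ t-orbit
  v⊆ = proj₁ (proj₂ t-orbit)
  x≡ : x ≡ act (w ++ v) (e k)
  x≡ = sym (trans (act-++ w v (e k)) (trans (cong (act w) (proj₂ (proj₂ t-orbit))) act-t))

-- Reduced words and signs

≤τ-weaken : ∀ {m n x} → m ≤ n → n ≤τ x → m ≤τ x
≤τ-weaken m≤n (weight a b n≤) = weight a b (ℕ.≤-trans m≤n n≤)

≤τ-⊕ : ∀ {m n x y} → m ≤τ x → n ≤τ y → (m ℕ.+ n) ≤τ (x ⊕ y)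
≤τ-⊕ {m} {n} (weight a b m≤) (weight c d n≤) = weight (a ℕ.+ c) (b ℕ.+ d)
  (subst (m ℕ.+ n ≤_) (ℕ-interchange a b c d) (ℕ.+-mono-≤ m≤ n≤))

NonNeg-⊗ : ∀ {x y} → NonNeg x → NonNeg y → NonNeg (x ⊗ y)
NonNeg-⊗ (weight a b _) (weight c d _) = subst NonNeg
  (cong₂ [_,_]
    (cong₂ ℤ._+_ (ℤ.pos-* a c) (ℤ.pos-* b d))
    (cong₂ ℤ._+_ (cong₂ ℤ._+_ (ℤ.pos-* a d) (ℤ.pos-* b c)) (ℤ.pos-* b d)))
  (weight (a ℕ.* c ℕ.+ b ℕ.* d) (a ℕ.* d ℕ.+ b ℕ.* c ℕ.+ b ℕ.* d) z≤n)

≤τ-τ⊗ : ∀ {n x} → n ≤τ x → n ≤τ (τ ⊗ x)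
≤τ-τ⊗ {n} (weight a b n≤) = subst (n ≤τ_) (sym τ⊗) (weight b (a ℕ.+ b)
  (ℕ.≤-trans n≤ (ℕ.m≤n+m (a ℕ.+ b) b)))
  where
  τ⊗ : τ ⊗ [ + a , + b ] ≡ [ + b , + (a ℕ.+ b) ]
  τ⊗ = cong₂ [_,_]
    (trans (ℤ.+-identityˡ _) (ℤ.*-identityˡ (+ b)))
    (cong₂ ℤ._+_ (trans (ℤ.+-identityˡ _) (ℤ.*-identityˡ (+ a))) (ℤ.*-identityˡ (+ b)))

Pos-⊝ : ∀ {x} → Pos x → ¬ Pos (⊝ x)
Pos-⊝ (weight zero    zero    ()) _
Pos-⊝ (weight zero    (suc b) _) ()
Pos-⊝ (weight (suc a) b       _) ()

NonNeg-+ : ∀ {x y} → NonNeg x → NonNeg y → NonNeg (x ⊕ y)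
NonNeg-+ = ≤τ-⊕ {0} {0}

Pos-+ : ∀ {x y} → Pos x → NonNeg y → Pos (x ⊕ y)
Pos-+ = ≤τ-⊕ {1} {0}

Pos⇒NonNeg : ∀ {x} → Pos x → NonNeg x
Pos⇒NonNeg = ≤τ-weaken z≤n

-- The word w = sₙ ∷ … ∷ s₁ ∷ [] denotes the product of the reflections
-- in s₁, …, sₙ in this order.
opaque
  R : Point → Point → Point
  R = mirror 𝟚

  R≡ : ∀ s x → R s x ≡ x ⊟ (𝟚 ⊗ ⟨ x , s ⟩) · s
  R≡ s x = refl

⟦_⟧ : List Point → Point → Point
⟦ [] ⟧    x = x
⟦ s ∷ w ⟧ x = ⟦ w ⟧ (R s x)

Root-2norm : ∀ {s} → Root s → 𝟚 ⊗ ⟨ s , s ⟩ ≡ 𝟚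
Root-2norm r = cong (𝟚 ⊗_) (Root-norm r)

opaque
  unfolding R

  R-isometry : ∀ {s} → Root s → Isometry (R s)
  R-isometry {s} r = mirror-isometry {𝟚} {s} (Root-2norm r)

  R-conj : ∀ {f} → Isometry f → ∀ s x → f (R s x) ≡ R (f s) (f x)
  R-conj iso = mirror-conj iso 𝟚

  reflect-zero : ∀ x → reflect zero x ≡ R (e 0) x
  reflect-zero x = refl

  R-involutive : ∀ {s} → Root s → ∀ x → R s (R s x) ≡ x
  R-involutive {s} r = mirror-involutive {𝟚} {s} (Root-2norm r)

  R-fix : ∀ {s t} → Adj s t → R s t ≡ t
  R-fix {s} {t} adj = mirror-fix 𝟚 (Adj-sym {s} {t} adj)

  R-comm : ∀ {s t} → Root s → Adj s t → ∀ x → R s (R t x) ≡ R t (R s x)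
  R-comm {s} {t} r adj x = trans (mirror-conj (R-isometry r) 𝟚 t x) (cong (λ u → mirror 𝟚 u (R s x)) (R-fix {s} {t} adj))

R-self : ∀ {s} → Root s → ∀ {f} → Isometry f → ∀ x → ⟨ x , f (R s s) ⟩ ≡ ⊝ ⟨ x , f s ⟩
R-self {s} r {f} iso x = begin
  ⟨ x , f (R s s) ⟩                             ≡⟨ cong (λ y → ⟨ x , y ⟩) (trans (cong f (R≡ s s)) (Isometry.linear iso (𝟚 ⊗ ⟨ s , s ⟩) s s)) ⟩
  ⟨ x , f s ⊟ (𝟚 ⊗ ⟨ s , s ⟩) · f s ⟩           ≡⟨ ⟨⟩-linearʳ (𝟚 ⊗ ⟨ s , s ⟩) (f s) (f s) x ⟩
  ⟨ x , f s ⟩ ⊖ 𝟚 ⊗ ⟨ s , s ⟩ ⊗ ⟨ x , f s ⟩     ≡⟨ cong (λ c → ⟨ x , f s ⟩ ⊖ c ⊗ ⟨ x , f s ⟩) (Root-2norm r) ⟩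
  ⟨ x , f s ⟩ ⊖ 𝟚 ⊗ ⟨ x , f s ⟩                 ≡⟨ lemma ⟨ x , f s ⟩ ⟩
  ⊝ ⟨ x , f s ⟩                                 ∎
  where
  open ≡-Reasoning
  lemma : ∀ p → p ⊕ ⊝ ((𝟙 ⊕ 𝟙) ⊗ p) ≡ ⊝ p
  lemma = solve-∀-in ℤτ-ring

word-isometry : ∀ {w} → All Root w → Isometry ⟦ w ⟧
word-isometry []       = id-isometry
word-isometry (r ∷ rs) = ∘-isometry (word-isometry rs) (R-isometry r)

-- The last letters of the reduced words for w.
desc : List Point → List Point
desc []      = []
desc (s ∷ w) = s ∷ filter (adj? s) (desc w)

-- In a right-angled group a word shortens only when a letter meets an equal one after commutations,
-- that is, when the new letter is already a last letter.
data Reduced : List Point → Set where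
  []   : Reduced []
  step : ∀ {s w} → Root s → s ∉ desc w → Reduced w → Reduced (s ∷ w)

Reduced⇒Root : ∀ {w} → Reduced w → All Root w
Reduced⇒Root []             = []
Reduced⇒Root (step r _ red) = r ∷ Reduced⇒Root red

desc⊆ : ∀ w {t} → t ∈ desc w → t ∈ w
desc⊆ (s ∷ w) (here eq)  = here eq
desc⊆ (s ∷ w) (there t∈) = there (desc⊆ w (proj₁ (∈-filter⁻ (adj? s) t∈)))

desc-Root : ∀ {w t} → All Root w → t ∈ desc w → Root t
desc-Root {w} rs t∈ = All.lookup rs (desc⊆ w t∈)

desc-clique : ∀ {w} → All Root w → Clique (desc w)
desc-clique []       = clique [] []
desc-clique {s ∷ w} (r ∷ rs) with clique cs as ← desc-clique rs =
  clique (r ∷ All.filter⁺ (adj? s) cs) (All.all-filter (adj? s) (desc w) ∷ AllPairs.filter⁺ (adj? s) as)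

clique-Adj : ∀ {c s t} → AllPairs Adj c → s ∈ c → t ∈ c → s ≡ t ⊎ Adj s t
clique-Adj (_ ∷ _)  (here refl) (here refl) = inj₁ refl
clique-Adj (a ∷ _)  (here refl) (there t∈)  = inj₂ (All.lookup a t∈)
clique-Adj {s = s} {t} (a ∷ _)  (there s∈)  (here refl) = inj₂ (Adj-sym {t} {s} (All.lookup a s∈))
clique-Adj (_ ∷ as) (there s∈)  (there t∈)  = clique-Adj as s∈ t∈

-- The sign tells on which side of a wall `c₀` lies, namely the wall crossed by the edge in
-- direction `t` at the vertex of `w`: positive if this edge leads away from `c₀`, negative if it
-- leads back.
z : List Point → Point → ℤτ
z w t = ⟨ c₀ , ⟦ w ⟧ t ⟩

z-step : ∀ {s w} → All Root w → ∀ t → z (s ∷ w) t ≡ z w t ⊖ 𝟚 ⊗ ⟨ t , s ⟩ ⊗ z w s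
z-step {s} {w} rs t = trans
  (cong (λ x → ⟨ c₀ , x ⟩) (trans (cong ⟦ w ⟧ (R≡ s t)) (Isometry.linear (word-isometry rs) (𝟚 ⊗ ⟨ t , s ⟩) t s)))
  (⟨⟩-linearʳ (𝟚 ⊗ ⟨ t , s ⟩) (⟦ w ⟧ t) (⟦ w ⟧ s) c₀)

z-self : ∀ {s w} → Root s → All Root w → z (s ∷ w) s ≡ ⊝ z w s
z-self r rs = R-self r (word-isometry rs) c₀

z-adj : ∀ {s t} w → Adj s t → z (s ∷ w) t ≡ z w t
z-adj {s} {t} w adj = cong (z w) (R-fix {s} {t} adj)

-- Splits `⊝ ⟨ t , s ⟩` into τ and the surplus that `gram` makes nonnegative for distinct
-- non-adjacent roots.
z-far : ∀ {s w} → All Root w → ∀ t →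
  z (s ∷ w) t ≡ z w t ⊕ 𝟚 ⊗ (τ ⊕ (⊝ ⟨ t , s ⟩ ⊖ τ)) ⊗ z w s
z-far {s} {w} rs t = trans (z-step rs t) (lemma τ ⟨ t , s ⟩ (z w t) (z w s))
  where
  lemma : ∀ k g x y → x ⊕ ⊝ ((𝟙 ⊕ 𝟙) ⊗ g ⊗ y) ≡ x ⊕ (𝟙 ⊕ 𝟙) ⊗ (k ⊕ (⊝ g ⊕ ⊝ k)) ⊗ y
  lemma = solve-∀-in ℤτ-ring

-- The mixed bound shows that a letter ceasing to be a descent gets a positive sign again.
record Signs (w : List Point) : Set where
  field
    ascent  : ∀ {t} → Root t → t ∉ desc w → Pos (z w t)
    descent : ∀ {t} → t ∈ desc w → Pos (⊝ z w t)
    mixed   : ∀ {t s} → Root t → t ∉ desc w → s ∈ desc w → ¬ Adj t s → NonNeg (τ ⊗ z w t ⊕ z w s)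

open Signs

module _ {s w} (r : Root s) (s∉ : s ∉ desc w) (rs : All Root w) (signs : Signs w) where

  private
    s⁺ : Pos (z w s)
    s⁺ = ascent signs r s∉

    ∉desc⁻ : ∀ {t} → Adj s t → t ∉ desc (s ∷ w) → t ∉ desc w
    ∉desc⁻ adj t∉ t∈ = t∉ (there (∈-filter⁺ (adj? s) t∈ adj))

    far : ∀ {p} → NonNeg p → NonNeg (𝟚 ⊗ p ⊗ z w s)
    far p⁺ = NonNeg-⊗ (NonNeg-⊗ (weight 2 0 z≤n) p⁺) (Pos⇒NonNeg s⁺)

    nn-τ : NonNeg τ
    nn-τ = weight 0 1 z≤n

    ascent′ : ∀ {t} → Root t → t ∉ desc (s ∷ w) → Pos (z (s ∷ w) t)
    ascent′ {t} t-root t∉ with gram r t-root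
    ... | inj₁ refl = ⊥-elim (t∉ (here refl))
    ... | inj₂ (inj₁ adj) = subst Pos (sym (z-adj {s} {t} w adj)) (ascent signs t-root (∉desc⁻ {t} adj t∉))
    ... | inj₂ (inj₂ _) with gram t-root r | t ∈? desc w
    ... | inj₁ refl | _ = ⊥-elim (t∉ (here refl))
    ... | inj₂ (inj₁ adj) | _ = subst Pos (sym (z-adj {s} {t} w (Adj-sym {t} {s} adj)))
                                  (ascent signs t-root (∉desc⁻ {t} (Adj-sym {t} {s} adj) t∉))
    ... | inj₂ (inj₂ p⁺) | no t∉w = subst Pos (sym (z-far rs t))
        (Pos-+ (ascent signs t-root t∉w) (far (NonNeg-+ nn-τ p⁺)))
    ... | inj₂ (inj₂ p⁺) | yes t∈w with adj? s t
    ... | yes adj = ⊥-elim (t∉ (there (∈-filter⁺ (adj? s) t∈w adj)))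
    -- One of the two multiples τ `z w s` compensates the negative `z w t` by the mixed bound; the
    -- other keeps the sum positive.
    ... | no ¬adj = subst Pos (sym (trans (z-far rs t) (lemma τ (⊝ ⟨ t , s ⟩ ⊖ τ) (z w t) (z w s))))
        (Pos-+ (Pos-+ (≤τ-τ⊗ s⁺) (mixed signs r s∉ t∈w ¬adj)) (far p⁺))
      where
      lemma : ∀ k p x y → x ⊕ (𝟙 ⊕ 𝟙) ⊗ (k ⊕ p) ⊗ y ≡ k ⊗ y ⊕ (k ⊗ y ⊕ x) ⊕ (𝟙 ⊕ 𝟙) ⊗ p ⊗ y
      lemma = solve-∀-in ℤτ-ring

    descent′ : ∀ {t} → t ∈ desc (s ∷ w) → Pos (⊝ z (s ∷ w) t)
    descent′ (here refl) = subst Pos (trans (lemma (z w s)) (cong ⊝_ (sym (z-self r rs)))) s⁺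
      where
      lemma : ∀ x → x ≡ ⊝ ⊝ x
      lemma = solve-∀-in ℤτ-ring
    descent′ {t} (there t∈) with t∈w , adj ← ∈-filter⁻ (adj? s) t∈ =
      subst (Pos ∘ ⊝_) (sym (z-adj {s} {t} w adj)) (descent signs t∈w)

    mixed-s : ∀ {t} → Root t → t ∉ desc (s ∷ w) → ¬ Adj t s → NonNeg (τ ⊗ z (s ∷ w) t ⊕ z (s ∷ w) s)
    mixed-s {t} t-root t∉ ¬adj with gram t-root r | t ∈? desc w
    ... | inj₁ refl       | _ = ⊥-elim (t∉ (here refl))
    ... | inj₂ (inj₁ adj) | _ = ⊥-elim (¬adj adj)
    -- After expansion `z w s` has, apart from the surplus, the coefficient 2τ² - 1 = 1 + 2τ.
    ... | inj₂ (inj₂ p⁺) | no t∉w = subst NonNeg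
        (trans (lemma τ (⊝ ⟨ t , s ⟩ ⊖ τ) (z w t) (z w s)) (sym (cong₂ (λ x y → τ ⊗ x ⊕ y) (z-far rs t) (z-self r rs))))
        (NonNeg-+ (NonNeg-+ (≤τ-τ⊗ (Pos⇒NonNeg (ascent signs t-root t∉w))) (≤τ-τ⊗ (far p⁺)))
                  (NonNeg-⊗ {𝟚 ⊗ τ ⊗ τ ⊖ 𝟙} (weight 1 2 z≤n) (Pos⇒NonNeg s⁺)))
      where
      lemma : ∀ k p x y →
        k ⊗ x ⊕ k ⊗ ((𝟙 ⊕ 𝟙) ⊗ p ⊗ y) ⊕ ((𝟙 ⊕ 𝟙) ⊗ k ⊗ k ⊕ ⊝ 𝟙) ⊗ y ≡
        k ⊗ (x ⊕ (𝟙 ⊕ 𝟙) ⊗ (k ⊕ p) ⊗ y) ⊕ ⊝ y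
      lemma = solve-∀-in ℤτ-ring
    -- Here `z w t` is negative. τ times the mixed bound at `w` absorbs it and leaves the
    -- coefficient τ² - 1 = τ for `z w s`.
    ... | inj₂ (inj₂ p⁺) | yes t∈w = subst NonNeg
        (trans (lemma τ (⊝ ⟨ t , s ⟩ ⊖ τ) (z w t) (z w s)) (sym (cong₂ (λ x y → τ ⊗ x ⊕ y) (z-far rs t) (z-self r rs))))
        (NonNeg-+ (NonNeg-+ (≤τ-τ⊗ (mixed signs r s∉ t∈w (¬adj ∘ Adj-sym {s} {t}))) (≤τ-τ⊗ (far p⁺)))
                  (NonNeg-⊗ {τ ⊗ τ ⊖ 𝟙} (weight 0 1 z≤n) (Pos⇒NonNeg s⁺)))
      where
      lemma : ∀ k p x y →
        k ⊗ (k ⊗ y ⊕ x) ⊕ k ⊗ ((𝟙 ⊕ 𝟙) ⊗ p ⊗ y) ⊕ (k ⊗ k ⊕ ⊝ 𝟙) ⊗ y ≡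
        k ⊗ (x ⊕ (𝟙 ⊕ 𝟙) ⊗ (k ⊕ p) ⊗ y) ⊕ ⊝ y
      lemma = solve-∀-in ℤτ-ring

    mixed′ : ∀ {t u} → Root t → t ∉ desc (s ∷ w) → u ∈ desc (s ∷ w) → ¬ Adj t u →
             NonNeg (τ ⊗ z (s ∷ w) t ⊕ z (s ∷ w) u)
    mixed′ {t} t-root t∉ (here refl) ¬adj = mixed-s {t} t-root t∉ ¬adj
    mixed′ {t} {u} t-root t∉ (there u∈) ¬adj
      with u∈w , s-u ← ∈-filter⁻ (adj? s) u∈ with gram t-root r
    ... | inj₁ refl = ⊥-elim (t∉ (here refl))
    ... | inj₂ (inj₁ adj) = subst NonNeg
        (sym (cong₂ (λ x y → τ ⊗ x ⊕ y) (z-adj {s} {t} w (Adj-sym {t} {s} adj)) (z-adj {s} {u} w s-u)))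
        (mixed signs t-root (∉desc⁻ {t} (Adj-sym {t} {s} adj) t∉) u∈w ¬adj)
    ... | inj₂ (inj₂ p⁺) with t ∈? desc w
    ... | no t∉w = subst NonNeg
        (trans (lemma τ (𝟚 ⊗ (τ ⊕ (⊝ ⟨ t , s ⟩ ⊖ τ)) ⊗ z w s) (z w t) (z w u))
          (sym (cong₂ (λ x y → τ ⊗ x ⊕ y) (z-far rs t) (z-adj {s} {u} w s-u))))
        (NonNeg-+ (mixed signs t-root t∉w u∈w ¬adj) (≤τ-τ⊗ (far (NonNeg-+ nn-τ p⁺))))
      where
      lemma : ∀ k a x y → k ⊗ x ⊕ y ⊕ k ⊗ a ≡ k ⊗ (x ⊕ a) ⊕ y
      lemma = solve-∀-in ℤτ-ring
    -- Two descents of `w` are equal or adjacent; both are excluded.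
    ... | yes t∈w with clique-Adj (adjacents (desc-clique rs)) t∈w u∈w
    ... | inj₁ refl = ⊥-elim (t∉ (there u∈))
    ... | inj₂ adj  = ⊥-elim (¬adj adj)

  Signs-step : Signs (s ∷ w)
  Signs-step = record { ascent = ascent′ ; descent = descent′ ; mixed = mixed′ }

Reduced⇒Signs : ∀ {w} → Reduced w → Signs w
Reduced⇒Signs [] = record
  { ascent  = λ r _ → subst Pos (sym (⟨c₀,root⟩ r)) (weight 1 0 (s≤s z≤n))
  ; descent = λ ()
  ; mixed   = λ _ _ ()
  }
Reduced⇒Signs (step r s∉ red) = Signs-step r s∉ (Reduced⇒Root red) (Reduced⇒Signs red)

-- Exchange, reduction and faithfulness

infix 4 _≈_

record _≈_ (v w : List Point) : Set where
  constructor pointwise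
  field at : ∀ x → ⟦ v ⟧ x ≡ ⟦ w ⟧ x

open _≈_ public

≈-refl : ∀ {w} → w ≈ w
≈-refl = pointwise λ _ → refl

≈-sym : ∀ {v w} → v ≈ w → w ≈ v
≈-sym v≈w = pointwise λ x → sym (at v≈w x)

≈-trans : ∀ {u v w} → u ≈ v → v ≈ w → u ≈ w
≈-trans u≈v v≈w = pointwise λ x → trans (at u≈v x) (at v≈w x)

∷-≈ : ∀ s {v w} → v ≈ w → s ∷ v ≈ s ∷ w
∷-≈ s v≈w = pointwise λ x → at v≈w (R s x)

∷-cancel : ∀ {s} → Root s → ∀ w → s ∷ s ∷ w ≈ w
∷-cancel r w = pointwise λ x → cong ⟦ w ⟧ (R-involutive r x)

∷-comm : ∀ {s t} → Root s → Adj s t → ∀ w → s ∷ t ∷ w ≈ t ∷ s ∷ w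
∷-comm {s} {t} r adj w = pointwise λ x → cong ⟦ w ⟧ (sym (R-comm {s} {t} r adj x))

⟦++⟧ : ∀ v w x → ⟦ v ++ w ⟧ x ≡ ⟦ w ⟧ (⟦ v ⟧ x)
⟦++⟧ []      w x = refl
⟦++⟧ (s ∷ v) w x = ⟦++⟧ v w (R s x)

⟦reverse⟧ : ∀ {w} → All Root w → ∀ x → ⟦ reverse w ⟧ (⟦ w ⟧ x) ≡ x
⟦reverse⟧ [] x = refl
⟦reverse⟧ {s ∷ w} (r ∷ rs) x = begin
  ⟦ reverse (s ∷ w) ⟧ (⟦ w ⟧ (R s x))       ≡⟨ cong (λ v → ⟦ v ⟧ (⟦ w ⟧ (R s x))) (List.unfold-reverse s w) ⟩
  ⟦ reverse w ++ s ∷ [] ⟧ (⟦ w ⟧ (R s x))   ≡⟨ ⟦++⟧ (reverse w) (s ∷ []) _ ⟩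
  R s (⟦ reverse w ⟧ (⟦ w ⟧ (R s x)))       ≡⟨ cong (R s) (⟦reverse⟧ rs (R s x)) ⟩
  R s (R s x)                               ≡⟨ R-involutive r x ⟩
  x                                         ∎
  where open ≡-Reasoning

Root-reverse : ∀ {w} → All Root w → All Root (reverse w)
Root-reverse rs = All.tabulate λ s∈ → All.lookup rs (Any.reverse⁻ s∈)

⟦reverse⟧′ : ∀ {w} → All Root w → ∀ x → ⟦ w ⟧ (⟦ reverse w ⟧ x) ≡ x
⟦reverse⟧′ {w} rs x = trans (cong (λ v → ⟦ v ⟧ (⟦ reverse w ⟧ x)) (sym (List.reverse-involutive w)))
                            (⟦reverse⟧ (Root-reverse rs) x)

-- Descents are determined by signs, hence by the transformation alone.
desc-≈ : ∀ {v w t} → Reduced v → Reduced w → v ≈ w → t ∈ desc v → t ∈ desc w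
desc-≈ {v} {w} {t} red-v red-w v≈w t∈ with t ∈? desc w
... | yes t∈w = t∈w
... | no t∉w  = ⊥-elim (Pos-⊝ (Signs.ascent (Reduced⇒Signs red-w) (desc-Root (Reduced⇒Root red-v) t∈) t∉w)
  (subst (λ x → Pos (⊝ ⟨ c₀ , x ⟩)) (at v≈w t) (Signs.descent (Reduced⇒Signs red-v) t∈)))

-- Allowed words and the exchange property

unused : List Point → List Point
unused []      = std 4
unused (s ∷ w) = filter (λ j → ¬? (j ≟ᴾ s)) (unused w)

Star : List Point → Point → Set
Star J s = All (λ j → j ≡ s ⊎ Adj j s) J

-- The words of the edge paths from V₀ in the convex part.
data Allowed : List Point → Set where
  []   : Allowed []
  step : ∀ {s w} → Star (unused w) s → Allowed w → Allowed (s ∷ w)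

filter-comm : ∀ {A : Set} {P Q : A → Set} (P? : Decidable P) (Q? : Decidable Q) xs →
  filter P? (filter Q? xs) ≡ filter Q? (filter P? xs)
filter-comm P? Q? [] = refl
filter-comm P? Q? (x ∷ xs) with does (P? x) in p | does (Q? x) in q
... | true  | true  rewrite p | q = cong (x ∷_) (filter-comm P? Q? xs)
... | true  | false rewrite q     = filter-comm P? Q? xs
... | false | true  rewrite p     = filter-comm P? Q? xs
... | false | false               = filter-comm P? Q? xs

unused-comm : ∀ s t w → unused (s ∷ t ∷ w) ≡ unused (t ∷ s ∷ w)
unused-comm s t w = filter-comm (λ j → ¬? (j ≟ᴾ s)) (λ j → ¬? (j ≟ᴾ t)) (unused w)

∈-unused⁺ : ∀ {s w j} → j ∈ unused w → j ≢ s → j ∈ unused (s ∷ w)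
∈-unused⁺ {s} = ∈-filter⁺ (λ j → ¬? (j ≟ᴾ s))

∈-unused⁻ : ∀ {s} w {j} → j ∈ unused (s ∷ w) → j ∈ unused w × j ≢ s
∈-unused⁻ {s} w = ∈-filter⁻ (λ j → ¬? (j ≟ᴾ s)) {xs = unused w}

-- After the swap `t` is tested against at most one more direction, `s` itself, with which it
-- commutes; `s` is tested against no new direction.
Allowed-swap : ∀ {s t w} → Root s → Adj t s → Allowed (s ∷ w) → Star (unused (s ∷ w)) t →
               Allowed (s ∷ t ∷ w)
Allowed-swap {s} {t} {w} r adj (step star-s allowed) star-t =
  step (All.tabulate λ j∈ → All.lookup star-s (proj₁ (∈-unused⁻ w j∈)))
       (step (All.tabulate star) allowed)
  where
  star : ∀ {j} → j ∈ unused w → j ≡ t ⊎ Adj j t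
  star {j} j∈ with j ≟ᴾ s
  ... | yes refl = inj₂ (Adj-sym {t} {s} adj)
  ... | no j≢s   = All.lookup star-t (∈-unused⁺ {s} {w} j∈ j≢s)

record Exchange (w : List Point) (s : Point) : Set where
  field
    rest     : List Point
    reduced  : Reduced (s ∷ rest)
    equal    : w ≈ s ∷ rest
    shorter  : length w ≡ suc (length rest)
    allowed  : Allowed w → Allowed (s ∷ rest)
    unused-≡ : unused w ≡ unused (s ∷ rest)

exchange : ∀ {w s} → Reduced w → s ∈ desc w → Exchange w s
exchange {t ∷ u} red (here refl) = record
  { rest = u ; reduced = red ; equal = ≈-refl ; shorter = refl
  ; allowed = λ a → a ; unused-≡ = refl }
exchange {t ∷ u} {s} (step r t∉ red) (there s∈)
  with s∈u , adj ← ∈-filter⁻ (adj? t) {xs = desc u} s∈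
  with record { rest = v ; reduced = step rˢ s∉ red-v ; equal = u≈ ; shorter = u≡ ; allowed = al ; unused-≡ = un≡ }
    ← exchange red s∈u = record
  { rest     = t ∷ v
  ; reduced  = step rˢ s∉tv (step r t∉v red-v)
  ; equal    = ≈-trans (∷-≈ t u≈) (∷-comm {t} {s} r adj v)
  ; shorter  = cong suc u≡
  ; allowed  = λ { (step star a) → Allowed-swap rˢ adj (al a) (subst (λ J → Star J t) un≡ star) }
  ; unused-≡ = trans (cong (filter (λ j → ¬? (j ≟ᴾ t))) un≡) (unused-comm t s v)
  }
  where
  -- Adding the letter `s`, adjacent to `t`, does not change the sign at `t`, and `s ∷ v` equals
  -- `u`, where `t` is an ascent.
  t∉v : t ∉ desc v
  t∉v t∈ = Pos-⊝ (Signs.ascent (Reduced⇒Signs red) r t∉)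
    (subst (λ x → Pos (⊝ x)) (trans (sym (z-adj {s} {t} v (Adj-sym {t} {s} adj))) (cong (λ x → ⟨ c₀ , x ⟩) (sym (at u≈ t))))
      (Signs.descent (Reduced⇒Signs red-v) t∈))
  s∉tv : s ∉ desc (t ∷ v)
  s∉tv (here refl) = Root-irrefl r adj
  s∉tv (there s∈′) = s∉ (proj₁ (∈-filter⁻ (adj? t) {xs = desc v} s∈′))

Reduced-≈ : ∀ {s v w} → Reduced (s ∷ v) → Reduced w → v ≈ w → Reduced (s ∷ w)
Reduced-≈ (step r s∉ red) red′ v≈w = step r (λ s∈ → s∉ (desc-≈ red′ red (≈-sym v≈w) s∈)) red′

-- The alternative in `shorter` identifies reduced words with shortest ones: a word that is not
-- reduced becomes strictly shorter.
record Reduction (w : List Point) : Set where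
  field
    word    : List Point
    reduced : Reduced word
    equal   : w ≈ word
    shorter : length word ≤ length w × (Reduced w ⊎ length word < length w)

reduce : ∀ {w} → All Root w → Reduction w
reduce [] = record { word = [] ; reduced = [] ; equal = ≈-refl ; shorter = z≤n , inj₁ [] }
reduce {s ∷ w} (r ∷ rs)
  with record { word = v ; reduced = red ; equal = w≈v ; shorter = v≤w , shorter } ← reduce rs
  with s ∈? desc v
... | yes s∈ = record
  { word    = rest
  ; reduced = red-rest
  ; equal   = ≈-trans (∷-≈ s (≈-trans w≈v equal)) (∷-cancel r rest)
  ; shorter = ℕ.<⇒≤ lt , inj₂ lt }
  where
  open Exchange (exchange red s∈) renaming (shorter to v≡)
  red-rest : Reduced rest
  red-rest with step _ _ red′ ← reduced = red′
  lt : length rest < suc (length w)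
  lt = s≤s (ℕ.≤-trans (ℕ.≤-trans (ℕ.n≤1+n _) (ℕ.≤-reflexive (sym v≡))) v≤w)
... | no s∉ = record
  { word = s ∷ v ; reduced = step r s∉ red ; equal = ∷-≈ s w≈v ; shorter = s≤s v≤w , shorter′ shorter }
  where
  shorter′ : Reduced w ⊎ length v < length w → Reduced (s ∷ w) ⊎ suc (length v) < suc (length w)
  shorter′ (inj₁ red-w) = inj₁ (Reduced-≈ (step r s∉ red) red-w (≈-sym w≈v))
  shorter′ (inj₂ lt)    = inj₂ (s≤s lt)

-- Among vertices this increases with the hyperbolic distance from `c₀`. By `depth-∷` each letter of
-- a reduced word adds twice a positive amount.
depth : Point → ℤτ
depth x = ⟨ c₀ , c₀ ⟩ ⊖ ⟨ c₀ , x ⟩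

depth-c₀ : depth c₀ ≡ 𝟘
depth-c₀ = lemma ⟨ c₀ , c₀ ⟩
  where
  lemma : ∀ a → a ⊕ ⊝ a ≡ 𝟘
  lemma = solve-∀-in ℤτ-ring

depth-∷ : ∀ {s w} → Root s → All Root w →
  depth (⟦ s ∷ w ⟧ c₀) ≡ depth (⟦ w ⟧ c₀) ⊕ (z w s ⊕ z w s)
depth-∷ {s} {w} r rs = begin
  ⟨ c₀ , c₀ ⟩ ⊖ z (s ∷ w) c₀                               ≡⟨ cong (⟨ c₀ , c₀ ⟩ ⊖_) (z-step rs c₀) ⟩
  ⟨ c₀ , c₀ ⟩ ⊖ (z w c₀ ⊖ 𝟚 ⊗ ⟨ c₀ , s ⟩ ⊗ z w s)          ≡⟨ cong (λ p → ⟨ c₀ , c₀ ⟩ ⊖ (z w c₀ ⊖ 𝟚 ⊗ p ⊗ z w s)) (⟨c₀,root⟩ r) ⟩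
  ⟨ c₀ , c₀ ⟩ ⊖ (z w c₀ ⊖ 𝟚 ⊗ 𝟙 ⊗ z w s)                   ≡⟨ lemma ⟨ c₀ , c₀ ⟩ (z w c₀) (z w s) ⟩
  ⟨ c₀ , c₀ ⟩ ⊖ z w c₀ ⊕ (z w s ⊕ z w s)                   ∎
  where
  open ≡-Reasoning
  lemma : ∀ a b c → a ⊕ ⊝ (b ⊕ ⊝ ((𝟙 ⊕ 𝟙) ⊗ 𝟙 ⊗ c)) ≡ a ⊕ ⊝ b ⊕ (c ⊕ c)
  lemma = solve-∀-in ℤτ-ring

depth-NonNeg : ∀ {w} → Reduced w → NonNeg (depth (⟦ w ⟧ c₀))
depth-Pos : ∀ {s w} → Reduced (s ∷ w) → Pos (depth (⟦ s ∷ w ⟧ c₀))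

depth-NonNeg []               = subst NonNeg (sym depth-c₀) (weight 0 0 z≤n)
depth-NonNeg red@(step _ _ _) = Pos⇒NonNeg (depth-Pos red)

depth-Pos {s} {w} (step r s∉ red) =
  subst Pos (sym (depth-∷ r (Reduced⇒Root red)))
    (≤τ-⊕ {0} {1} (depth-NonNeg red) (Pos-+ z⁺ (Pos⇒NonNeg z⁺)))
  where z⁺ = Signs.ascent (Reduced⇒Signs red) r s∉

¬Pos-𝟘 : ¬ Pos 𝟘
¬Pos-𝟘 (weight _ _ ())

c₀-moves : ∀ {w} → Reduced w → ⟦ w ⟧ c₀ ≡ c₀ → w ≡ []
c₀-moves []               _  = refl
c₀-moves red@(step _ _ _) eq = ⊥-elim (¬Pos-𝟘 (subst Pos (trans (cong depth eq) depth-c₀) (depth-Pos red)))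

-- The group acts freely on the vertices: the reduced word for the quotient of the two elements
-- fixes `c₀`, so it is empty because depth would otherwise be positive.
c₀-faithful : ∀ {v w} → All Root v → All Root w → ⟦ v ⟧ c₀ ≡ ⟦ w ⟧ c₀ → v ≈ w
c₀-faithful {v} {w} rv rw eq = pointwise λ x → begin
  ⟦ v ⟧ x                         ≡⟨ ⟦reverse⟧′ rw (⟦ v ⟧ x) ⟨
  ⟦ w ⟧ (⟦ reverse w ⟧ (⟦ v ⟧ x)) ≡⟨ cong ⟦ w ⟧ (trans (sym (⟦++⟧ v (reverse w) x)) (trivial x)) ⟩
  ⟦ w ⟧ x                         ∎
  where
  open ≡-Reasoning
  open Reduction (reduce (All.++⁺ rv (Root-reverse rw)))
  fixes-c₀ : ⟦ word ⟧ c₀ ≡ c₀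
  fixes-c₀ = begin
    ⟦ word ⟧ c₀                  ≡⟨ at equal c₀ ⟨
    ⟦ v ++ reverse w ⟧ c₀        ≡⟨ ⟦++⟧ v (reverse w) c₀ ⟩
    ⟦ reverse w ⟧ (⟦ v ⟧ c₀)     ≡⟨ cong ⟦ reverse w ⟧ eq ⟩
    ⟦ reverse w ⟧ (⟦ w ⟧ c₀)     ≡⟨ ⟦reverse⟧ rw c₀ ⟩
    c₀                           ∎
  trivial : ∀ x → ⟦ v ++ reverse w ⟧ x ≡ x
  trivial x = trans (at equal x) (cong (λ u → ⟦ u ⟧ x) (c₀-moves reduced fixes-c₀))

record Same (v w : List Point) : Set where
  field
    length-≡ : length v ≡ length w
    allowed  : Allowed v → Allowed w
    unused-≡ : unused v ≡ unused w

-- Signs show that the last letter of `w` is a descent of `v`. Exchanging it to the end of `v` and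
-- cancelling it leaves shorter equal words.
≈⇒Same : ∀ {v w} → Reduced v → Reduced w → v ≈ w → Same v w
≈⇒Same {v} {[]} red-v [] v≈w with refl ← c₀-moves red-v (at v≈w c₀) = record
  { length-≡ = refl ; allowed = λ a → a ; unused-≡ = refl }
≈⇒Same {v} {s ∷ w} red-v red-w@(step r s∉ red-w′) v≈w = record
  { length-≡ = trans shorter (cong suc (Same.length-≡ same))
  ; allowed  = λ a → allowed′ (allowed a)
  ; unused-≡ = trans unused-≡ (cong (filter (λ j → ¬? (j ≟ᴾ s))) (Same.unused-≡ same))
  }
  where
  open Exchange (exchange red-v (desc-≈ red-w red-v (≈-sym v≈w) (here refl)))
  rest≈w : rest ≈ w
  rest≈w = pointwise λ x → trans (cong ⟦ rest ⟧ (sym (R-involutive r x)))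
    (trans (sym (at equal (R s x))) (trans (at v≈w (R s x)) (cong ⟦ w ⟧ (R-involutive r x))))
  red-rest : Reduced rest
  red-rest with step _ _ red′ ← reduced = red′
  same : Same rest w
  same = ≈⇒Same red-rest red-w′ rest≈w
  allowed′ : Allowed (s ∷ rest) → Allowed (s ∷ w)
  allowed′ (step star a) = step (subst (λ J → Star J s) (Same.unused-≡ same) star) (Same.allowed same a)

-- Centres of cubes

-- The centre of the cube with vertex c₀ spanned by the edges in the directions c.
opaque
  corner : List Point → Point
  corner []      = c₀
  corner (s ∷ c) = corner c ⊟ 𝟙 · s

  corner-[] : corner [] ≡ c₀
  corner-[] = refl

  ⟨corner⟩-∷ : ∀ s c t → ⟨ corner (s ∷ c) , t ⟩ ≡ ⟨ corner c , t ⟩ ⊕ ⊝ ⟨ s , t ⟩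
  ⟨corner⟩-∷ s c t = trans (⟨⟩-linear 𝟙 (corner c) s t) (lemma ⟨ corner c , t ⟩ ⟨ s , t ⟩)
    where
    lemma : ∀ a b → a ⊕ ⊝ (𝟙 ⊗ b) ≡ a ⊕ ⊝ b
    lemma = solve-∀-in ℤτ-ring

opaque
  unfolding corner

  ⟨corner⟩-adj : ∀ {c t} → Root t → All (λ s → Adj s t) c → ⟨ corner c , t ⟩ ≡ 𝟙
  ⟨corner⟩-adj             r []         = ⟨c₀,root⟩ r
  ⟨corner⟩-adj {s ∷ c} {t} r (a ∷ as) =
    trans (⟨corner⟩-∷ s c t) (cong₂ (λ p q → p ⊕ ⊝ q) (⟨corner⟩-adj r as) a)

⟨corner⟩-∈ : ∀ {c t} → Clique c → t ∈ c → ⟨ corner c , t ⟩ ≡ 𝟘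
⟨corner⟩-∈ {s ∷ c} (clique (r ∷ _) (as ∷ _)) (here refl) =
  trans (⟨corner⟩-∷ s c s) (cong₂ (λ p q → p ⊕ ⊝ q)
    (⟨corner⟩-adj r (All.map (λ {t} → Adj-sym {s} {t}) as)) (Root-norm r))
⟨corner⟩-∈ {s ∷ c} {t} (clique (r ∷ rs) (as ∷ ass)) (there t∈) =
  trans (⟨corner⟩-∷ s c t) (cong₂ (λ p q → p ⊕ ⊝ q) (⟨corner⟩-∈ (clique rs ass) t∈) (All.lookup as t∈))

-- Together with `⟨corner⟩-∈`: among the walls of the roots, those through the centre belong to the
-- directions of the cube, which can therefore be read off from the centre.
⟨corner⟩-∉ : ∀ {c t} → All Root c → Root t → t ∉ c → Pos ⟨ corner c , t ⟩
⟨corner⟩-∉             []       r t∉ = subst Pos (sym (⟨corner⟩-adj r [])) (weight 1 0 (s≤s z≤n))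
⟨corner⟩-∉ {s ∷ c} {t} (q ∷ qs) r t∉ = subst Pos (sym (⟨corner⟩-∷ s c t))
  (Pos-+ (⟨corner⟩-∉ qs r (t∉ ∘ there)) nonpositive)
  where
  lemma : ∀ k g → k ⊕ (⊝ g ⊕ ⊝ k) ≡ ⊝ g
  lemma = solve-∀-in ℤτ-ring
  nonpositive : NonNeg (⊝ ⟨ s , t ⟩)
  nonpositive with gram q r
  ... | inj₁ refl       = ⊥-elim (t∉ (here refl))
  ... | inj₂ (inj₁ adj) = subst (NonNeg ∘ ⊝_) (sym adj) (weight 0 0 z≤n)
  ... | inj₂ (inj₂ p⁺)  = subst NonNeg (lemma τ ⟨ s , t ⟩) (NonNeg-+ (weight 0 1 z≤n) p⁺)

corner-fix : ∀ {c s} → Clique c → s ∈ c → R s (corner c) ≡ corner c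
corner-fix {c} {s} cl s∈ = R-fix {s} {corner c} (Adj-sym {corner c} {s} (⟨corner⟩-∈ cl s∈))

corner-⊆ : ∀ {c c′} → Clique c → Clique c′ → corner c ≡ corner c′ → c ⊆ c′
corner-⊆ {c} {c′} cl cl′ eq {t} t∈ with t ∈? c′
... | yes t∈′ = t∈′
... | no t∉   = ⊥-elim (¬Pos-𝟘 (subst Pos
  (trans (cong (λ x → ⟨ x , t ⟩) (sym eq)) (⟨corner⟩-∈ cl t∈))
  (⟨corner⟩-∉ (areRoots cl′) (All.lookup (areRoots cl) t∈) t∉)))

opaque
  unfolding corner

  depth-corner : ∀ {w} → All Root w → ∀ s c →
    depth (⟦ w ⟧ (corner (s ∷ c))) ≡ z w s ⊕ depth (⟦ w ⟧ (corner c))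
  depth-corner {w} rs s c = begin
    depth (⟦ w ⟧ (corner c ⊟ 𝟙 · s))                          ≡⟨ cong depth (Isometry.linear (word-isometry rs) 𝟙 (corner c) s) ⟩
    depth (⟦ w ⟧ (corner c) ⊟ 𝟙 · ⟦ w ⟧ s)                    ≡⟨ cong (⟨ c₀ , c₀ ⟩ ⊖_) (⟨⟩-linearʳ 𝟙 (⟦ w ⟧ (corner c)) (⟦ w ⟧ s) c₀) ⟩
    ⟨ c₀ , c₀ ⟩ ⊖ (⟨ c₀ , ⟦ w ⟧ (corner c) ⟩ ⊖ 𝟙 ⊗ z w s)     ≡⟨ lemma ⟨ c₀ , c₀ ⟩ ⟨ c₀ , ⟦ w ⟧ (corner c) ⟩ (z w s) ⟩
    z w s ⊕ depth (⟦ w ⟧ (corner c))                          ∎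
    where
    open ≡-Reasoning
    lemma : ∀ a b c → a ⊕ ⊝ (b ⊕ ⊝ (𝟙 ⊗ c)) ≡ c ⊕ (a ⊕ ⊝ b)
    lemma = solve-∀-in ℤτ-ring

  depth-corner-[] : ∀ {c} → All Root c → depth (corner c) ≡ [ + length c , + 0 ]
  depth-corner-[] []                 = depth-c₀
  depth-corner-[] {s ∷ c} (r ∷ rs) =
    trans (depth-corner [] s c) (cong₂ _⊕_ (⟨c₀,root⟩ r) (depth-corner-[] rs))

depth-corner-≥ : ∀ {k w c} → Reduced w → k ≤τ depth (⟦ w ⟧ c₀) → All Root c → All (_∉ desc w) c →
  (length c ℕ.+ k) ≤τ depth (⟦ w ⟧ (corner c))
depth-corner-≥ {k} {w} red k≤ [] [] = subst (λ x → k ≤τ depth (⟦ w ⟧ x)) (sym corner-[]) k≤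
depth-corner-≥ {k} {w} {s ∷ c} red k≤ (r ∷ rs) (s∉ ∷ ss) =
  subst (suc (length c ℕ.+ k) ≤τ_) (sym (depth-corner (Reduced⇒Root red) s c))
    (≤τ-⊕ {1} (Signs.ascent (Reduced⇒Signs red) r s∉) (depth-corner-≥ red k≤ rs ss))

≤τ-ℕ : ∀ {m n} → m ≤τ [ + n , + 0 ] → m ≤ n
≤τ-ℕ {m} (weight a b m≤) = subst (m ≤_) (ℕ.+-identityʳ a) m≤

record Stabilises (r c c′ : List Point) : Set where
  field
    word    : List Point
    reduced : Reduced word
    equal   : r ≈ word
    letters : All (_∈ c) word
    ⊆ˡ      : c ⊆ c′
    ⊆ʳ      : c′ ⊆ c

-- A reduced word with no descent in c increases the depth of the corner strictly,
-- since each direction in c and c₀ itself contribute at least 1 to the weight.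
corner-faithful : ∀ n {r c c′} → length r ≤ n → Reduced r → Clique c → Clique c′ →
  length c ≡ length c′ → ⟦ r ⟧ (corner c) ≡ corner c′ → Stabilises r c c′
corner-faithful n {r} {c} {c′} r≤n red cl cl′ len eq with any? (_∈? desc r) c
corner-faithful n {[]} {c} {c′} r≤n red cl cl′ len eq | no _ = record
  { word = [] ; reduced = [] ; equal = ≈-refl ; letters = []
  ; ⊆ˡ = corner-⊆ cl cl′ eq ; ⊆ʳ = corner-⊆ cl′ cl (sym eq) }
corner-faithful n {s ∷ r} {c} {c′} r≤n red cl cl′ len eq | no none = ⊥-elim (ℕ.<-irrefl len
  (subst (_≤ length c′) (ℕ.+-comm (length c) 1) (≤τ-ℕ (subst ((length c ℕ.+ 1) ≤τ_)
    (trans (cong depth eq) (depth-corner-[] (areRoots cl′)))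
    (depth-corner-≥ red (depth-Pos red) (areRoots cl) (All.¬Any⇒All¬ c none))))))
corner-faithful n {r} {c} {c′} r≤n red cl cl′ len eq | yes some = result n r≤n
  where
  t  = proj₁ (find some)
  t∈ = proj₁ (proj₂ (find some))
  module X = Exchange (exchange red (proj₂ (proj₂ (find some))))
  red-rest : Reduced X.rest
  red-rest with step _ _ red′ ← X.reduced = red′
  eq′ : ⟦ X.rest ⟧ (corner c) ≡ corner c′
  eq′ = trans (cong ⟦ X.rest ⟧ (sym (corner-fix cl t∈))) (trans (sym (at X.equal (corner c))) eq)
  result : ∀ n → length r ≤ n → Stabilises r c c′
  result zero    r≤n with () ← subst (_≤ 0) X.shorter r≤n
  result (suc n) r≤n = record
    { word    = t ∷ word
    ; reduced = Reduced-≈ X.reduced reduced equal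
    ; equal   = ≈-trans X.equal (∷-≈ t equal)
    ; letters = t∈ ∷ letters
    ; ⊆ˡ = ⊆ˡ ; ⊆ʳ = ⊆ʳ }
    where
    open Stabilises (corner-faithful n (ℕ.s≤s⁻¹ (subst (_≤ suc n) X.shorter r≤n)) red-rest cl cl′ len eq′)

-- Faces of the mosaic

⟦map⟧ : ∀ {f} → Isometry f → ∀ w x → ⟦ List.map f w ⟧ (f x) ≡ f (⟦ w ⟧ x)
⟦map⟧     iso []      x = refl
⟦map⟧ {f} iso (s ∷ w) x = trans (cong ⟦ List.map f w ⟧ (sym (R-conj iso s x))) (⟦map⟧ iso w (R s x))

opaque
  unfolding corner

  map-corner : ∀ {f} → Isometry f → f c₀ ≡ c₀ → ∀ c → f (corner c) ≡ corner (List.map f c)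
  map-corner     iso fix []      = fix
  map-corner {f} iso fix (s ∷ c) =
    trans (Isometry.linear iso 𝟙 (corner c) s) (cong (_⊟ 𝟙 · f s) (map-corner iso fix c))

map-clique : ∀ {w c} → Isotropy w → Clique c → Clique (List.map (act w) c)
map-clique {w} w⊆ (clique rs as) =
  clique (All.map⁺ (All.map (act-Root w⊆) rs)) (AllPairs.map⁺ (AllPairs.map (λ {s} {t} → act-Adj w {s} {t}) as))

std-clique : ∀ k → k ≤ 4 → Clique (std k)
std-clique 0 _ = clique [] []
std-clique 1 _ = clique (Root-e 0 ∷ []) ([] ∷ [])
std-clique 2 _ = clique (Root-e 1 ∷ Root-e 0 ∷ []) ((refl ∷ []) ∷ [] ∷ [])
std-clique 3 _ = clique (Root-e 2 ∷ Root-e 1 ∷ Root-e 0 ∷ []) ((refl ∷ refl ∷ []) ∷ (refl ∷ []) ∷ [] ∷ [])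
std-clique 4 _ = clique (Root-e 3 ∷ Root-e 2 ∷ Root-e 1 ∷ Root-e 0 ∷ [])
  ((refl ∷ refl ∷ refl ∷ []) ∷ (refl ∷ refl ∷ []) ∷ (refl ∷ []) ∷ [] ∷ [])
std-clique (suc (suc (suc (suc (suc _))))) (s≤s (s≤s (s≤s (s≤s ()))))

opaque
  unfolding c₀ corner

  corner-std-4 : corner (std 4) ≡ centre hypercube
  corner-std-4 = refl

  corner-std-2 : corner (std 2) ≡ centre square
  corner-std-2 = refl

suc∈gens : ∀ i → suc i ∈ gens 0
suc∈gens zero                   = here refl
suc∈gens (suc zero)             = there (here refl)
suc∈gens (suc (suc zero))       = there (there (here refl))
suc∈gens (suc (suc (suc zero))) = there (there (there (here refl)))

-- [4,3,3,5] is the semidirect product of the group generated by the reflections in the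
-- roots and the isotropy group of c₀.
record Decomposition (w : List (Fin 5)) : Set where
  field
    word     : List Point
    isotropy : List (Fin 5)
    roots-w  : All Root word
    is-isotropy   : Isotropy isotropy
    equal    : ∀ x → act w x ≡ ⟦ word ⟧ (act isotropy x)

decompose : ∀ w → Decomposition w
decompose [] = record { word = [] ; isotropy = [] ; roots-w = [] ; is-isotropy = [] ; equal = λ _ → refl }
decompose (zero ∷ w) = record
  { word     = word ++ e 0 ∷ []
  ; isotropy = isotropy
  ; roots-w  = All.++⁺ roots-w (Root-e 0 ∷ [])
  ; is-isotropy   = is-isotropy
  ; equal    = λ x → trans (cong (reflect zero) (equal x))
      (trans (reflect-zero _) (sym (⟦++⟧ word (e 0 ∷ []) (act isotropy x))))
  }
  where open Decomposition (decompose w)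
decompose (suc i ∷ w) = record
  { word     = List.map (reflect (suc i)) word
  ; isotropy = suc i ∷ isotropy
  ; roots-w  = All.map⁺ (All.map (act-Root (suc∈gens i ∷ [])) roots-w)
  ; is-isotropy   = suc∈gens i ∷ is-isotropy
  ; equal    = λ x → trans (cong (reflect (suc i)) (equal x))
      (sym (⟦map⟧ (reflect-isometry (suc i)) word (act isotropy x)))
  }
  where open Decomposition (decompose w)

-- A root is an image of `e 0` under the isotropy group, so its reflection is a conjugate of the
-- generator `zero`.
compose : ∀ {w} → All Root w → ∃[ v ] ∀ x → act v x ≡ ⟦ w ⟧ x
compose [] = [] , λ _ → refl
compose {_ ∷ w} ((h , h⊆ , refl) ∷ rs) with v , v≡ ← compose rs =
  v ++ h ++ zero ∷ reverse h , λ x → begin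
    act (v ++ h ++ zero ∷ reverse h) x                    ≡⟨ act-++ v _ x ⟩
    act v (act (h ++ zero ∷ reverse h) x)                 ≡⟨ v≡ _ ⟩
    ⟦ w ⟧ (act (h ++ zero ∷ reverse h) x)                 ≡⟨ cong ⟦ w ⟧ (act-++ h _ x) ⟩
    ⟦ w ⟧ (act h (reflect zero (act (reverse h) x)))      ≡⟨ cong (⟦ w ⟧ ∘ act h) (reflect-zero _) ⟩
    ⟦ w ⟧ (act h (R (e 0) (act (reverse h) x)))           ≡⟨ cong ⟦ w ⟧ (R-conj (act-isometry h) (e 0) _) ⟩
    ⟦ w ⟧ (R (act h (e 0)) (act h (act (reverse h) x)))   ≡⟨ cong (⟦ w ⟧ ∘ R (act h (e 0))) (act-reverse′ h x) ⟩
    ⟦ w ⟧ (R (act h (e 0)) x)                             ∎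
  where open ≡-Reasoning

-- `u` carries the standard vertex and hypercube to the given `V₀` and `Q₀`; faces are pulled back
-- along it to standard coordinates.
module Frame (u : List (Fin 5)) where

  V : List Point → Point
  V w = act u (⟦ w ⟧ c₀)

  Cube : List Point → List Point → Point
  Cube w c = act u (⟦ w ⟧ (corner c))

  act-u-injective : ∀ {x y} → act u x ≡ act u y → x ≡ y
  act-u-injective {x} {y} eq = trans (sym (act-reverse u x)) (trans (cong (act (reverse u)) eq) (act-reverse u y))

  V-≈ : ∀ {v w} → v ≈ w → V v ≡ V w
  V-≈ v≈w = cong (act u) (at v≈w c₀)

  Cube-≈ : ∀ {v w} c → v ≈ w → Cube v c ≡ Cube w c
  Cube-≈ c v≈w = cong (act u) (at v≈w (corner c))

  V-faithful : ∀ {v w} → All Root v → All Root w → V v ≡ V w → v ≈ w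
  V-faithful rv rw eq = c₀-faithful rv rw (act-u-injective eq)

  Cube-absorb : ∀ {w c s} → Clique c → s ∈ c → Cube (s ∷ w) c ≡ Cube w c
  Cube-absorb {w} cl s∈ = cong (act u ∘ ⟦ w ⟧) (corner-fix cl s∈)

  private
    from-u : ∀ w x → act w x ≡ act u (act (reverse u ++ w) x)
    from-u w x = sym (trans (cong (act u) (act-++ (reverse u) w x)) (act-reverse′ u (act w x)))

  record EdgeAt (x y : Point) : Set where
    field
      {word} : List Point
      {dir}  : Point
      roots-w : All Root word
      root-d  : Root dir
      source  : x ≡ V word
      target  : y ≡ V (dir ∷ word)

  Edge⇒EdgeAt : ∀ {x y} → Edge x y → EdgeAt x y
  Edge⇒EdgeAt (w , refl , refl) = record
    { word    = word
    ; dir     = act isotropy (e 0)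
    ; roots-w = roots-w
    ; root-d  = act-Root is-isotropy (Root-e 0)
    ; source  = trans (from-u w _) (cong (act u) (trans (equal _)
        (cong ⟦ word ⟧ (trans (cong (act isotropy) (sym c₀≡)) (Isotropy-c₀ is-isotropy)))))
    ; target  = trans (from-u w _) (cong (act u) (trans (equal _) (cong ⟦ word ⟧ (begin
        act isotropy (reflect zero (centre vertex))         ≡⟨ cong (act isotropy) (reflect-zero _) ⟩
        act isotropy (R (e 0) (centre vertex))              ≡⟨ R-conj (act-isometry isotropy) (e 0) _ ⟩
        R (act isotropy (e 0)) (act isotropy (centre vertex)) ≡⟨ cong (R (act isotropy (e 0))) (trans (cong (act isotropy) (sym c₀≡)) (Isotropy-c₀ is-isotropy)) ⟩
        R (act isotropy (e 0)) c₀                           ∎))))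
    }
    where
    open Decomposition (decompose (reverse u ++ w))
    open ≡-Reasoning

  V-Edge : ∀ {w s} → All Root w → Root s → Edge (V w) (V (s ∷ w))
  V-Edge {w} rs (h , h⊆ , refl) with v , v≡ ← compose rs =
    u ++ v ++ h , start , end
    where
    open ≡-Reasoning
    split : ∀ x → act (u ++ v ++ h) x ≡ act u (⟦ w ⟧ (act h x))
    split x = trans (act-++ u _ x) (cong (act u) (trans (act-++ v h x) (v≡ _)))
    start : act (u ++ v ++ h) (centre vertex) ≡ V w
    start = trans (split _) (cong (act u ∘ ⟦ w ⟧) (trans (cong (act h) (sym c₀≡)) (Isotropy-c₀ h⊆)))
    end : act (u ++ v ++ h) (reflect zero (centre vertex)) ≡ V (act h (e 0) ∷ w)
    end = trans (split _) (cong (act u ∘ ⟦ w ⟧) (begin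
      act h (reflect zero (centre vertex))    ≡⟨ cong (act h) (reflect-zero _) ⟩
      act h (R (e 0) (centre vertex))         ≡⟨ R-conj (act-isometry h) (e 0) _ ⟩
      R (act h (e 0)) (act h (centre vertex)) ≡⟨ cong (R (act h (e 0))) (trans (cong (act h) (sym c₀≡)) (Isotropy-c₀ h⊆)) ⟩
      R (act h (e 0)) c₀                      ∎))

  record VertexAt (x Q : Point) : Set where
    field
      {word}  : List Point
      {dirs}  : List Point
      roots-w : All Root word
      cliq    : Clique dirs
      size    : length dirs ≡ 4
      vertex≡ : x ≡ V word
      cube≡   : Q ≡ Cube word dirs

  private
    act-corner : ∀ {h} → Isotropy h → ∀ c → act h (corner c) ≡ corner (List.map (act h) c)
    act-corner {h} h⊆ = map-corner (act-isometry h) (Isotropy-c₀ h⊆)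

  Incident⇒VertexAt : ∀ {x Q} → Incident vertex hypercube x Q → VertexAt x Q
  Incident⇒VertexAt (w , refl , refl) = record
    { word    = word
    ; dirs    = List.map (act isotropy) (std 4)
    ; roots-w = roots-w
    ; cliq    = map-clique is-isotropy (std-clique 4 ℕ.≤-refl)
    ; size    = refl
    ; vertex≡ = trans (from-u w _) (cong (act u) (trans (equal _)
        (cong ⟦ word ⟧ (trans (cong (act isotropy) (sym c₀≡)) (Isotropy-c₀ is-isotropy)))))
    ; cube≡   = trans (from-u w _) (cong (act u) (trans (equal _)
        (cong ⟦ word ⟧ (trans (cong (act isotropy) (sym corner-std-4)) (act-corner is-isotropy (std 4))))))
    }
    where open Decomposition (decompose (reverse u ++ w))

  V-Incident : ∀ {w c} → All Root w → Clique c → length c ≡ 4 → Incident vertex hypercube (V w) (Cube w c)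
  V-Incident {w} {c} rs cl len
    with v , v≡ ← compose rs | _ , h , h⊆ , c≡ ← homogeneous cl =
    u ++ v ++ h ,
    trans (split _) (cong (act u ∘ ⟦ w ⟧) (trans (cong (act h) (sym c₀≡)) (Isotropy-c₀ h⊆))) ,
    trans (split _) (cong (act u ∘ ⟦ w ⟧) (trans (cong (act h) (sym corner-std-4))
      (trans (act-corner h⊆ (std 4)) (cong corner (sym (trans c≡ (cong (List.map (act h) ∘ std) len)))))))
    where
    split : ∀ x → act (u ++ v ++ h) x ≡ act u (⟦ w ⟧ (act h x))
    split x = trans (act-++ u _ x) (cong (act u) (trans (act-++ v h x) (v≡ _)))

  record SquareAt (x Q : Point) : Set where
    field
      {word}    : List Point
      {a b s t} : Point
      roots-w   : All Root word
      cliq      : Clique (a ∷ b ∷ s ∷ t ∷ [])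
      square≡   : x ≡ Cube word (s ∷ t ∷ [])
      cube≡     : Q ≡ Cube word (a ∷ b ∷ s ∷ t ∷ [])

  Incident⇒SquareAt : ∀ {x Q} → Incident square hypercube x Q → SquareAt x Q
  Incident⇒SquareAt (w , refl , refl) = record
    { word    = word
    ; roots-w = roots-w
    ; cliq    = map-clique is-isotropy (std-clique 4 ℕ.≤-refl)
    ; square≡ = trans (from-u w _) (cong (act u) (trans (equal _)
        (cong ⟦ word ⟧ (trans (cong (act isotropy) (sym corner-std-2)) (act-corner is-isotropy (std 2))))))
    ; cube≡   = trans (from-u w _) (cong (act u) (trans (equal _)
        (cong ⟦ word ⟧ (trans (cong (act isotropy) (sym corner-std-4)) (act-corner is-isotropy (std 4))))))
    }
    where open Decomposition (decompose (reverse u ++ w))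

  Square-Incident : ∀ {w a b s t} → All Root w → Clique (a ∷ b ∷ s ∷ t ∷ []) →
    Incident square hypercube (Cube w (s ∷ t ∷ [])) (Cube w (a ∷ b ∷ s ∷ t ∷ []))
  Square-Incident {w} rs cl
    with v , v≡ ← compose rs | _ , h , h⊆ , c≡ ← homogeneous cl =
    u ++ v ++ h ,
    trans (split _) (cong (act u ∘ ⟦ w ⟧) (trans (cong (act h) (sym corner-std-2))
      (trans (act-corner h⊆ (std 2)) (cong (corner ∘ List.drop 2) (sym c≡))))) ,
    trans (split _) (cong (act u ∘ ⟦ w ⟧) (trans (cong (act h) (sym corner-std-4))
      (trans (act-corner h⊆ (std 4)) (cong corner (sym c≡)))))
    where
    split : ∀ x → act (u ++ v ++ h) x ≡ act u (⟦ w ⟧ (act h x))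
    split x = trans (act-++ u _ x) (cong (act u) (trans (act-++ v h x) (v≡ _)))

-- Paths and values

⊆-length : ∀ {A : Set} {xs ys : List A} → Unique xs → xs ⊆ ys → length xs ≤ length ys
⊆-length {xs = []}     _          _  = z≤n
⊆-length {xs = x ∷ xs} (x∉ ∷ xs!) xs⊆ with as , bs , refl ← ∈-∃++ (xs⊆ (here refl)) =
  subst (suc (length xs) ≤_) (sym (trans (List.length-++ as) (trans (ℕ.+-suc (length as) (length bs))
    (cong suc (sym (List.length-++ as))))))
    (s≤s (⊆-length xs! xs⊆′))
  where
  xs⊆′ : xs ⊆ as ++ bs
  xs⊆′ y∈ with ∈-++⁻ as (xs⊆ (there y∈))
  ... | inj₁ y∈as         = ∈-++⁺ˡ y∈as
  ... | inj₂ (here refl)  = ⊥-elim (All.lookup x∉ y∈ refl)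
  ... | inj₂ (there y∈bs) = ∈-++⁺ʳ as y∈bs

Card-≤ : ∀ {A : Set} {P Q : A → Set} {m n} → (∀ {x} → P x → Q x) → Card P m → Card Q n → m ≤ n
Card-≤ P⇒Q (xs , (xs! , P⇔) , refl) (ys , (_ , Q⇔) , refl) =
  ⊆-length xs! λ {x} x∈ → Equivalence.from (Q⇔ x) (P⇒Q (Equivalence.to (P⇔ x) x∈))

Card-unique : ∀ {A : Set} {P : A → Set} {m n} → Card P m → Card P n → m ≡ n
Card-unique p q = ℕ.≤-antisym (Card-≤ (λ x → x) p q) (Card-≤ (λ x → x) q p)

Enumerates-map : ∀ {A B : Set} {P : A → Set} {Q : B → Set} {f : A → B} {xs} →
  (∀ {x y} → P x → P y → f x ≡ f y → x ≡ y) →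
  (∀ {x} → P x → Q (f x)) → (∀ {y} → Q y → ∃[ x ] (P x × f x ≡ y)) →
  Enumerates xs P → Enumerates (List.map f xs) Q
Enumerates-map {P = P} {Q} {f} {xs} inj P⇒Q Q⇒P (xs! , P⇔) =
  unique xs! (All.tabulate λ {x} → Equivalence.to (P⇔ x)) , λ y → mk⇔ to from
  where
  unique : ∀ {ys} → Unique ys → All P ys → Unique (List.map f ys)
  unique []         []       = []
  unique (y∉ ∷ ys!) (p ∷ ps) =
    All.map⁺ (All.map (λ { (y≢ , q) eq → y≢ (inj p q eq) }) (All.zip (y∉ , ps))) ∷ unique ys! ps
  to : ∀ {y} → y ∈ List.map f xs → Q y
  to y∈ with x , x∈ , refl ← ∈-map⁻ f y∈ = P⇒Q (Equivalence.to (P⇔ x) x∈)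
  from : ∀ {y} → Q y → y ∈ List.map f xs
  from q with x , p , refl ← Q⇒P q = ∈-map⁺ f (Equivalence.from (P⇔ x) p)

Enumerates-filter : ∀ {A : Set} {P Q : A → Set} {xs} (Q? : ∀ x → Dec (Q x)) →
  Enumerates xs P → Enumerates (filter Q? xs) (λ x → P x × Q x)
Enumerates-filter {xs = xs} Q? (xs! , P⇔) = Unique.filter⁺ Q? xs! , λ x → mk⇔
  (λ x∈ → let x∈xs , q = ∈-filter⁻ Q? {xs = xs} x∈ in Equivalence.to (P⇔ x) x∈xs , q)
  (λ { (p , q) → ∈-filter⁺ Q? (Equivalence.from (P⇔ x) p) q })

roots-enumerate : Enumerates roots Root
roots-enumerate = roots-unique , λ x → mk⇔ ∈roots⇒Root Root⇒∈roots

Extends : List Point → Point → Set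
Extends w s = s ∉ desc w × Star (unused w) s

extends? : ∀ w s → Dec (Extends w s)
extends? w s = (s ∉? desc w) ×-dec all? (λ j → (j ≟ᴾ s) ⊎-dec adj? j s) (unused w)

extensions : List Point → List (List Point)
extensions w = List.map (_∷ w) (filter (extends? w) roots)

words : ℕ → List (List Point)
words zero    = [] ∷ []
words (suc n) = concat (List.map extensions (words n))

record Word (n : ℕ) (w : List Point) : Set where
  constructor mk
  field
    reduced : Reduced w
    allowed : Allowed w
    size    : length w ≡ n

words-enumerate : ∀ n → Enumerates (words n) (Word n)
words-enumerate zero = [] ∷ [] , λ w → mk⇔ to from
  where
  to : ∀ {w} → w ∈ [] ∷ [] → Word 0 w
  to (here refl) = mk [] [] refl
  from : ∀ {w} → Word 0 w → w ∈ [] ∷ []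
  from {[]} _ = here refl
words-enumerate (suc n) with words! , ⇔ ← words-enumerate n =
  AllPairs.concat⁺ (All.map⁺ (All.tabulate λ {w} _ → proj₁ (extensions-enumerate w)))
                   (AllPairs.map⁺ (AllPairs.map disjoint words!)) ,
  λ w → mk⇔ to from
  where
  extensions-enumerate : ∀ w → Enumerates (extensions w) (λ v → ∃[ s ] ((Root s × Extends w s) × s ∷ w ≡ v))
  extensions-enumerate w = Enumerates-map (λ _ _ → List.∷-injectiveˡ)
    (λ {s} p → s , p , refl) (λ { (s , p , eq) → s , p , eq })
    (Enumerates-filter (extends? w) roots-enumerate)
  disjoint : ∀ {v w} → v ≢ w → All (λ x → All (x ≢_) (extensions w)) (extensions v)
  disjoint v≢w = All.map⁺ (All.tabulate λ _ → All.map⁺ (All.tabulate λ _ eq → v≢w (List.∷-injectiveʳ eq)))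
  to : ∀ {w} → w ∈ words (suc n) → Word (suc n) w
  to w∈ with ws , w∈ws , ws∈ ← ∈-concat⁻′ (List.map extensions (words n)) w∈
    with v , v∈ , refl ← ∈-map⁻ extensions ws∈
    with s , (r , s∉ , star) , refl ← Equivalence.to (proj₂ (extensions-enumerate v) _) w∈ws
    with mk red al size ← Equivalence.to (⇔ v) v∈ = mk (step r s∉ red) (step star al) (cong suc size)
  from : ∀ {w} → Word (suc n) w → w ∈ words (suc n)
  from {s ∷ w} (mk (step r s∉ red) (step star al) size) = ∈-concat⁺′
    (Equivalence.from (proj₂ (extensions-enumerate w) _) (s , (r , s∉ , star) , refl))
    (∈-map⁺ extensions (Equivalence.from (⇔ w) (mk red al (ℕ.suc-injective size))))

_++ᴾ_ : ∀ {R : Point → Point → Set} {x p y q v} → Path R x p y → Path R y q v → Path R x (p ++ q) v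
[]      ++ᴾ q = q
(e ∷ p) ++ᴾ q = e ∷ (p ++ᴾ q)

Path-map : ∀ {Q R : Point → Point → Set} → (∀ {x y} → Q x y → R x y) → ∀ {x p y} → Path Q x p y → Path R x p y
Path-map f []      = []
Path-map f (e ∷ p) = f e ∷ Path-map f p

module Paths (u : List (Fin 5)) where

  open Frame u public

  trace : List Point → List Point
  trace []      = []
  trace (s ∷ w) = trace w ∷ʳ V (s ∷ w)

  length-trace : ∀ w → length (trace w) ≡ length w
  length-trace []      = refl
  length-trace (s ∷ w) = trans (List.length-++ (trace w)) (trans (ℕ.+-comm _ 1) (cong suc (length-trace w)))

  trace-injective : ∀ {v w} → Reduced v → Reduced w → trace v ≡ trace w → v ≡ w
  trace-injective {[]}    {[]}    _ _ _ = refl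
  trace-injective {[]}    {t ∷ w} _ _ eq with () ← trans (cong length eq) (length-trace (t ∷ w))
  trace-injective {s ∷ v} {[]}    _ _ eq with () ← trans (sym (length-trace (s ∷ v))) (cong length eq)
  trace-injective {s ∷ v} {t ∷ w} red-v@(step r s∉ red-v′) red-w@(step r′ _ red-w′) eq
    with refl ← trace-injective red-v′ red-w′ (List.∷ʳ-injectiveˡ (trace v) (trace w) eq) =
    cong (_∷ v) (same (desc-≈ red-v red-w (V-faithful (Reduced⇒Root red-v) (Reduced⇒Root red-w)
      (List.∷ʳ-injectiveʳ (trace v) (trace v) eq)) (here refl)))
    where
    same : s ∈ desc (t ∷ v) → s ≡ t
    same (here s≡t) = s≡t
    same (there s∈) = ⊥-elim (s∉ (proj₁ (∈-filter⁻ (adj? t) {xs = desc v} s∈)))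

  Edge⇒dir : ∀ {w x y} → All Root w → x ≡ V w → Edge x y → ∃[ s ] (Root s × y ≡ V (s ∷ w))
  Edge⇒dir rs refl edge = dir , root-d ,
    trans target (V-≈ (∷-≈ dir (≈-sym (V-faithful rs roots-w source))))
    where open EdgeAt (Edge⇒EdgeAt edge)

  path⇒word : ∀ {w x p y} → All Root w → x ≡ V w → Path Edge x p y →
    ∃[ v ] (All Root v × y ≡ V v × trace v ≡ trace w ++ p)
  path⇒word {w} rs x≡ [] = w , rs , x≡ , sym (List.++-identityʳ (trace w))
  path⇒word {w} rs x≡ (_∷_ {p = p} edge path) with s , r , refl ← Edge⇒dir rs x≡ edge
    with v , rv , y≡ , tr ← path⇒word (r ∷ rs) refl path =
    v , rv , y≡ , trans tr (List.++-assoc (trace w) (V (s ∷ w) ∷ []) p)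

  word⇒path : ∀ {w} → All Root w → Path Edge (V []) (trace w) (V w)
  word⇒path []       = []
  word⇒path (r ∷ rs) = word⇒path rs ++ᴾ (V-Edge rs r ∷ [])

  length-minimal : ∀ {v w} → All Root v → Reduced w → v ≈ w →
    length w ≤ length v × (Reduced v ⊎ length w < length v)
  length-minimal {v} {w} rv red v≈w = subst (λ n → n ≤ length v × (Reduced v ⊎ n < length v))
    (Same.length-≡ (≈⇒Same reduced red (≈-trans (≈-sym equal) v≈w))) shorter
    where open Reduction (reduce rv)

  trace-shortest : ∀ {v w} → Reduced v → Reduced w → V w ≡ V v → ShortestPath Edge (V []) (V v) (trace w)
  trace-shortest {v} {w} red-v red-w eq =
    subst (Path Edge (V []) (trace w)) eq (word⇒path (Reduced⇒Root red-w)) , minimal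
    where
    minimal : ∀ q → Path Edge (V []) q (V v) → length (trace w) ≤ length q
    minimal q path with x , rx , v≡ , tr ← path⇒word [] refl path =
      subst₂ _≤_ (sym (length-trace w)) (trans (sym (length-trace x)) (cong length tr))
        (proj₁ (length-minimal rx red-w (V-faithful rx (Reduced⇒Root red-w) (trans (sym v≡) (sym eq)))))

  shortest⇒trace : ∀ {v p} → Reduced v → ShortestPath Edge (V []) (V v) p →
    ∃[ w ] (Reduced w × V w ≡ V v × trace w ≡ p)
  shortest⇒trace {v} {p} red (path , minimal)
    with w , rw , v≡ , tr ← path⇒word [] refl path
    with proj₂ (length-minimal rw red (V-faithful rw (Reduced⇒Root red) (sym v≡)))
  ... | inj₁ red-w = w , red-w , sym v≡ , tr
  ... | inj₂ v<w   = ⊥-elim (ℕ.<⇒≱ v<w (subst₂ _≤_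
    (trans (cong length (sym tr)) (length-trace w)) (length-trace v)
    (minimal (trace v) (word⇒path (Reduced⇒Root red)))))

  class : List Point → List (List Point)
  class w = filter (λ v → V v ≟ᴾ V w) (words (length w))

  value : List Point → ℕ
  value w = length (class w)

  -- `words` lists only allowed words, yet no reduced word of the vertex is lost: all of them are
  -- allowed as soon as one is. So the shortest paths of the whole mosaic are counted.
  class-enumerates : ∀ {w} → Reduced w → Allowed w → Enumerates (class w) (λ v → Reduced v × V v ≡ V w)
  class-enumerates {w} red al
    with xs! , ⇔ ← Enumerates-filter (λ v → V v ≟ᴾ V w) (words-enumerate (length w)) =
    xs! , λ v → mk⇔ (λ v∈ → let word , eq = Equivalence.to (⇔ v) v∈ in Word.reduced word , eq)
                    (λ { (red-v , eq) → Equivalence.from (⇔ v) (word red-v eq , eq) })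
    where
    word : ∀ {v} → Reduced v → V v ≡ V w → Word (length w) v
    word red-v eq = mk red-v (Same.allowed same al) (sym (Same.length-≡ same))
      where same = ≈⇒Same red red-v (V-faithful (Reduced⇒Root red) (Reduced⇒Root red-v) (sym eq))

  value-correct : ∀ {Q₀ w} → Reduced w → Allowed w → Simplex.Value (V []) Q₀ (V w) (value w)
  value-correct {w = w} red al = List.map trace (class w) ,
    Enumerates-map (λ { (red-v , _) (red-v′ , _) → trace-injective red-v red-v′ })
      (λ { (red-v , eq) → trace-shortest red red-v eq })
      (λ shortest → let v , red-v , eq , tr = shortest⇒trace red shortest in v , (red-v , eq) , tr)
      (class-enumerates red al) ,
    List.length-map trace (class w)

-- Cubes of the convex part

opaque
  unfolding corner

  corner-↭ : ∀ {c c′} → c ↭ c′ → corner c ≡ corner c′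
  corner-↭ ↭-refl        = refl
  corner-↭ (prep s p)    = cong (_⊟ 𝟙 · s) (corner-↭ p)
  corner-↭ (swap {xs} s t p) =
    trans (⊟-swap 𝟙 𝟙 (corner xs) t s) (cong (λ x → x ⊟ 𝟙 · s ⊟ 𝟙 · t) (corner-↭ p))
  corner-↭ (↭-trans p q) = trans (corner-↭ p) (corner-↭ q)

clique-unique : ∀ {c} → Clique c → Unique c
clique-unique (clique [] [])             = []
clique-unique (clique (r ∷ rs) (a ∷ as)) =
  All.map (λ { adj refl → Root-irrefl r adj }) a ∷ clique-unique (clique rs as)

clique-adj : ∀ {c s t} → Clique c → s ∈ c → t ∈ c → s ≢ t → Adj s t
clique-adj cl s∈ t∈ s≢t with clique-Adj (adjacents cl) s∈ t∈
... | inj₁ s≡t = ⊥-elim (s≢t s≡t)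
... | inj₂ adj = adj

extra : ∀ {c T : List Point} → Unique T → length c < length T → ∃[ k ] (k ∈ T × k ∉ c)
extra {c} {T} T! c<T with any? (_∉? c) T
... | yes some = find some
... | no none  = ⊥-elim (ℕ.<⇒≱ c<T (⊆-length T! λ {x} x∈ →
  decidable-stable (x ∈? c) (All.lookup (All.¬Any⇒All¬ T none) x∈)))

sub-clique : ∀ {c T} → Clique T → Unique c → c ⊆ T → Clique c
sub-clique cl []         _  = clique [] []
sub-clique cl (x∉ ∷ xs!) ⊆T with clique rs as ← sub-clique cl xs! (λ x∈ → ⊆T (there x∈)) =
  clique (All.lookup (areRoots cl) (⊆T (here refl)) ∷ rs)
         (All.tabulate (λ y∈ → clique-adj cl (⊆T (here refl)) (⊆T (there y∈)) (All.lookup x∉ y∈)) ∷ as)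

corner-set : ∀ {c c′} → Clique c → Clique c′ → c ⊆ c′ → c′ ⊆ c → corner c ≡ corner c′
corner-set cl cl′ ⊆ˡ ⊆ʳ =
  corner-↭ (∼bag⇒↭ (unique∧set⇒bag (clique-unique cl) (clique-unique cl′) (mk⇔ ⊆ˡ ⊆ʳ)))

⊆-antisym : ∀ {xs ys : List Point} → Unique xs → xs ⊆ ys → length ys ≤ length xs → ys ⊆ xs
⊆-antisym {xs} {ys} xs! xs⊆ys len {y} y∈ with y ∈? xs
... | yes y∈xs = y∈xs
... | no y∉xs  = ⊥-elim (ℕ.<⇒≱ (⊆-length (All.tabulate (λ { z∈ refl → y∉xs z∈ }) ∷ xs!)
  λ { (here refl) → y∈ ; (there z∈) → xs⊆ys z∈ }) len)

orbit-3-length : length (orbit 3) ≡ 2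
orbit-3-length = orbit-3
  where
  opaque
    unfolding orbit
    orbit-3 : length (orbit 3) ≡ 2
    orbit-3 = refl

-- Moved to standard position, the common neighbours of a triangle lie in `orbit 3`, which has two
-- elements.
triangle-neighbours : ∀ {c x y z} → Clique c → length c ≡ 3 → Clique (x ∷ c) → Clique (y ∷ c) → Clique (z ∷ c) →
  ¬ Unique (x ∷ y ∷ z ∷ [])
triangle-neighbours {c} cl len cx cy cz xyz! with _ , w , w⊆ , c≡ ← homogeneous cl =
  ℕ.<⇒≱ (⊆-length xyz! images) (ℕ.≤-reflexive (trans (List.length-map (act w) (orbit 3)) orbit-3-length))
  where
  neighbour : ∀ {t} → Clique (t ∷ c) → t ∈ List.map (act w) (orbit 3)
  neighbour {t} (clique (r ∷ _) (a ∷ _)) = subst (_∈ List.map (act w) (orbit 3)) (act-reverse′ w t)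
    (∈-map⁺ (act w) (All.lookup (neighbours-transitive 3 ℕ.≤-refl)
      (Root⇒∈roots (act-Root (Isotropy-reverse w⊆) r))
      (All.tabulate λ {y} y∈ → act-Adj⁻ w (subst (λ s → Adj s (act w y)) (sym (act-reverse′ w t))
        (All.lookup a (subst (act w y ∈_) (sym (trans c≡ (cong (List.map (act w) ∘ std) len)))
          (∈-map⁺ (act w) y∈)))))))
  images : _ ∷ _ ∷ _ ∷ [] ⊆ List.map (act w) (orbit 3)
  images (here refl)                 = neighbour cx
  images (there (here refl))         = neighbour cy
  images (there (there (here refl))) = neighbour cz

unused-∉ : ∀ w {j} → j ∈ unused w → j ∉ w
unused-∉ (s ∷ w) j∈ (here refl) = proj₂ (∈-unused⁻ w j∈) refl
unused-∉ (s ∷ w) j∈ (there j∈w) = unused-∉ w (proj₁ (∈-unused⁻ w j∈)) j∈w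

Reduced-tail : ∀ {s w} → Reduced (s ∷ w) → Reduced w
Reduced-tail (step _ _ red) = red

Allowed-tail : ∀ {s w} → Allowed (s ∷ w) → Allowed w
Allowed-tail (step _ al) = al

-- The cube spanned at w by the directions T belongs to the convex part.
record Good (w T : List Point) : Set where
  field
    word    : List Point
    reduced : Reduced word
    allowed : Allowed word
    equal   : w ≈ word
    unused⊆ : unused word ⊆ T

clique-star : ∀ {T J s} → Clique T → J ⊆ T → s ∈ T → Star J s
clique-star cl J⊆ s∈ = All.tabulate λ j∈ → clique-Adj (adjacents cl) (J⊆ j∈) s∈

Good-∷ : ∀ {w T s} → Clique T → s ∈ T → Good w T → Good (s ∷ w) T
Good-∷ {w} {T} {s} cl s∈ g with s ∈? desc (Good.word g)
... | yes s∈desc = record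
  { word    = rest
  ; reduced = Reduced-tail reduced
  ; allowed = Allowed-tail (allowed (Good.allowed g))
  ; equal   = ≈-trans (∷-≈ s (≈-trans (Good.equal g) equal)) (∷-cancel (All.lookup (areRoots cl) s∈) rest)
  ; unused⊆ = λ {j} j∈ → unused-rest j∈
  }
  where
  open Exchange (exchange (Good.reduced g) s∈desc)
  unused-rest : unused rest ⊆ T
  unused-rest {j} j∈ with j ≟ᴾ s
  ... | yes refl = s∈
  ... | no j≢s   = Good.unused⊆ g (subst (j ∈_) (sym unused-≡) (∈-unused⁺ {s} {rest} j∈ j≢s))
... | no s∉desc = record
  { word    = s ∷ word
  ; reduced = step (All.lookup (areRoots cl) s∈) s∉desc reduced
  ; allowed = step (clique-star cl unused⊆ s∈) allowed
  ; equal   = ∷-≈ s equal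
  ; unused⊆ = λ j∈ → unused⊆ (proj₁ (∈-unused⁻ word j∈))
  }
  where open Good g

Good-≈ : ∀ {v w T} → v ≈ w → Good w T → Good v T
Good-≈ v≈w g = record
  { word = word ; reduced = reduced ; allowed = allowed ; equal = ≈-trans v≈w equal ; unused⊆ = unused⊆ }
  where open Good g

Good-⊆ : ∀ {w T T′} → T ⊆ T′ → Good w T → Good w T′
Good-⊆ T⊆ g = record
  { word = word ; reduced = reduced ; allowed = allowed ; equal = equal ; unused⊆ = λ j∈ → T⊆ (unused⊆ j∈) }
  where open Good g

Good-++ : ∀ {r w T} → Clique T → All (_∈ T) r → Good w T → Good (r ++ w) T
Good-++ cl []        g = g
Good-++ cl (s∈ ∷ ss) g = Good-∷ cl s∈ (Good-++ cl ss g)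

Good-unused : ∀ {w v T} → Good w T → Reduced v → w ≈ v → Allowed v × unused v ⊆ T
Good-unused {v = v} g red w≈v = Same.allowed same allowed , λ {j} j∈ → unused⊆ (subst (j ∈_) (sym (Same.unused-≡ same)) j∈)
  where
  open Good g
  same : Same word v
  same = ≈⇒Same reduced red (≈-trans (≈-sym equal) w≈v)

-- All cubes of the convex part are admissible

module Soundness (u : List (Fin 5)) where

  open Paths u public

  Cube-++ : ∀ {r w T} → Clique T → All (_∈ T) r → Cube (r ++ w) T ≡ Cube w T
  Cube-++ cl []                = refl
  Cube-++ {s ∷ r} {w} cl (s∈ ∷ ss) = trans (Cube-absorb {r ++ w} cl s∈) (Cube-++ {r} {w} cl ss)

  record Coset (v w c c′ : List Point) : Set where
    field
      word    : List Point
      reduced : Reduced word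
      letters : All (_∈ c) word
      equal   : w ≈ word ++ v
      ⊆ˡ      : c ⊆ c′
      ⊆ʳ      : c′ ⊆ c

  -- The quotient of the two elements carries one corner to the other; `corner-faithful` writes it
  -- in the directions of the cube.
  Cube-faithful : ∀ {v w c c′} → All Root v → All Root w → Clique c → Clique c′ → length c ≡ length c′ →
    Cube v c ≡ Cube w c′ → Coset v w c c′
  Cube-faithful {v} {w} {c} {c′} rv rw cl cl′ len eq = record
    { word    = word
    ; reduced = reduced
    ; letters = All.map ⊆ˡ letters
    ; equal   = pointwise λ x → sym (begin
        ⟦ word ++ v ⟧ x                 ≡⟨ ⟦++⟧ word v x ⟩
        ⟦ v ⟧ (⟦ word ⟧ x)              ≡⟨ cong ⟦ v ⟧ (trans (at M.equal x) (at equal x)) ⟨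
        ⟦ v ⟧ (⟦ w ++ reverse v ⟧ x)    ≡⟨ cong ⟦ v ⟧ (⟦++⟧ w (reverse v) x) ⟩
        ⟦ v ⟧ (⟦ reverse v ⟧ (⟦ w ⟧ x)) ≡⟨ ⟦reverse⟧′ rv _ ⟩
        ⟦ w ⟧ x                         ∎)
    ; ⊆ˡ = ⊆ʳ ; ⊆ʳ = ⊆ˡ }
    where
    open ≡-Reasoning
    module M = Reduction (reduce {w ++ reverse v} (All.++⁺ rw (Root-reverse rv)))
    stabilises : Stabilises M.word c′ c
    stabilises = corner-faithful (length M.word) ℕ.≤-refl M.reduced cl′ cl (sym len) (begin
      ⟦ M.word ⟧ (corner c′)               ≡⟨ at M.equal (corner c′) ⟨
      ⟦ w ++ reverse v ⟧ (corner c′)       ≡⟨ ⟦++⟧ w (reverse v) (corner c′) ⟩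
      ⟦ reverse v ⟧ (⟦ w ⟧ (corner c′))    ≡⟨ cong ⟦ reverse v ⟧ (act-u-injective eq) ⟨
      ⟦ reverse v ⟧ (⟦ v ⟧ (corner c))     ≡⟨ ⟦reverse⟧ rv (corner c) ⟩
      corner c                             ∎)
    open Stabilises stabilises

  Good-Cube : ∀ {v w T T′} → All Root v → All Root w → Clique T → Clique T′ → length T ≡ length T′ →
    Cube v T ≡ Cube w T′ → Good v T → Good w T′
  Good-Cube rv rw cl cl′ len eq g = Good-⊆ ⊆ˡ (Good-≈ equal (Good-++ cl letters g))
    where open Coset (Cube-faithful rv rw cl cl′ len eq)

  value-mono-⊆ : ∀ {s w} → Reduced (s ∷ w) → Allowed (s ∷ w) → List.map (s ∷_) (class w) ⊆ class (s ∷ w)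
  value-mono-⊆ {s} {w} red al v∈ with v , v∈class , refl ← ∈-map⁻ (s ∷_) v∈
    with red-v , eq ← Equivalence.to (proj₂ (class-enumerates (Reduced-tail red) (Allowed-tail al)) v) v∈class =
    Equivalence.from (proj₂ (class-enumerates red al) (s ∷ v))
      (Reduced-≈ red red-v (≈-sym v≈w) , V-≈ (∷-≈ s v≈w))
    where v≈w = V-faithful (Reduced⇒Root red-v) (Reduced⇒Root (Reduced-tail red)) eq

  private
    class-∷-unique : ∀ {s w} → Reduced (s ∷ w) → Allowed (s ∷ w) → Unique (List.map (s ∷_) (class w))
    class-∷-unique red al = Unique.map⁺ List.∷-injectiveʳ
      (proj₁ (class-enumerates (Reduced-tail red) (Allowed-tail al)))

  value-mono : ∀ {s w} → Reduced (s ∷ w) → Allowed (s ∷ w) → value w ≤ value (s ∷ w)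
  value-mono {s} {w} red al = subst (_≤ value (s ∷ w)) (List.length-map (s ∷_) (class w))
    (⊆-length (class-∷-unique red al) (value-mono-⊆ red al))

  -- Appending `s` embeds the reduced words of the old vertex; exchanging `t` to the end gives one
  -- more word, which does not end in `s`.
  value-strict : ∀ {s w t} → Reduced (s ∷ w) → Allowed (s ∷ w) → t ∈ desc (s ∷ w) → t ≢ s → value w < value (s ∷ w)
  value-strict {s} {w} {t} red al t∈ t≢s = subst (λ n → suc n ≤ value (s ∷ w)) (List.length-map (s ∷_) (class w))
    (⊆-length (All.map⁺ (All.tabulate λ _ eq → t≢s (List.∷-injectiveˡ eq)) ∷ class-∷-unique red al)
      λ { (here refl) → Equivalence.from (proj₂ (class-enumerates red al) (t ∷ rest)) (reduced , V-≈ (≈-sym equal))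
        ; (there v∈)  → value-mono-⊆ red al v∈ })
    where open Exchange (exchange red t∈)

  -- A walk inside the cube away from `V₀`, crossing those directions of `ts` that are not yet
  -- descents. `avoid` keeps a direction available for a later step, and `fresh` bounds the
  -- directions really crossed.
  record Climb (v T avoid ts : List Point) : Set where
    field
      word    : List Point
      reduced : Reduced word
      allowed : Allowed word
      unused⊆ : unused word ⊆ T
      avoided : All (_∉ desc word) avoid
      reached : All (_∈ desc word) ts
      path    : List Point
      letters : All (_∈ ts) path
      fresh   : All (_∉ desc v) path
      word≡   : word ≡ path ++ v
      value≤  : value v ≤ value word

  climb : ∀ {v T avoid} ts → Clique T → Reduced v → Allowed v → unused v ⊆ T → All (_∉ desc v) avoid →
    ts ⊆ T → All (_∉ avoid) ts → Climb v T avoid ts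
  climb {v} [] cl red al un av ts⊆ _ = record
    { word = v ; reduced = red ; allowed = al ; unused⊆ = un ; avoided = av ; reached = [] ; path = []
    ; letters = [] ; fresh = [] ; word≡ = refl ; value≤ = ℕ.≤-refl }
  climb {v} {T} {avoid} (t ∷ ts) cl red al un av ts⊆ (t∉avoid ∷ dis) = result (t ∈? desc word)
    where
    open Climb (climb ts cl red al un av (λ x∈ → ts⊆ (there x∈)) dis)
    t∈T : t ∈ T
    t∈T = ts⊆ (here refl)
    result : Dec (t ∈ desc word) → Climb v T avoid (t ∷ ts)
    result (yes t∈) = record
      { word = word ; reduced = reduced ; allowed = allowed ; unused⊆ = unused⊆ ; avoided = avoided
      ; reached = t∈ ∷ reached ; path = path ; letters = All.map there letters ; fresh = fresh
      ; word≡ = word≡ ; value≤ = value≤ }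
    result (no t∉) = record
      { word    = t ∷ word
      ; reduced = reduced′
      ; allowed = allowed′
      ; unused⊆ = λ j∈ → unused⊆ (proj₁ (∈-unused⁻ word j∈))
      ; avoided = All.tabulate avoided′
      ; reached = here refl ∷ All.tabulate reached′
      ; path    = t ∷ path
      ; letters = here refl ∷ All.map there letters
      ; fresh   = t∉v ∷ fresh
      ; word≡   = cong (t ∷_) word≡
      ; value≤  = ℕ.≤-trans value≤ (value-mono reduced′ allowed′)
      }
      where
      reduced′ : Reduced (t ∷ word)
      reduced′ = step (All.lookup (areRoots cl) t∈T) t∉ reduced
      allowed′ : Allowed (t ∷ word)
      allowed′ = step (clique-star cl unused⊆ t∈T) allowed
      avoided′ : ∀ {x} → x ∈ avoid → x ∉ desc (t ∷ word)
      avoided′ x∈ (here refl) = t∉avoid x∈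
      avoided′ x∈ (there x∈′) = All.lookup avoided x∈ (proj₁ (∈-filter⁻ (adj? t) {xs = desc word} x∈′))
      reached′ : ∀ {x} → x ∈ ts → x ∈ desc (t ∷ word)
      reached′ {x} x∈ with clique-Adj (adjacents cl) t∈T (ts⊆ (there x∈))
      ... | inj₁ refl = here refl
      ... | inj₂ adj  = there (∈-filter⁺ (adj? t) (All.lookup reached x∈) adj)
      t∉v : t ∉ desc v
      t∉v t∈v = t∉ (subst (λ w → t ∈ desc w) (sym word≡) (keep letters))
        where
        keep : ∀ {p} → All (_∈ ts) p → t ∈ desc (p ++ v)
        keep [] = t∈v
        keep {s ∷ p} (s∈ ∷ ss) with clique-Adj (adjacents cl) (ts⊆ (there s∈)) t∈T
        ... | inj₁ refl = here refl
        ... | inj₂ adj  = there (∈-filter⁺ (adj? s) (keep ss) adj)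

  Q₀ : Point
  Q₀ = Cube [] (std 4)

  open Simplex (V []) Q₀ public

  record GoodCube (Q : Point) : Set where
    field
      word    : List Point
      dirs    : List Point
      roots-w : All Root word
      cliq    : Clique dirs
      size    : length dirs ≡ 4
      cube≡   : Q ≡ Cube word dirs
      good    : Good word dirs

  GoodCube-at : ∀ {w T} → All Root w → Clique T → length T ≡ 4 → GoodCube (Cube w T) → Good w T
  GoodCube-at rw cl len gc = Good-Cube roots-w rw cliq cl (trans size (sym len)) (sym cube≡) good
    where open GoodCube gc

  -- If `s` were an ascent at the vertex of largest value, crossing it alone might leave the value
  -- unchanged. So another direction `t` is made a descent beforehand; crossing `s` then yields two
  -- last letters and a strictly larger value.
  top-descents : ∀ {v T} → Reduced v → Allowed v → unused v ⊆ T → Clique T → length T ≡ 4 →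
    LargestIn (Cube v T) (V v) → T ⊆ desc v
  top-descents {v} {a ∷ b ∷ T} red al un cl len (_ , k , value-k , largest) {s} s∈ with s ∈? desc v
  ... | yes s∈desc = s∈desc
  ... | no s∉desc  = ⊥-elim (contradiction other)
    where
    other : ∃[ t ] (t ∈ a ∷ b ∷ T × t ≢ s)
    other with a ≟ᴾ s
    ... | no a≢s   = a , here refl , a≢s
    ... | yes refl = b , there (here refl) , λ { refl → Root-irrefl (All.lookup (areRoots cl) s∈)
                       (All.lookup (AllPairs.head (adjacents cl)) (here refl)) }
    contradiction : ¬ (∃[ t ] (t ∈ a ∷ b ∷ T × t ≢ s))
    contradiction (t , t∈ , t≢s) = ℕ.<⇒≱ (ℕ.≤-<-trans value≤ strict) s-value≤
      where
      ts⊆ : t ∷ [] ⊆ a ∷ b ∷ T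
      ts⊆ (here refl) = t∈
      t∉s : t ∉ s ∷ []
      t∉s (here t≡s) = t≢s t≡s
      open Climb (climb {avoid = s ∷ []} (t ∷ []) cl red al un (s∉desc ∷ []) ts⊆ (t∉s ∷ []))
      reduced′ : Reduced (s ∷ word)
      reduced′ = step (All.lookup (areRoots cl) s∈) (All.head avoided) reduced
      allowed′ : Allowed (s ∷ word)
      allowed′ = step (clique-star cl unused⊆ s∈) allowed
      strict : value word < value (s ∷ word)
      strict = value-strict reduced′ allowed′
        (there (∈-filter⁺ (adj? s) (All.head reached) (clique-adj cl s∈ t∈ (t≢s ∘ sym)))) t≢s
      incident : Incident vertex hypercube (V (s ∷ word)) (Cube v (a ∷ b ∷ T))
      incident = subst (Incident vertex hypercube (V (s ∷ word)))
        (trans (Cube-absorb {word} cl s∈) (trans (cong (λ w → Cube w (a ∷ b ∷ T)) word≡)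
          (Cube-++ {path} {v} cl (All.map ts⊆ letters))))
        (V-Incident (Reduced⇒Root reduced′) cl len)
      s-value≤ : value (s ∷ word) ≤ value v
      s-value≤ with j , value-j , j≤k ← largest (V (s ∷ word)) incident =
        subst₂ _≤_ (Card-unique value-j (value-correct {Q₀} reduced′ allowed′))
                   (Card-unique value-k (value-correct {Q₀} red al)) j≤k

  next-good : ∀ {Q v Q′} → GoodCube Q → LargestIn Q v → Incident vertex hypercube v Q′ → GoodCube Q′
  next-good {Q} {v} {Q′} gc largest inc = record
    { word = Y.word ; dirs = Y.dirs ; roots-w = Y.roots-w ; cliq = Y.cliq ; size = Y.size ; cube≡ = Y.cube≡
    ; good = record { word = word ; reduced = reduced ; allowed = allowed
                    ; equal = ≈-trans (V-faithful Y.roots-w X.roots-w (trans (sym Y.vertex≡) X.vertex≡)) equal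
                    ; unused⊆ = λ j∈ → ⊥-elim (unused-∉ word j∈ (desc⊆ word (top (unused⊆ j∈)))) } }
    where
    module X = VertexAt (Incident⇒VertexAt (proj₁ largest))
    module Y = VertexAt (Incident⇒VertexAt inc)
    open Good (GoodCube-at X.roots-w X.cliq X.size (subst GoodCube X.cube≡ gc))
    top : X.dirs ⊆ desc word
    top = top-descents reduced allowed unused⊆ X.cliq X.size
      (subst₂ LargestIn (trans X.cube≡ (Cube-≈ X.dirs equal)) (trans X.vertex≡ (V-≈ equal)) largest)

  -- Names the cubes around a square at one common vertex, so that their directions can be compared
  -- within one 600-cell.
  record Around (w f : List Point) (Q : Point) : Set where
    field
      dirs  : List Point
      cliq  : Clique dirs
      size  : length dirs ≡ 4
      cube≡ : Q ≡ Cube w dirs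
      good  : Good w dirs
      face⊆ : f ⊆ dirs

  tail₂-clique : ∀ {a b s t} → Clique (a ∷ b ∷ s ∷ t ∷ []) → Clique (s ∷ t ∷ [])
  tail₂-clique (clique (_ ∷ _ ∷ rs) (_ ∷ _ ∷ as)) = clique rs as

  around : ∀ {x w s t Q} → All Root w → Clique (s ∷ t ∷ []) → x ≡ Cube w (s ∷ t ∷ []) →
    GoodCube Q → Incident square hypercube x Q → Around w (s ∷ t ∷ []) Q
  around rw cl square≡ gc inc = record
    { dirs  = Y.a ∷ Y.b ∷ Y.s ∷ Y.t ∷ []
    ; cliq  = Y.cliq
    ; size  = refl
    ; cube≡ = trans Y.cube≡ (sym (trans (Cube-≈ (Y.a ∷ Y.b ∷ Y.s ∷ Y.t ∷ []) equal) (Cube-++ {word} {Y.word} Y.cliq letters′)))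
    ; good  = Good-≈ equal (Good-++ Y.cliq letters′
                (GoodCube-at Y.roots-w Y.cliq refl (subst GoodCube Y.cube≡ gc)))
    ; face⊆ = λ x∈ → there (there (⊆ʳ x∈))
    }
    where
    module Y = SquareAt (Incident⇒SquareAt inc)
    open Coset (Cube-faithful Y.roots-w rw (tail₂-clique Y.cliq) cl refl (trans (sym Y.square≡) square≡))
    letters′ = All.map (λ x∈ → there (there x∈)) letters

  -- A triangle of the 600-cell has only two common neighbours.
  three-around : ∀ {w f j Q₁ Q₂ Q₃} → Clique f → length f ≡ 2 → j ∉ f →
    (y₁ : Around w f Q₁) (y₂ : Around w f Q₂) (y₃ : Around w f Q₃) →
    j ∈ Around.dirs y₁ → j ∈ Around.dirs y₂ → j ∈ Around.dirs y₃ →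
    Q₁ ≢ Q₂ → Q₁ ≢ Q₃ → Q₂ ≢ Q₃ → ⊥
  three-around {w} {f} {j} cl len j∉f y₁ y₂ y₃ j∈₁ j∈₂ j∈₃ Q₁≢Q₂ Q₁≢Q₃ Q₂≢Q₃ =
    triangle-neighbours (sub-clique (Around.cliq y₁) c! (c⊆ y₁ j∈₁)) (cong suc len)
      (kc-clique F₁) (kc-clique F₂) (kc-clique F₃)
      ((distinct F₁ F₂ Q₁≢Q₂ ∷ distinct F₁ F₃ Q₁≢Q₃ ∷ []) ∷ (distinct F₂ F₃ Q₂≢Q₃ ∷ []) ∷ [] ∷ [])
    where
    c : List Point
    c = j ∷ f
    c! : Unique c
    c! = All.tabulate (λ { x∈ refl → j∉f x∈ }) ∷ clique-unique cl
    c⊆ : ∀ {Q} (y : Around w f Q) → j ∈ Around.dirs y → c ⊆ Around.dirs y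
    c⊆ y j∈ (here refl) = j∈
    c⊆ y j∈ (there x∈)  = Around.face⊆ y x∈
    record Fourth (Q : Point) : Set where
      field
        k         : Point
        kc-clique : Clique (k ∷ c)
        kc-cube   : Q ≡ Cube w (k ∷ c)
    open Fourth
    fourth : ∀ {Q} (y : Around w f Q) → j ∈ Around.dirs y → Fourth Q
    fourth {Q} y j∈ with k , k∈ , k∉ ← extra {c} (clique-unique (Around.cliq y))
        (ℕ.≤-reflexive (trans (cong (2 ℕ.+_) len) (sym (Around.size y)))) = record
      { k = k
      ; kc-clique = cl′
      ; kc-cube   = trans (Around.cube≡ y) (cong (act u ∘ ⟦ w ⟧) (corner-set (Around.cliq y) cl′
          (⊆-antisym kc! kc⊆ (ℕ.≤-reflexive (trans (Around.size y) (cong (2 ℕ.+_) (sym len))))) kc⊆))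
      }
      where
      kc! : Unique (k ∷ c)
      kc! = All.tabulate (λ { x∈ refl → k∉ x∈ }) ∷ c!
      kc⊆ : k ∷ c ⊆ Around.dirs y
      kc⊆ (here refl) = k∈
      kc⊆ (there x∈)  = c⊆ y j∈ x∈
      cl′ : Clique (k ∷ c)
      cl′ = sub-clique (Around.cliq y) kc! kc⊆
    distinct : ∀ {Q Q′} (y : Fourth Q) (y′ : Fourth Q′) → Q ≢ Q′ → k y ≢ k y′
    distinct y y′ Q≢Q′ eq = Q≢Q′ (trans (kc-cube y) (trans (cong (λ k → Cube w (k ∷ c)) eq) (sym (kc-cube y′))))
    F₁ = fourth y₁ j∈₁
    F₂ = fourth y₂ j∈₂
    F₃ = fourth y₃ j∈₃

  convex-good : ∀ {s Q₁ Q₂ Q₃ Q} → GoodCube Q₁ → GoodCube Q₂ → GoodCube Q₃ →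
    Q₁ ≢ Q₂ → Q₁ ≢ Q₃ → Q₂ ≢ Q₃ →
    Incident square hypercube s Q₁ → Incident square hypercube s Q₂ →
    Incident square hypercube s Q₃ → Incident square hypercube s Q → GoodCube Q
  convex-good {s} {Q₁} {Q₂} {Q₃} {Q} g₁ g₂ g₃ Q₁≢Q₂ Q₁≢Q₃ Q₂≢Q₃ i₁ i₂ i₃ i = record
    { word = X.word ; dirs = X.a ∷ X.b ∷ f ; roots-w = X.roots-w ; cliq = X.cliq ; size = refl
    ; cube≡ = X.cube≡
    ; good = record { word = word ; reduced = reduced ; allowed = allowed ; equal = equal
                    ; unused⊆ = λ {j} j∈ → there (there (in-face j∈)) } }
    where
    module X = SquareAt (Incident⇒SquareAt i)
    f : List Point
    f = X.s ∷ X.t ∷ []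
    f-clique : Clique f
    f-clique = tail₂-clique X.cliq
    y₁ : Around X.word f Q₁
    y₁ = around X.roots-w f-clique X.square≡ g₁ i₁
    y₂ : Around X.word f Q₂
    y₂ = around X.roots-w f-clique X.square≡ g₂ i₂
    y₃ : Around X.word f Q₃
    y₃ = around X.roots-w f-clique X.square≡ g₃ i₃
    open Good (Around.good y₁)
    un : ∀ {Q} (y : Around X.word f Q) → unused word ⊆ Around.dirs y
    un y = proj₂ (Good-unused (Around.good y) reduced equal)
    in-face : unused word ⊆ f
    in-face {j} j∈ = decidable-stable (j ∈? f) λ j∉ →
      three-around f-clique refl j∉ y₁ y₂ y₃ (un y₁ j∈) (un y₂ j∈) (un y₃ j∈) Q₁≢Q₂ Q₁≢Q₃ Q₂≢Q₃

  𝒫⇒GoodCube : ∀ {Q} → 𝒫 Q → GoodCube Q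
  𝒫⇒GoodCube first = record
    { word = [] ; dirs = std 4 ; roots-w = [] ; cliq = std-clique 4 ℕ.≤-refl ; size = refl ; cube≡ = refl
    ; good = record { word = [] ; reduced = [] ; allowed = [] ; equal = ≈-refl ; unused⊆ = λ j∈ → j∈ } }
  𝒫⇒GoodCube (next p largest inc) = next-good (𝒫⇒GoodCube p) largest inc
  𝒫⇒GoodCube (convex p₁ p₂ p₃ Q₁≢Q₂ Q₁≢Q₃ Q₂≢Q₃ i₁ i₂ i₃ i) =
    convex-good (𝒫⇒GoodCube p₁) (𝒫⇒GoodCube p₂) (𝒫⇒GoodCube p₃) Q₁≢Q₂ Q₁≢Q₃ Q₂≢Q₃ i₁ i₂ i₃ i

-- Links in the 600-cell

AdjacentPair : List Point → Point → Set
AdjacentPair seen r = Any.Any (λ x → Adj r x × Any.Any (λ y → Adj x y × Adj r y) seen) seen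

data Shelled : List Point → List Point → Set where
  []   : ∀ {seen} → Shelled seen []
  _∷_  : ∀ {seen r rest} → r ∈ seen ⊎ AdjacentPair seen r → Shelled (r ∷ seen) rest → Shelled seen (r ∷ rest)

shelled? : ∀ seen rest → Dec (Shelled seen rest)
shelled? seen []         = yes []
shelled? seen (r ∷ rest) with (r ∈? seen) ⊎-dec any? (λ x → adj? r x ×-dec any? (λ y → adj? x y ×-dec adj? r y) seen) seen
... | no ¬p = no λ { (p ∷ _) → ¬p p }
... | yes p with shelled? (r ∷ seen) rest
...   | yes ps = yes (p ∷ ps)
...   | no ¬ps = no λ { (_ ∷ ps) → ¬ps ps }

opaque
  unfolding orbit

  -- The order found by `explore` is suitable for the 600-cell and for its icosahedral vertex link.
  -- The link of an edge is a pentagon and has no triangles; there `convex` acts directly.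
  orbit-shelled : ∀ k → k ≤ 1 → Shelled (e (suc k) ∷ e k ∷ []) (orbit k)
  orbit-shelled 0 _ = toWitness {a? = shelled? (e 1 ∷ e 0 ∷ []) (orbit 0)} _
  orbit-shelled 1 _ = toWitness {a? = shelled? (e 2 ∷ e 1 ∷ []) (orbit 1)} _
  orbit-shelled (suc (suc _)) (s≤s ())

shelled-spread : ∀ (P L : Point → Set) →
  (∀ {x y r} → L x → L y → L r → Adj x y → Adj r x → Adj r y → P x → P y → P r) →
  ∀ {seen rest} → Shelled seen rest → All (λ x → L x × P x) seen → All L rest → All P rest
shelled-spread P L spread []       _    _        = []
shelled-spread P L spread {seen} (_∷_ {r = r} s ss) seen⁺ (l ∷ ls) = p ∷ shelled-spread P L spread ss ((l , p) ∷ seen⁺) ls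
  where
  reach : r ∈ seen ⊎ AdjacentPair seen r → P r
  reach (inj₁ r∈) = proj₂ (All.lookup seen⁺ r∈)
  reach (inj₂ pair) with x , x∈ , rx , pair′ ← find pair with y , y∈ , xy , ry ← find pair′ =
    spread (proj₁ (All.lookup seen⁺ x∈)) (proj₁ (All.lookup seen⁺ y∈)) l xy rx ry
      (proj₂ (All.lookup seen⁺ x∈)) (proj₂ (All.lookup seen⁺ y∈))
  p : P r
  p = reach s

-- Induction along an order of the link in which each vertex after the first two forms a
-- triangle with two earlier ones.
link-connected : ∀ {c p q} → Clique (p ∷ q ∷ c) → length c ≤ 1 → (P : Point → Set) →
  (∀ {x y r} → Clique (x ∷ y ∷ r ∷ c) → P x → P y → P r) → P p → P q → ∀ {r} → Clique (r ∷ c) → P r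
link-connected {c} {p} {q} cl c≤1 P spread Pp Pq {r} cl-r
  with _ , w , w⊆ , pqc≡ ← homogeneous cl =
  subst P (act-reverse′ w r) (All.lookup all-P r′∈)
  where
  k = length c
  p≡ : p ≡ act w (e (suc k))
  p≡ = List.∷-injectiveˡ pqc≡
  q≡ : q ≡ act w (e k)
  q≡ = List.∷-injectiveˡ (List.∷-injectiveʳ pqc≡)
  c≡ : c ≡ List.map (act w) (std k)
  c≡ = List.∷-injectiveʳ (List.∷-injectiveʳ pqc≡)
  k≤3 : k ≤ 3
  k≤3 = ℕ.≤-trans c≤1 (s≤s z≤n)
  r′ : Point
  r′ = act (reverse w) r
  L : Point → Set
  L x = Clique (act w x ∷ c)
  r′-clique : Clique (act w r′ ∷ c)
  r′-clique = subst (λ x → Clique (x ∷ c)) (sym (act-reverse′ w r)) cl-r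
  r′∈ : r′ ∈ orbit k
  r′∈ = All.lookup (neighbours-transitive k k≤3)
    (Root⇒∈roots (act-Root (Isotropy-reverse w⊆) (All.head (areRoots cl-r))))
    (All.tabulate λ {y} y∈ → act-Adj⁻ w (All.lookup (AllPairs.head (adjacents r′-clique))
      (subst (act w y ∈_) (sym c≡) (∈-map⁺ (act w) y∈))))
  in-link : All L (orbit k)
  in-link = All.tabulate λ {x} x∈ → let v , v⊆ , x≡ = ∈orbit⇒Orbit k x∈ in
    subst (λ x → Clique (act w x ∷ c)) x≡ (subst Clique
      (cong₂ _∷_ refl (trans (sym (List.map-∘ (std k))) (sym (trans c≡ (List.map-cong-local
        (All.tabulate λ y∈ → cong (act w) (sym (act-fixes (All.map (λ i∈ → proj₂ (All.lookup (gens-fix-std k k≤3) i∈)) v⊆) y∈))))))))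
      (map-clique w⊆ (map-clique (All.map (λ i∈ → proj₁ (All.lookup (gens-fix-std k k≤3) i∈)) v⊆)
        (std-clique (suc k) (s≤s k≤3)))))
  start : All (λ x → L x × P (act w x)) (e (suc k) ∷ e k ∷ [])
  start = (subst (λ x → Clique (x ∷ c)) p≡ (sub-clique cl p-unique λ { (here eq) → here eq ; (there x∈) → there (there x∈) }) , subst P p≡ Pp)
        ∷ (subst (λ x → Clique (x ∷ c)) q≡ (clique-tail cl) , subst P q≡ Pq) ∷ []
    where
    clique-tail : ∀ {x c} → Clique (x ∷ c) → Clique c
    clique-tail (clique (_ ∷ rs) (_ ∷ as)) = clique rs as
    p-unique : Unique (p ∷ c)
    p-unique with (_ ∷ p∉) ∷ _ ∷ c! ← clique-unique cl = p∉ ∷ c!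
  all-P : All (P ∘ act w) (orbit k)
  all-P = shelled-spread (P ∘ act w) L
    (λ { {x} {y} {r} (clique (rx ∷ _) (ax ∷ _)) (clique (ry ∷ _) (ay ∷ _)) (clique (rr ∷ rs) (ar ∷ as)) xy rx′ ry′ →
      spread (clique (rx ∷ ry ∷ rr ∷ rs)
        ((act-Adj w {x} {y} xy ∷ Adj-sym {act w r} {act w x} (act-Adj w {r} {x} rx′) ∷ ax)
        ∷ (Adj-sym {act w r} {act w y} (act-Adj w {r} {y} ry′) ∷ ay) ∷ ar ∷ as)) })
    (orbit-shelled k c≤1) start in-link

-- All admissible cubes belong to the convex part

clique-tail : ∀ {x c} → Clique (x ∷ c) → Clique c
clique-tail (clique (_ ∷ rs) (_ ∷ as)) = clique rs as

clique-swap : ∀ {x y c} → Clique (x ∷ y ∷ c) → Clique (y ∷ x ∷ c)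
clique-swap {x} {y} (clique (rx ∷ ry ∷ rs) ((xy ∷ ax) ∷ ay ∷ as)) =
  clique (ry ∷ rx ∷ rs) ((Adj-sym {x} {y} xy ∷ ay) ∷ ax ∷ as)

clique-∉ : ∀ {x c} → Clique (x ∷ c) → x ∉ c
clique-∉ cl x∈ = All.lookup (AllPairs.head (clique-unique cl)) x∈ refl

extend : ∀ {c} → Clique c → length c ≤ 3 → ∃[ q ] Clique (q ∷ c)
extend {c} cl c≤3 with _ , w , w⊆ , c≡ ← homogeneous cl =
  act w (e (length c)) ,
  subst (λ c′ → Clique (act w (e (length c)) ∷ c′)) (sym c≡) (map-clique w⊆ (std-clique (suc (length c)) (s≤s c≤3)))

-- The last generator fixes e 0, e 1, e 2 and moves e 3.
second-neighbour : ∀ {q c} → Clique (q ∷ c) → length c ≡ 3 → ∃[ r ] (r ≢ q × Clique (r ∷ c))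
second-neighbour {q} {c} cl len with _ , w , w⊆ , qc≡ ← homogeneous cl =
  act w σe , (λ r≡q → σe≢ (act-injective (trans r≡q (List.∷-injectiveˡ qc≡′)))) ,
  subst (λ c′ → Clique (act w σe ∷ c′)) (sym (List.∷-injectiveʳ qc≡′))
    (map-clique w⊆ (clique (act-Root (suc∈gens (suc (suc (suc zero))) ∷ []) (Root-e 3) ∷ areRoots (std-clique 3 (s≤s (s≤s (s≤s z≤n)))))
      ((refl ∷ refl ∷ refl ∷ []) ∷ adjacents (std-clique 3 (s≤s (s≤s (s≤s z≤n)))))))
  where
  σe : Point
  σe = reflect (suc (suc (suc (suc zero)))) (e 3)
  σe≢ : σe ≢ e 3
  σe≢ = toWitnessFalse {a? = σe ≟ᴾ e 3} _
  qc≡′ : q ∷ c ≡ List.map (act w) (std 4)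
  qc≡′ = trans qc≡ (cong (List.map (act w) ∘ std ∘ suc) len)
  act-injective : ∀ {x y} → act w x ≡ act w y → x ≡ y
  act-injective {x} {y} eq = trans (sym (act-reverse w x)) (trans (cong (act (reverse w)) eq) (act-reverse w y))

unused-⊆-std : ∀ w → unused w ⊆ std 4
unused-⊆-std []      j∈ = j∈
unused-⊆-std (s ∷ w) j∈ = unused-⊆-std w (proj₁ (∈-unused⁻ w j∈))

unused-unique : ∀ w → Unique (unused w)
unused-unique []      = clique-unique (std-clique 4 ℕ.≤-refl)
unused-unique (s ∷ w) = Unique.filter⁺ (λ j → ¬? (j ≟ᴾ s)) (unused-unique w)

unused-clique : ∀ w → Clique (unused w)
unused-clique w = sub-clique (std-clique 4 ℕ.≤-refl) (unused-unique w) (unused-⊆-std w)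

-- When the letter was added it lay in the star of `j`, and it was not `j`, which would then have
-- been used.
letter-adj : ∀ {w s j} → Allowed w → s ∈ w → j ∈ unused w → Adj j s
letter-adj {t ∷ w} (step star al) (here refl) j∈ with j∈w , j≢t ← ∈-unused⁻ w j∈ with All.lookup star j∈w
... | inj₁ j≡t = ⊥-elim (j≢t j≡t)
... | inj₂ adj = adj
letter-adj {t ∷ w} (step star al) (there s∈) j∈ = letter-adj al s∈ (proj₁ (∈-unused⁻ w j∈))

desc-unused-clique : ∀ {w} → Reduced w → Allowed w → ∀ {c} → Clique c → c ⊆ desc w → Clique (c ++ unused w)
desc-unused-clique {w} red al {[]} _ _ = unused-clique w
desc-unused-clique {w} red al {s ∷ c} (clique (r ∷ rs) (a ∷ as)) c⊆
  with clique rs′ as′ ← desc-unused-clique red al (clique rs as) (λ x∈ → c⊆ (there x∈)) =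
  clique (r ∷ rs′) (All.++⁺ a (All.tabulate λ {j} j∈ → Adj-sym {j} {s} (letter-adj al (desc⊆ w (c⊆ (here refl))) j∈)) ∷ as′)

module Completeness (u : List (Fin 5)) where

  open Soundness u public

  -- Reflections in the vertices of a cell commute, so only the parity of the occurrences of `t`
  -- matters; `R t t` is the opposite of `t`.
  clique-word : ∀ {r T t} → All Root T → AllPairs Adj T → All (_∈ T) r → t ∈ T → ⟦ r ⟧ t ≡ t ⊎ ⟦ r ⟧ t ≡ R t t
  clique-word rs as [] t∈ = inj₁ refl
  clique-word {s ∷ r} {T} {t} rs as (s∈ ∷ ss) t∈ = step-s (clique-Adj as s∈ t∈) (clique-word rs as ss t∈)
    where
    t-root = All.lookup rs t∈
    r-roots = All.map (All.lookup rs) ss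
    step-s : s ≡ t ⊎ Adj s t → ⟦ r ⟧ t ≡ t ⊎ ⟦ r ⟧ t ≡ R t t → ⟦ r ⟧ (R s t) ≡ t ⊎ ⟦ r ⟧ (R s t) ≡ R t t
    step-s (inj₂ adj) (inj₁ eq) = inj₁ (trans (cong ⟦ r ⟧ (R-fix {s} {t} adj)) eq)
    step-s (inj₂ adj) (inj₂ eq) = inj₂ (trans (cong ⟦ r ⟧ (R-fix {s} {t} adj)) eq)
    step-s (inj₁ refl) (inj₁ eq) = inj₂ (trans (R-conj (word-isometry r-roots) t t) (cong₂ R eq eq))
    step-s (inj₁ refl) (inj₂ eq) = inj₁ (trans (R-conj (word-isometry r-roots) t t)
      (trans (cong₂ R eq eq) (trans (sym (R-conj (R-isometry t-root) t t)) (R-involutive t-root t))))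

  -- A nonempty reduced quotient would fix or reverse its last letter `s`. Fixing contradicts that
  -- `s` is a descent of the quotient, reversing that `s` is a descent at both tops.
  tops-equal : ∀ {v w T T′} → Reduced v → Reduced w → Clique T → Clique T′ → length T ≡ length T′ →
    T ⊆ desc v → T′ ⊆ desc w → Cube v T ≡ Cube w T′ → v ≈ w
  tops-equal {v} {w} {T} red-v red-w cl cl′ len top-v top-w eq = ≈-sym (go word reduced letters equal)
    where
    open Coset (Cube-faithful (Reduced⇒Root red-v) (Reduced⇒Root red-w) cl cl′ len eq)
    go : ∀ r → Reduced r → All (_∈ T) r → w ≈ r ++ v → w ≈ v
    go []      _   _  w≈ = w≈
    go (s ∷ r) red ss@(s∈ ∷ _) w≈ = ⊥-elim (absurd (clique-word (areRoots cl) (adjacents cl) ss s∈))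
      where
      s-root = All.lookup (areRoots cl) s∈
      absurd : ⟦ s ∷ r ⟧ s ≡ s ⊎ ⟦ s ∷ r ⟧ s ≡ R s s → ⊥
      absurd (inj₁ fixed) = Pos-⊝ (weight 1 0 (s≤s z≤n)) (subst (Pos ∘ ⊝_)
        (trans (cong (λ x → ⟨ c₀ , x ⟩) fixed) (⟨c₀,root⟩ s-root))
        (Signs.descent (Reduced⇒Signs red) (here refl)))
      absurd (inj₂ flipped) = Pos-⊝ (Signs.descent (Reduced⇒Signs red-v) (top-v s∈))
        (subst (Pos ∘ ⊝_)
          (trans (cong (λ x → ⟨ c₀ , x ⟩) (trans (at w≈ s) (trans (⟦++⟧ (s ∷ r) v s) (cong ⟦ v ⟧ flipped))))
            (z-self s-root (Reduced⇒Root red-v)))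
          (Signs.descent (Reduced⇒Signs red-w) (top-w (⊆ˡ s∈))))

  record Tetra (T : List Point) : Set where
    constructor tetra
    field
      cliq : Clique T
      size : length T ≡ 4

  -- From any vertex of the cube, climbing in all directions never lowers the value and ends at a
  -- top, which is `v` by `tops-equal`.
  top-largest : ∀ {v T} → Reduced v → Allowed v → unused v ⊆ T → Tetra T → T ⊆ desc v →
    LargestIn (Cube v T) (V v)
  top-largest {v} {T} red al un (tetra cl len) top =
    V-Incident (Reduced⇒Root red) cl len , value v , value-correct {Q₀} red al , largest
    where
    largest : ∀ x → Incident vertex hypercube x (Cube v T) → ∃[ j ] (Value x j × j ≤ value v)
    largest x inc = value G.word , subst (λ y → Value y (value G.word)) (sym x≡) (value-correct {Q₀} G.reduced G.allowed) ,
      ℕ.≤-trans value≤ (ℕ.≤-reflexive (Card-unique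
        (value-correct {Q₀} reduced allowed)
        (subst (λ y → Value y (value v)) (V-≈ v≈) (value-correct {Q₀} red al))))
      where
      module X = VertexAt (Incident⇒VertexAt inc)
      good : Good X.word X.dirs
      good = Good-Cube (Reduced⇒Root red) X.roots-w cl X.cliq (trans len (sym X.size)) X.cube≡
        (record { word = v ; reduced = red ; allowed = al ; equal = ≈-refl ; unused⊆ = un })
      module G = Good good
      x≡ : x ≡ V G.word
      x≡ = trans X.vertex≡ (V-≈ G.equal)
      open Climb (climb {avoid = []} X.dirs X.cliq G.reduced G.allowed G.unused⊆ [] (λ t∈ → t∈) (All.tabulate λ _ ()))
      v≈ : v ≈ word
      v≈ = tops-equal red reduced cl X.cliq (trans len (sym X.size)) top (λ t∈ → All.lookup reached t∈)
        (trans X.cube≡ (trans (Cube-≈ X.dirs G.equal) (trans (sym (Cube-++ {path} {G.word} X.cliq letters))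
          (cong (λ w → Cube w X.dirs) (sym word≡)))))

  -- Climbing from `v` to the top of the cube crosses only ascents. A cube containing these
  -- directions has the same top among its vertices, so `next` yields it.
  𝒫-above : ∀ {v T T′} → Reduced v → Allowed v → unused v ⊆ T → Tetra T → 𝒫 (Cube v T) →
    Tetra T′ → (∀ {s} → s ∈ T → s ∉ desc v → s ∈ T′) → 𝒫 (Cube v T′)
  𝒫-above {v} {T} {T′} red al un (tetra cl len) p (tetra cl′ len′) ⊆T′ =
    subst 𝒫 (trans (cong (λ w → Cube w T′) word≡) (Cube-++ {path} {v} cl′
      (All.map (λ { (t∈ , t∉) → ⊆T′ t∈ t∉ }) (All.zip (letters , fresh)))))
      (next (subst 𝒫 (trans (sym (Cube-++ {path} {v} cl letters)) (cong (λ w → Cube w T) (sym word≡))) p)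
        (top-largest reduced allowed unused⊆ (tetra cl len) (λ t∈ → All.lookup reached t∈))
        (V-Incident (Reduced⇒Root reduced) cl′ len′))
    where
    open Climb (climb {avoid = []} T cl red al un [] (λ t∈ → t∈) (All.tabulate λ _ ()))

  Cube-⊆ : ∀ {v T T′} → All Root v → Clique T → Clique T′ → Cube v T ≡ Cube v T′ → T ⊆ T′
  Cube-⊆ {v} {T} {T′} rv cl cl′ eq = corner-⊆ cl cl′ (trans (sym (⟦reverse⟧ rv (corner T)))
    (trans (cong ⟦ reverse v ⟧ (act-u-injective eq)) (⟦reverse⟧ rv (corner T′))))

  Known : List Point → List Point → Set
  Known v c = ∀ {T} → Tetra T → c ⊆ T → 𝒫 (Cube v T)

  module _ {v} (rv : All Root v) where

    completion : ∀ {s t T} → Tetra T → Clique (s ∷ t ∷ []) → s ∷ t ∷ [] ⊆ T →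
      ∃[ a ] ∃[ b ] (Clique (a ∷ b ∷ s ∷ t ∷ []) × Cube v (a ∷ b ∷ s ∷ t ∷ []) ≡ Cube v T)
    completion {s} {t} {T} (tetra cl len) st st⊆
      with b , b∈ , b∉ ← extra {s ∷ t ∷ []} (clique-unique cl) (subst (3 ≤_) (sym len) (s≤s (s≤s (s≤s z≤n))))
      with a , a∈ , a∉ ← extra {b ∷ s ∷ t ∷ []} (clique-unique cl) (subst (4 ≤_) (sym len) ℕ.≤-refl) =
      a , b , abst , cong (act u ∘ ⟦ v ⟧) (corner-set abst cl abst⊆
        (⊆-antisym abst! abst⊆ (ℕ.≤-reflexive len)))
      where
      abst! : Unique (a ∷ b ∷ s ∷ t ∷ [])
      abst! = All.tabulate (λ { x∈ refl → a∉ x∈ }) ∷ All.tabulate (λ { x∈ refl → b∉ x∈ }) ∷ clique-unique st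
      abst⊆ : a ∷ b ∷ s ∷ t ∷ [] ⊆ T
      abst⊆ (here refl)         = a∈
      abst⊆ (there (here refl)) = b∈
      abst⊆ (there (there x∈))  = st⊆ x∈
      abst : Clique (a ∷ b ∷ s ∷ t ∷ [])
      abst = sub-clique cl abst! abst⊆

    around-square : ∀ {s t T} → Tetra T → Clique (s ∷ t ∷ []) → s ∷ t ∷ [] ⊆ T →
      Incident square hypercube (Cube v (s ∷ t ∷ [])) (Cube v T)
    around-square {s} {t} T4 st st⊆ with a , b , abst , eq ← completion T4 st st⊆ =
      subst (Incident square hypercube (Cube v (s ∷ t ∷ []))) eq (Square-Incident rv abst)

    -- Five cells surround the edge of `s` and `t`. The common cell of `p` and `q`, the other one at
    -- `p` and the other one at `q` give three distinct cubes around the square, and `convex` yields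
    -- the rest.
    known-square : ∀ {s t p q} → Clique (p ∷ q ∷ s ∷ t ∷ []) →
      Known v (p ∷ s ∷ t ∷ []) → Known v (q ∷ s ∷ t ∷ []) → Known v (s ∷ t ∷ [])
    known-square {s} {t} {p} {q} cl known-p known-q {T} T4 st⊆
      with r , r≢q , cl-r ← second-neighbour (clique-swap cl) refl
      with r′ , r′≢p , cl-r′ ← second-neighbour cl refl =
      convex (known-p (tetra cl-r refl) there) (known-p (tetra cl refl) λ { (here eq) → here eq ; (there x∈) → there (there x∈) })
        (known-q (tetra cl-r′ refl) there)
        (λ eq → r∉ (Cube-⊆ rv cl-r cl eq (here refl)))
        (λ eq → p∉ (Cube-⊆ rv cl-r cl-r′ eq (there (here refl))))
        (λ eq → p∉ (Cube-⊆ rv cl cl-r′ eq (here refl)))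
        (around-square (tetra cl-r refl) st (λ x∈ → there (there x∈)))
        (around-square (tetra cl refl) st (λ x∈ → there (there x∈)))
        (around-square (tetra cl-r′ refl) st (λ x∈ → there (there x∈)))
        (around-square T4 st st⊆)
      where
      st : Clique (s ∷ t ∷ [])
      st = clique-tail (clique-tail cl)
      r∉ : r ∉ p ∷ q ∷ s ∷ t ∷ []
      r∉ (here refl)         = clique-∉ cl-r (here refl)
      r∉ (there (here refl)) = r≢q refl
      r∉ (there (there r∈))  = clique-∉ cl-r (there r∈)
      p∉ : p ∉ r′ ∷ q ∷ s ∷ t ∷ []
      p∉ (here refl) = r′≢p refl
      p∉ (there p∈)  = clique-∉ cl p∈

    -- By `known-square` two vertices of a triangle in the icosahedral link of `d` pass the property
    -- to the third. `known-vertex` does the same over the whole 600-cell.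
    known-edge : ∀ {d p q} → Clique (p ∷ q ∷ d ∷ []) →
      Known v (p ∷ d ∷ []) → Known v (q ∷ d ∷ []) → Known v (d ∷ [])
    known-edge {d} cl known-p known-q {T} (tetra cl-T len) d⊆
      with r , r∈ , r∉ ← extra {d ∷ []} (clique-unique cl-T) (subst (2 ≤_) (sym len) (s≤s (s≤s z≤n))) =
      link-connected cl ℕ.≤-refl (λ x → Known v (x ∷ d ∷ [])) spread known-p known-q rd (tetra cl-T len)
        (λ { (here refl) → r∈ ; (there x∈) → d⊆ x∈ })
      where
      spread : ∀ {x y r} → Clique (x ∷ y ∷ r ∷ d ∷ []) → Known v (x ∷ d ∷ []) → Known v (y ∷ d ∷ []) → Known v (r ∷ d ∷ [])
      spread cl kx ky = known-square cl
        (λ T4 ⊆T → kx T4 λ { (here refl) → ⊆T (here refl) ; (there d∈) → ⊆T (there (there d∈)) })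
        (λ T4 ⊆T → ky T4 λ { (here refl) → ⊆T (here refl) ; (there d∈) → ⊆T (there (there d∈)) })
      rd : Clique (r ∷ d ∷ [])
      rd = sub-clique cl-T (All.tabulate (λ { x∈ refl → r∉ x∈ }) ∷ [] ∷ [])
        λ { (here refl) → r∈ ; (there x∈) → d⊆ x∈ }

    known-vertex : ∀ {p q} → Clique (p ∷ q ∷ []) → Known v (p ∷ []) → Known v (q ∷ []) → Known v []
    known-vertex cl known-p known-q {r ∷ T} (tetra cl-T len) _ =
      link-connected cl z≤n (λ x → Known v (x ∷ [])) spread known-p known-q (clique (All.head (areRoots cl-T) ∷ []) ([] ∷ []))
        (tetra cl-T len) λ { (here refl) → here refl }
      where
      spread : ∀ {x y r} → Clique (x ∷ y ∷ r ∷ []) → Known v (x ∷ []) → Known v (y ∷ []) → Known v (r ∷ [])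
      spread cl kx ky = known-edge cl
        (λ T4 ⊆T → kx T4 λ { (here refl) → ⊆T (here refl) })
        (λ T4 ⊆T → ky T4 λ { (here refl) → ⊆T (here refl) })

    known : ∀ {c p q} → Clique (p ∷ q ∷ c) → length c ≤ 2 → Known v (p ∷ c) → Known v (q ∷ c) → Known v c
    known {[]}            cl _ = known-vertex cl
    known {_ ∷ []}        cl _ = known-edge cl
    known {_ ∷ _ ∷ []}    cl _ = known-square cl
    known {_ ∷ _ ∷ _ ∷ _} cl (s≤s (s≤s ()))

  -- The cubes around a triangle c joined to the descent p are new at the top of the cube
  -- spanned by p ∷ c; from there convexity leads to the smaller cells c.
  known-link : ∀ {v p} → Reduced v → Allowed v → p ∈ desc v →
    (∀ {T s} → Tetra T → unused v ⊆ T → s ∈ T → s ∈ desc v → 𝒫 (Cube v T)) →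
    ∀ m {c} → Clique (p ∷ c) → unused v ⊆ c → m ℕ.+ length c ≡ 3 → Known v c
  known-link {v} {p} red al p∈ below zero {c} cl un len T4 c⊆T =
    𝒫-above red al (λ j∈ → there (un j∈)) (tetra cl (cong suc len))
      (below (tetra cl (cong suc len)) (λ j∈ → there (un j∈)) (here refl) p∈) T4
      λ { (here refl) p∉ → ⊥-elim (p∉ p∈) ; (there s∈) _ → c⊆T s∈ }
  known-link {v} {p} red al p∈ below (suc m) {c} cl un len
    with q , cl-q ← extend cl (subst (suc (length c) ≤_) len (s≤s (ℕ.m≤n+m (length c) m))) =
    -- The cubes at `p ∷ c` contain the descent `p` and come from below; those at `q ∷ c` come from
    -- the recursion towards triangles.
    known (Reduced⇒Root red) (clique-swap cl-q) (subst (length c ≤_) (ℕ.suc-injective len) (ℕ.m≤n+m (length c) m))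
      (λ T4 ⊆T → below T4 (λ j∈ → ⊆T (there (un j∈))) (⊆T (here refl)) p∈)
      (known-link red al p∈ below m (clique-swap cl-q) (λ j∈ → there (un j∈))
        (trans (ℕ.+-suc m (length c)) len))

  -- All cubes meeting a descent belong to 𝒫 already at a shorter word.
  good⇒𝒫 : ∀ n {v T} → length v ≤ n → Reduced v → Allowed v → Tetra T → unused v ⊆ T → 𝒫 (Cube v T)
  good⇒𝒫 n {[]} {T} _ _ _ (tetra cl len) un = subst 𝒫
    (cong (act u) (corner-set (std-clique 4 ℕ.≤-refl) cl un
      (⊆-antisym (clique-unique (std-clique 4 ℕ.≤-refl)) un (ℕ.≤-reflexive len)))) first
  good⇒𝒫 (suc n) {p ∷ v} {T} (s≤s v≤n) red al T4 un =
    known-link red al (here refl) below (3 ℕ.∸ length (unused (p ∷ v))) cl (λ j∈ → j∈)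
      (ℕ.m∸n+n≡m (ℕ.s≤s⁻¹ (proj₁ (homogeneous cl)))) T4 un
    where
    cl : Clique (p ∷ unused (p ∷ v))
    cl = desc-unused-clique red al {p ∷ []} (clique (All.head (Reduced⇒Root red) ∷ []) ([] ∷ [])) λ { (here refl) → here refl }
    below : ∀ {T s} → Tetra T → unused (p ∷ v) ⊆ T → s ∈ T → s ∈ desc (p ∷ v) → 𝒫 (Cube (p ∷ v) T)
    below {T} {s} T4 un s∈T s∈ = subst 𝒫
      (sym (trans (Cube-≈ T equal) (Cube-absorb {rest} (Tetra.cliq T4) s∈T)))
      (good⇒𝒫 n (ℕ.≤-trans (ℕ.≤-reflexive (ℕ.suc-injective (sym shorter))) v≤n) (Reduced-tail reduced)
        (Allowed-tail (allowed al)) T4 un′)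
      where
      open Exchange (exchange red s∈)
      un′ : unused rest ⊆ T
      un′ {j} j∈ with j ≟ᴾ s
      ... | yes refl = s∈T
      ... | no j≢s   = un (subst (j ∈_) (sym unused-≡) (∈-unused⁺ {s} {rest} j∈ j≢s))

-- Degrees, levels and types

star? : ∀ J s → Dec (Star J s)
star? J s = all? (λ j → (j ≟ᴾ s) ⊎-dec adj? j s) J

star-directions : List Point → List Point
star-directions J = filter (star? J) roots

extend-tetra : ∀ m {c} → Clique c → m ℕ.+ length c ≡ 4 → ∃[ T ] (Clique T × length T ≡ 4 × c ⊆ T)
extend-tetra zero    {c} cl len = c , cl , len , λ x∈ → x∈
extend-tetra (suc m) {c} cl len
  with q , cl-q ← extend cl (subst (length c ≤_) (ℕ.suc-injective len) (ℕ.m≤n+m (length c) m))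
  with T , cl-T , len-T , ⊆T ← extend-tetra m cl-q (trans (ℕ.+-suc m (length c)) len) =
  T , cl-T , len-T , λ x∈ → ⊆T (there x∈)

clique⊆tetra : ∀ {c} → Clique c → ∃[ T ] (Clique T × length T ≡ 4 × c ⊆ T)
clique⊆tetra {c} cl = extend-tetra (4 ℕ.∸ length c) cl (ℕ.m∸n+n≡m (proj₁ (homogeneous cl)))

star⊆tetra : ∀ {J s} → Clique J → Root s → Star J s → ∃[ T ] (Clique T × length T ≡ 4 × s ∷ J ⊆ T)
star⊆tetra {J} {s} cl r star with s ∈? J
... | yes s∈ with T , cl-T , len , J⊆T ← clique⊆tetra cl =
  T , cl-T , len , λ { (here refl) → J⊆T s∈ ; (there x∈) → J⊆T x∈ }
... | no s∉ = clique⊆tetra (clique (r ∷ areRoots cl) (All.tabulate adj ∷ adjacents cl))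
  where
  adj : ∀ {j} → j ∈ J → Adj s j
  adj {j} j∈ with All.lookup star j∈
  ... | inj₁ refl = ⊥-elim (s∉ j∈)
  ... | inj₂ a    = Adj-sym {j} {s} a

letters-agree : ∀ {r s} → Root s → Reduced r → s ∷ [] ≈ r → s ∈ r
letters-agree r red eq = desc⊆ _ (desc-≈ (step r (λ ()) []) red eq (here refl))

module Types (u : List (Fin 5)) where

  open Completeness u public

  cancel : ∀ {v r w} → All Root w → v ++ w ≈ r ++ w → v ≈ r
  cancel {v} {r} {w} rw eq = pointwise λ x → trans (sym (⟦reverse⟧ rw (⟦ v ⟧ x)))
    (trans (cong ⟦ reverse w ⟧ (trans (sym (⟦++⟧ v w x)) (trans (at eq x) (⟦++⟧ r w x)))) (⟦reverse⟧ rw (⟦ r ⟧ x)))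

  dir-injective : ∀ {w s t} → All Root w → Root s → Root t → V (s ∷ w) ≡ V (t ∷ w) → s ≡ t
  dir-injective {w} {s} {t} rw rs rt eq with letters-agree rs (step rt (λ ()) [])
    (cancel {s ∷ []} {t ∷ []} rw (V-faithful (rs ∷ rw) (rt ∷ rw) eq))
  ... | here s≡t = s≡t

  Neighbour : List Point → Point → Point → Set
  Neighbour w s y = (Root s × Star (unused w) s) × V (s ∷ w) ≡ y

  𝒫Edge⇒Neighbour : ∀ {w y} → Reduced w → 𝒫Edge (V w) y → ∃[ s ] Neighbour w s y
  𝒫Edge⇒Neighbour {w} {y} red (edge , Q , p , inc-w , inc-y)
    with s , r , y≡ ← Edge⇒dir (Reduced⇒Root red) refl edge = s , (r , star) , sym y≡
    where
    rw = Reduced⇒Root red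
    module X = VertexAt (Incident⇒VertexAt inc-w)
    module Y = VertexAt (Incident⇒VertexAt inc-y)
    good : Good X.word X.dirs
    good = GoodCube-at X.roots-w X.cliq X.size (subst GoodCube X.cube≡ (𝒫⇒GoodCube p))
    w≈ : X.word ≈ w
    w≈ = V-faithful X.roots-w rw (sym X.vertex≡)
    open Coset (Cube-faithful X.roots-w Y.roots-w X.cliq Y.cliq (trans X.size (sym Y.size)) (trans (sym X.cube≡) Y.cube≡))
    s∈ : s ∈ word
    s∈ = letters-agree r reduced (cancel {s ∷ []} {word} rw
      (≈-trans (V-faithful (r ∷ rw) Y.roots-w (trans (sym y≡) Y.vertex≡))
      (≈-trans equal (pointwise λ x → trans (⟦++⟧ word X.word x) (trans (at w≈ (⟦ word ⟧ x)) (sym (⟦++⟧ word w x)))))))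
    star : Star (unused w) s
    star = clique-star X.cliq (proj₂ (Good-unused good red w≈)) (All.lookup letters s∈)

  Neighbour⇒𝒫Edge : ∀ {w s y} → Reduced w → Allowed w → Neighbour w s y → 𝒫Edge (V w) y
  Neighbour⇒𝒫Edge {w} {s} red al ((r , star) , refl)
    with T , cl , len , ⊆T ← star⊆tetra (unused-clique w) r star =
    V-Edge rw r , Cube w T , good⇒𝒫 (length w) ℕ.≤-refl red al (tetra cl len) (λ j∈ → ⊆T (there j∈)) ,
    V-Incident rw cl len ,
    subst (Incident vertex hypercube (V (s ∷ w))) (Cube-absorb {w} cl (⊆T (here refl))) (V-Incident (r ∷ rw) cl len)
    where rw = Reduced⇒Root red

  degree-correct : ∀ {w} → Reduced w → Allowed w → Card (𝒫Edge (V w)) (length (star-directions (unused w)))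
  degree-correct {w} red al = List.map (λ s → V (s ∷ w)) (star-directions (unused w)) ,
    Enumerates-map (λ { (r , _) (r′ , _) → dir-injective (Reduced⇒Root red) r r′ })
      (λ {s} p → Neighbour⇒𝒫Edge red al (p , refl)) (𝒫Edge⇒Neighbour red)
      (Enumerates-filter (star? (unused w)) roots-enumerate) ,
    List.length-map _ (star-directions (unused w))

  word⇒𝒫path : ∀ {w} → Reduced w → Allowed w → Path 𝒫Edge (V []) (trace w) (V w)
  word⇒𝒫path []             []             = []
  word⇒𝒫path (step r s∉ red) (step star al) =
    word⇒𝒫path red al ++ᴾ (Neighbour⇒𝒫Edge red al ((r , star) , refl) ∷ [])

  normalise : ∀ {w s} → Reduced w → Allowed w → Root s → Star (unused w) s →
    ∃[ v ] (Reduced v × Allowed v × V (s ∷ w) ≡ V v)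
  normalise {w} {s} red al r star with s ∈? desc w
  ... | no s∉  = s ∷ w , step r s∉ red , step star al , refl
  ... | yes s∈ = rest , Reduced-tail reduced , Allowed-tail (allowed al) ,
      V-≈ (≈-trans (∷-≈ s equal) (∷-cancel r rest))
    where open Exchange (exchange red s∈)

  𝒫path⇒word : ∀ {w x p y} → Reduced w → Allowed w → x ≡ V w → Path 𝒫Edge x p y →
    ∃[ v ] (Reduced v × Allowed v × y ≡ V v)
  𝒫path⇒word {w} red al x≡ []                 = w , red , al , x≡
  𝒫path⇒word {w} red al x≡ (_∷_ {w = y} {p} {v} edge path) =
    let s , (r , star) , y≡ = 𝒫Edge⇒Neighbour red (subst (λ x → 𝒫Edge x y) x≡ edge)
        v , red-v , al-v , v≡ = normalise red al r star
    in 𝒫path⇒word red-v al-v (trans (sym y≡) v≡) path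

  -- Distances in `𝒫` and in the mosaic agree: the path of a reduced allowed word stays in `𝒫`, and
  -- no path of the mosaic is shorter.
  word⇒Level : ∀ {n w} → Word n w → Level n (V w)
  word⇒Level {w = w} (mk red al refl) = trace w ,
    (word⇒𝒫path red al , λ q path → proj₂ (trace-shortest red red refl) q (Path-map proj₁ path)) ,
    length-trace w

  Level-unique : ∀ {m n x} → Level m x → Level n x → m ≡ n
  Level-unique (p , (path , min) , refl) (q , (path′ , min′) , refl) = ℕ.≤-antisym (min q path′) (min′ p path)

  Level⇒word : ∀ {n x} → Level n x → ∃[ w ] (Word n w × x ≡ V w)
  Level⇒word level@(p , (path , _) , _) with w , red , al , refl ← 𝒫path⇒word [] [] refl path =
    w , mk red al (Level-unique (word⇒Level (mk red al refl)) level) , refl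

  drop-desc : ∀ {w s} → Root s → (red : Reduced w) (s∈ : s ∈ desc w) → s ∷ w ≈ Exchange.rest (exchange red s∈)
  drop-desc {w} {s} r red s∈ = ≈-trans (∷-≈ s equal) (∷-cancel r rest)
    where open Exchange (exchange red s∈)

  longer⇒desc : ∀ {v w s} → Reduced v → Reduced w → Root s → s ∷ v ≈ w → length w ≡ suc (length v) → s ∈ desc w
  longer⇒desc {v} {w} {s} red-v red-w r sv≈w len = desc-≈ (step r s∉ red-v) red-w sv≈w (here refl)
    where
    -- Otherwise `s` would cancel, and the result would be shorter than `v`.
    s∉ : s ∉ desc v
    s∉ s∈ = ℕ.m≢1+m+n (length rest) (trans
        (Same.length-≡ (≈⇒Same (Reduced-tail reduced) red-w (≈-trans (≈-sym (drop-desc r red-v s∈)) sv≈w)))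
        (trans len (cong suc (trans shorter (ℕ.+-comm 1 (length rest))))))
      where open Exchange (exchange red-v s∈)

  Incoming⇒desc : ∀ {w x} → Reduced w → Allowed w → Incoming (V w) x → ∃[ s ] (s ∈ desc w × V (s ∷ w) ≡ x)
  Incoming⇒desc {w} {x} red al (edge , n , level-x , level-w) =
    let v , mk red-v al-v v-size , x≡ = Level⇒word level-x
        s , (r , star) , w≡ = 𝒫Edge⇒Neighbour red-v (subst (λ y → 𝒫Edge y (V w)) x≡ edge)
        sv≈w = V-faithful (r ∷ Reduced⇒Root red-v) (Reduced⇒Root red) w≡
    in s ,
       longer⇒desc red-v red r sv≈w
         (trans (Level-unique (word⇒Level (mk red al refl)) level-w) (cong suc (sym v-size))) ,
       trans (V-≈ (≈-trans (∷-≈ s (≈-sym sv≈w)) (∷-cancel r v))) (sym x≡)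

  desc⇒Incoming : ∀ {w s} → Reduced w → Allowed w → s ∈ desc w → Incoming (V w) (V (s ∷ w))
  desc⇒Incoming {w} {s} red al s∈ =
    subst₂ 𝒫Edge rest≡ (V-≈ (≈-sym equal)) (Neighbour⇒𝒫Edge red-rest (Allowed-tail al′) ((r , star al′) , refl)) ,
    length rest , subst (Level (length rest)) rest≡ (word⇒Level (mk red-rest (Allowed-tail al′) refl)) ,
    word⇒Level (mk red al shorter)
    where
    open Exchange (exchange red s∈)
    al′ = allowed al
    star : Allowed (s ∷ rest) → Star (unused rest) s
    star (step st _) = st
    red-rest = Reduced-tail reduced
    r = All.head (Reduced⇒Root reduced)
    rest≡ : V rest ≡ V (s ∷ w)
    rest≡ = V-≈ (≈-sym (drop-desc r red s∈))

  indegree-correct : ∀ {w} → Reduced w → Allowed w → Card (Incoming (V w)) (length (desc w))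
  indegree-correct {w} red al = List.map (λ s → V (s ∷ w)) (desc w) ,
    Enumerates-map (λ s∈ t∈ → dir-injective rw (desc-Root rw s∈) (desc-Root rw t∈))
      (desc⇒Incoming red al) (Incoming⇒desc red al)
      (clique-unique (desc-clique rw) , λ s → mk⇔ (λ s∈ → s∈) (λ s∈ → s∈)) ,
    List.length-map _ (desc w)
    where rw = Reduced⇒Root red

-- Sums over a level

filter-map : ∀ {X Y : Set} {P : Y → Set} {Q : X → Set} (P? : Decidable P) (Q? : Decidable Q) (f : X → Y) →
  (∀ x → P (f x) ⇔ Q x) → ∀ xs → filter P? (map f xs) ≡ map f (filter Q? xs)
filter-map P? Q? f P⇔Q [] = refl
filter-map P? Q? f P⇔Q (x ∷ xs) with P? (f x) | Q? x
... | yes _ | yes _ = cong (f x ∷_) (filter-map P? Q? f P⇔Q xs)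
... | no _  | no _  = filter-map P? Q? f P⇔Q xs
... | yes p | no ¬q = ⊥-elim (¬q (Equivalence.to (P⇔Q x) p))
... | no ¬p | yes q = ⊥-elim (¬p (Equivalence.from (P⇔Q x) q))

filter-cong : ∀ {X : Set} {P Q : X → Set} (P? : Decidable P) (Q? : Decidable Q) {xs} →
  All (λ x → P x ⇔ Q x) xs → filter P? xs ≡ filter Q? xs
filter-cong P? Q? [] = refl
filter-cong P? Q? {x ∷ xs} (P⇔Q ∷ eqs) with P? x | Q? x
... | yes _ | yes _ = cong (x ∷_) (filter-cong P? Q? eqs)
... | no _  | no _  = filter-cong P? Q? eqs
... | yes p | no ¬q = ⊥-elim (¬q (Equivalence.to P⇔Q p))
... | no ¬p | yes q = ⊥-elim (¬p (Equivalence.from P⇔Q q))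

filter-split : ∀ {X : Set} {P Q S : X → Set} (P? : Decidable P) (Q? : Decidable Q) (S? : Decidable S) →
  (∀ {x} → P x → S x) → (∀ {x} → Q x → S x) → (∀ {x} → S x → P x ⊎ Q x) → (∀ {x} → P x → ¬ Q x) →
  ∀ xs → length (filter P? xs) ℕ.+ length (filter Q? xs) ≡ length (filter S? xs)
filter-split P? Q? S? PS QS SPQ PQ [] = refl
filter-split P? Q? S? PS QS SPQ PQ (x ∷ xs)
  with ih ← filter-split P? Q? S? PS QS SPQ PQ xs with P? x | Q? x | S? x
... | yes p | yes q | _     = ⊥-elim (PQ p q)
... | yes p | _     | no ¬s = ⊥-elim (¬s (PS p))
... | _     | yes q | no ¬s = ⊥-elim (¬s (QS q))
... | yes _ | no _  | yes _ = cong suc ih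
... | no _  | yes _ | yes _ = trans (ℕ.+-suc _ _) (cong suc ih)
... | no _  | no _  | no _  = ih
... | no ¬p | no ¬q | yes s with SPQ s
...   | inj₁ p = ⊥-elim (¬p p)
...   | inj₂ q = ⊥-elim (¬q q)

sum-fibres : ∀ {X : Set} (f : X → Point) {ys} → Unique ys → ∀ xs →
  sum (map (λ y → length (filter (λ x → f x ≟ᴾ y) xs)) ys) ≡ length (filter (λ x → f x ∈? ys) xs)
sum-fibres f [] xs = sym (cong length (List.filter-none (λ x → f x ∈? []) {xs} (All.tabulate λ _ ())))
sum-fibres f {y ∷ ys} (y∉ ∷ ys!) xs = trans
  (cong (length (filter (λ x → f x ≟ᴾ y) xs) ℕ.+_) (sum-fibres f ys! xs))
  (filter-split (λ x → f x ≟ᴾ y) (λ x → f x ∈? ys) (λ x → f x ∈? y ∷ ys)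
    here there (λ { (here eq) → inj₁ eq ; (there x∈) → inj₂ x∈ })
    (λ { refl x∈ → All.lookup y∉ x∈ refl }) xs)

State : Set
State = ℕ × ℕ

state : List Point → State
state w = length (unused w) , length (desc w)

-- j plus the number 120, 12, 5, 2 or 0 of vertices of the link of a cell with j vertices.
star-size : ℕ → ℕ
star-size 0 = 120
star-size 1 = 13
star-size 2 = 7
star-size 3 = 5
star-size _ = 4

opaque
  unfolding orbit

  star-size-std : ∀ j → j ≤ 4 → length (star-directions (std j)) ≡ star-size j
  star-size-std 0 _ = refl
  star-size-std 1 _ = refl
  star-size-std 2 _ = refl
  star-size-std 3 _ = refl
  star-size-std 4 _ = refl
  star-size-std (suc (suc (suc (suc (suc _))))) (s≤s (s≤s (s≤s (s≤s ()))))

act-roots : ∀ {h} → Isotropy h → roots ↭ map (act h) roots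
act-roots {h} h⊆ = ∼bag⇒↭ (unique∧set⇒bag roots-unique (Unique.map⁺ injective roots-unique) (mk⇔ to from))
  where
  injective : ∀ {x y} → act h x ≡ act h y → x ≡ y
  injective {x} {y} eq = trans (sym (act-reverse h x)) (trans (cong (act (reverse h)) eq) (act-reverse h y))
  to : ∀ {x} → x ∈ roots → x ∈ map (act h) roots
  to {x} x∈ = subst (_∈ map (act h) roots) (act-reverse′ h x)
    (∈-map⁺ (act h) (Root⇒∈roots (act-Root (Isotropy-reverse h⊆) (∈roots⇒Root x∈))))
  from : ∀ {x} → x ∈ map (act h) roots → x ∈ roots
  from x∈ with y , y∈ , refl ← ∈-map⁻ (act h) x∈ = Root⇒∈roots (act-Root h⊆ (∈roots⇒Root y∈))

module _ (h : List (Fin 5)) where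

  act-≡ : ∀ {x y} → (act h x ≡ act h y) ⇔ (x ≡ y)
  act-≡ {x} {y} = mk⇔ (λ eq → trans (sym (act-reverse h x)) (trans (cong (act (reverse h)) eq) (act-reverse h y)))
                      (cong (act h))

  act-Adj⇔ : ∀ {x y} → Adj (act h x) (act h y) ⇔ Adj x y
  act-Adj⇔ {x} {y} = mk⇔ (act-Adj⁻ h {x} {y}) (act-Adj h {x} {y})

  act-∉ : ∀ {x c} → (act h x ∉ map (act h) c) ⇔ (x ∉ c)
  act-∉ {x} {c} = mk⇔ (λ ∉m x∈ → ∉m (∈-map⁺ (act h) x∈)) to
    where
    to : x ∉ c → act h x ∉ map (act h) c
    to x∉ x∈ with y , y∈ , eq ← ∈-map⁻ (act h) x∈ = x∉ (subst (_∈ c) (sym (Equivalence.to act-≡ eq)) y∈)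

  act-Star : ∀ {J s} → Star (map (act h) J) (act h s) ⇔ Star J s
  act-Star {J} {s} = mk⇔ (λ st → All.map to (All.map⁻ st)) (λ st → All.map⁺ (All.map from st))
    where
    to : ∀ {j} → act h j ≡ act h s ⊎ Adj (act h j) (act h s) → j ≡ s ⊎ Adj j s
    to (inj₁ eq) = inj₁ (Equivalence.to act-≡ eq)
    to {j} (inj₂ a) = inj₂ (Equivalence.to (act-Adj⇔ {j} {s}) a)
    from : ∀ {j} → j ≡ s ⊎ Adj j s → act h j ≡ act h s ⊎ Adj (act h j) (act h s)
    from (inj₁ eq) = inj₁ (cong (act h) eq)
    from {j} (inj₂ a) = inj₂ (Equivalence.from (act-Adj⇔ {j} {s}) a)

star-size-correct : ∀ {J} → Clique J → length (star-directions J) ≡ star-size (length J)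
star-size-correct {J} cl with j≤4 , h , h⊆ , J≡ ← homogeneous cl = begin
  length (filter (star? J) roots)                       ≡⟨ cong (λ J → length (filter (star? J) roots)) J≡ ⟩
  length (filter (star? (map (act h) J₀)) roots)        ≡⟨ ↭-length (filter-↭ (star? (map (act h) J₀)) (act-roots h⊆)) ⟩
  length (filter (star? (map (act h) J₀)) (map (act h) roots))
    ≡⟨ cong length (filter-map (star? (map (act h) J₀)) (star? J₀) (act h) (λ s → act-Star h) roots) ⟩
  length (map (act h) (filter (star? J₀) roots))        ≡⟨ List.length-map (act h) (filter (star? J₀) roots) ⟩
  length (filter (star? J₀) roots)                      ≡⟨ star-size-std (length J) j≤4 ⟩
  star-size (length J)                                  ∎
  where
  open ≡-Reasoning
  J₀ = std (length J)

inClass : Class → State → Set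
inClass (type T) (j , d) = star-size j ≡ degree T × d ≡ indegree T
inClass all      _       = ⊤

inClass? : ∀ c σ → Dec (inClass c σ)
inClass? (type T) (j , d) = (star-size j ℕ.≟ degree T) ×-dec (d ℕ.≟ indegree T)
inClass? all      _       = yes tt

Admissible : List Point → List Point → Point → Set
Admissible Δ J s = s ∉ Δ × Star J s

admissible? : ∀ Δ J s → Dec (Admissible Δ J s)
admissible? Δ J s = (s ∉? Δ) ×-dec all? (λ j → (j ≟ᴾ s) ⊎-dec adj? j s) J

next-state : List Point → List Point → Point → State
next-state Δ J s = length (filter (λ j → ¬? (j ≟ᴾ s)) J) , suc (length (filter (adj? s) Δ))

-- The roots are a parameter so that their evaluation can be shared in `matrix-correct`.
successorsIn : List Point → List Point → List Point → List State
successorsIn xs Δ J = map (next-state Δ J) (filter (admissible? Δ J) xs)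

successors : List Point → List Point → List State
successors = successorsIn roots

successors-act : ∀ {h} → Isotropy h → ∀ Δ J → successors (map (act h) Δ) (map (act h) J) ↭ successors Δ J
successors-act {h} h⊆ Δ J = subst (successors hD hJ ↭_) eq (map-↭ (next-state hD hJ) (filter-↭ (admissible? hD hJ) (act-roots h⊆)))
  where
  hD = map (act h) Δ
  hJ = map (act h) J
  open ≡-Reasoning
  next-act : ∀ s → next-state hD hJ (act h s) ≡ next-state Δ J s
  next-act s = cong₂ _,_
    (trans (cong length (filter-map (λ j → ¬? (j ≟ᴾ act h s)) (λ j → ¬? (j ≟ᴾ s)) (act h)
        (λ j → mk⇔ (λ ≢m eq → ≢m (cong (act h) eq)) (λ ≢s eq → ≢s (Equivalence.to (act-≡ h) eq))) J))
      (List.length-map (act h) (filter (λ j → ¬? (j ≟ᴾ s)) J)))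
    (cong suc (trans (cong length (filter-map (adj? (act h s)) (adj? s) (act h) (λ t → act-Adj⇔ h {s} {t}) Δ))
      (List.length-map (act h) (filter (adj? s) Δ))))
  admissible⇔ : ∀ s → Admissible hD hJ (act h s) ⇔ Admissible Δ J s
  admissible⇔ s = mk⇔
    (λ { (∉D , st) → Equivalence.to (act-∉ h) ∉D , Equivalence.to (act-Star h) st })
    (λ { (∉D , st) → Equivalence.from (act-∉ h) ∉D , Equivalence.from (act-Star h) st })
  eq : map (next-state hD hJ) (filter (admissible? hD hJ) (map (act h) roots)) ≡ successors Δ J
  eq = begin
    map (next-state hD hJ) (filter (admissible? hD hJ) (map (act h) roots))
      ≡⟨ cong (map (next-state hD hJ)) (filter-map (admissible? hD hJ) (admissible? Δ J) (act h) admissible⇔ roots) ⟩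
    map (next-state hD hJ) (map (act h) (filter (admissible? Δ J) roots))
      ≡⟨ List.map-∘ (filter (admissible? Δ J) roots) ⟨
    map (next-state hD hJ ∘ act h) (filter (admissible? Δ J) roots)
      ≡⟨ List.map-cong next-act (filter (admissible? Δ J) roots) ⟩
    successors Δ J ∎

std-successorsIn : List Point → State → List State
std-successorsIn xs (j , d) = successorsIn xs (take d (std (d ℕ.+ j))) (drop d (std (d ℕ.+ j)))

std-successors : State → List State
std-successors = std-successorsIn roots

take-prefix : ∀ {X : Set} (xs ys : List X) → take (length xs) (xs ++ ys) ≡ xs
take-prefix []       ys = refl
take-prefix (x ∷ xs) ys = cong (x ∷_) (take-prefix xs ys)

drop-prefix : ∀ {X : Set} (xs ys : List X) → drop (length xs) (xs ++ ys) ≡ ys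
drop-prefix []       ys = refl
drop-prefix (x ∷ xs) ys = drop-prefix xs ys

successors-correct : ∀ {Δ J} → Clique (Δ ++ J) → successors Δ J ↭ std-successors (length J , length Δ)
successors-correct {Δ} {J} cl with _ , h , h⊆ , DJ≡ ← homogeneous cl =
  subst₂ (λ D′ J′ → successors D′ J′ ↭ std-successors (length J , length Δ)) (sym D≡) (sym J≡)
    (successors-act h⊆ (take (length Δ) s) (drop (length Δ) s))
  where
  s = std (length Δ ℕ.+ length J)
  DJ≡′ : Δ ++ J ≡ map (act h) s
  DJ≡′ = trans DJ≡ (cong (map (act h) ∘ std) (List.length-++ Δ))
  D≡ : Δ ≡ map (act h) (take (length Δ) s)
  D≡ = trans (sym (take-prefix Δ J)) (trans (cong (take (length Δ)) DJ≡′) (List.take-map (length Δ) s))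
  J≡ : J ≡ map (act h) (drop (length Δ) s)
  J≡ = trans (sym (drop-prefix Δ J)) (trans (cong (drop (length Δ)) DJ≡′) (List.drop-map (length Δ) s))

extension-states : ∀ {w} → Reduced w → Allowed w → map state (extensions w) ↭ std-successors (state w)
extension-states {w} red al = subst (_↭ std-successors (state w))
  (List.map-∘ (filter (extends? w) roots))
  (successors-correct (desc-unused-clique red al (desc-clique (Reduced⇒Root red)) (λ x∈ → x∈)))

module LevelSums (u : List (Fin 5)) where

  open Types u public

  InClass⇔inClass : ∀ {w} → Reduced w → Allowed w → ∀ c → InClass c (V w) ⇔ inClass c (state w)
  InClass⇔inClass red al all = mk⇔ (λ _ → tt) (λ _ → tt)
  InClass⇔inClass {w} red al (type T) = mk⇔
    (λ { (deg , indeg) → trans (sym size) (Card-unique (degree-correct red al) deg)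
                       , Card-unique (indegree-correct red al) indeg })
    (λ { (deg , indeg) → subst (Card (𝒫Edge (V w))) (trans size deg) (degree-correct red al)
                       , subst (Card (Incoming (V w))) indeg (indegree-correct red al) })
    where
    size : length (star-directions (unused w)) ≡ star-size (length (unused w))
    size = star-size-correct (unused-clique w)

  class-words : Class → ℕ → List (List Point)
  class-words c n = filter (λ w → inClass? c (state w)) (words n)

  levelSum : ∀ c n → LevelSum c n (length (class-words c n))
  levelSum c n = vertices , (deduplicate-! (map V (class-words c n)) , λ x → mk⇔ to from) ,
    map multiplicity vertices , pointwise-map (All.tabulate value-at) ,
    -- A value counts the words with a given endpoint, so the sum counts the words ending in
    -- `vertices`. The class depends on the endpoint alone, and these are the words of the class.
    trans (sum-fibres V (deduplicate-! (map V (class-words c n))) (words n))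
      (cong length (filter-cong (λ w → V w ∈? vertices) (λ w → inClass? c (state w))
        (All.tabulate λ w∈ → mk⇔ (back w∈) (λ ic → ∈-deduplicate⁺ _≟ᴾ_ (∈-map⁺ V (∈-filter⁺ (λ w → inClass? c (state w)) w∈ ic))))))
    where
    vertices : List Point
    vertices = deduplicate _≟ᴾ_ (map V (class-words c n))
    multiplicity : Point → ℕ
    multiplicity x = length (filter (λ w → V w ≟ᴾ x) (words n))
    word-at : ∀ {x} → x ∈ vertices → ∃[ w ] (Word n w × inClass c (state w) × x ≡ V w)
    word-at x∈ =
      let w , w∈ , x≡ = ∈-map⁻ V (∈-deduplicate⁻ _≟ᴾ_ (map V (class-words c n)) x∈)
          w∈words , ic = ∈-filter⁻ (λ w → inClass? c (state w)) {xs = words n} w∈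
      in w , Equivalence.to (proj₂ (words-enumerate n) w) w∈words , ic , x≡
    to : ∀ {x} → x ∈ vertices → Level n x × InClass c x
    to x∈ = let w , word , ic , x≡ = word-at x∈ in
      subst (λ x → Level n x × InClass c x) (sym x≡)
        (word⇒Level word , Equivalence.from (InClass⇔inClass (Word.reduced word) (Word.allowed word) c) ic)
    from : ∀ {x} → Level n x × InClass c x → x ∈ vertices
    from {x} (level , ic) = let w , word , x≡ = Level⇒word level in
      subst (_∈ vertices) (sym x≡) (∈-deduplicate⁺ _≟ᴾ_ (∈-map⁺ V (∈-filter⁺ (λ w → inClass? c (state w))
        (Equivalence.from (proj₂ (words-enumerate n) w) word)
        (Equivalence.to (InClass⇔inClass (Word.reduced word) (Word.allowed word) c) (subst (InClass c) x≡ ic)))))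
    back : ∀ {w} → w ∈ words n → V w ∈ vertices → inClass c (state w)
    back {w} w∈ Vw∈ =
      let word = Equivalence.to (proj₂ (words-enumerate n) w) w∈
          v , word-v , ic , eq = word-at Vw∈
      in Equivalence.to (InClass⇔inClass (Word.reduced word) (Word.allowed word) c)
           (subst (InClass c) (sym eq) (Equivalence.from (InClass⇔inClass (Word.reduced word-v) (Word.allowed word-v) c) ic))
    value-at : ∀ {x} → x ∈ vertices → Value x (multiplicity x)
    value-at x∈ = let w , word , ic , x≡ = word-at x∈ in
      subst (λ x → Value x (multiplicity x)) (sym x≡)
        (subst (λ m → Value (V w) (length (filter (λ v → V v ≟ᴾ V w) (words m)))) (Word.size word)
          (value-correct {Q₀} (Word.reduced word) (Word.allowed word)))
    pointwise-map : ∀ {xs} → All (λ x → Value x (multiplicity x)) xs → Pointwise Value xs (map multiplicity xs)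
    pointwise-map []       = []
    pointwise-map (p ∷ ps) = p ∷ pointwise-map ps

-- Recurrences

infix 4 _≟ˢ_

_≟ˢ_ : DecidableEquality State
_≟ˢ_ = Product.≡-dec ℕ._≟_ ℕ._≟_

open import Data.List.Membership.DecPropositional _≟ˢ_ using () renaming (_∈?_ to _∈ˢ?_)
open import Data.List.Relation.Unary.Unique.DecPropositional _≟ˢ_ using () renaming (unique? to uniqueˢ?)

indicator : ∀ {P : Set} → Dec P → ℕ
indicator P? = if does P? then 1 else 0

count : State → List State → ℕ
count σ L = sum (map (λ τ → indicator (σ ≟ˢ τ)) L)

length-filter : ∀ {X : Set} {P : X → Set} (P? : ∀ x → Dec (P x)) xs →
  length (filter P? xs) ≡ sum (map (indicator ∘ P?) xs)
length-filter P? [] = refl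
length-filter P? (x ∷ xs) with does (P? x)
... | true  = cong suc (length-filter P? xs)
... | false = length-filter P? xs

sum-map-+ : ∀ {X : Set} (f g : X → ℕ) xs → sum (map (λ x → f x ℕ.+ g x) xs) ≡ sum (map f xs) ℕ.+ sum (map g xs)
sum-map-+ f g []       = refl
sum-map-+ f g (x ∷ xs) = trans (cong (f x ℕ.+ g x ℕ.+_) (sum-map-+ f g xs)) (lemma (f x) (g x) _ _)
  where
  lemma : ∀ a b c d → a ℕ.+ b ℕ.+ (c ℕ.+ d) ≡ a ℕ.+ c ℕ.+ (b ℕ.+ d)
  lemma = ℕSolver.solve-∀

sum-map-concat : ∀ {X Y : Set} (f : Y → ℕ) (g : X → List Y) xs →
  sum (map f (concat (map g xs))) ≡ sum (map (λ x → sum (map f (g x))) xs)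
sum-map-concat f g []       = refl
sum-map-concat f g (x ∷ xs) = begin
  sum (map f (g x ++ concat (map g xs)))                   ≡⟨ cong sum (List.map-++ f (g x) _) ⟩
  sum (map f (g x) ++ map f (concat (map g xs)))           ≡⟨ sum-++ (map f (g x)) _ ⟩
  sum (map f (g x)) ℕ.+ sum (map f (concat (map g xs)))    ≡⟨ cong (sum (map f (g x)) ℕ.+_) (sum-map-concat f g xs) ⟩
  sum (map f (g x)) ℕ.+ sum (map (λ x → sum (map f (g x))) xs) ∎
  where open ≡-Reasoning

sum-zero : ∀ {X : Set} {f : X → ℕ} {xs} → All (λ x → f x ≡ 0) xs → sum (map f xs) ≡ 0
sum-zero []       = refl
sum-zero (p ∷ ps) = cong₂ ℕ._+_ p (sum-zero ps)

sum-indicator : ∀ (f : State → ℕ) {S τ} → Unique S → τ ∈ S → sum (map (λ σ → f σ ℕ.* indicator (σ ≟ˢ τ)) S) ≡ f τ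
sum-indicator f {σ ∷ S} {τ} (σ∉ ∷ _) (here refl) = trans
  (cong₂ ℕ._+_ (trans (cong (λ b → f σ ℕ.* (if b then 1 else 0)) (dec-true (σ ≟ˢ σ) refl)) (ℕ.*-identityʳ (f σ)))
    (sum-zero {f = λ ρ → f ρ ℕ.* indicator (ρ ≟ˢ σ)} (All.map (λ {ρ} σ≢ρ →
      trans (cong (λ b → f ρ ℕ.* (if b then 1 else 0)) (dec-false (ρ ≟ˢ σ) (σ≢ρ ∘ sym))) (ℕ.*-zeroʳ (f ρ))) σ∉)))
  (ℕ.+-identityʳ (f σ))
sum-indicator f {σ ∷ S} {τ} (σ∉ ∷ S!) (there τ∈) = cong₂ ℕ._+_
  (trans (cong (λ b → f σ ℕ.* (if b then 1 else 0)) (dec-false (σ ≟ˢ τ) (All.lookup σ∉ τ∈))) (ℕ.*-zeroʳ (f σ)))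
  (sum-indicator f S! τ∈)

sum-by-state : ∀ (f : State → ℕ) {S} → Unique S → ∀ {L} → All (_∈ S) L →
  sum (map f L) ≡ sum (map (λ σ → f σ ℕ.* count σ L) S)
sum-by-state f {S} S! [] = sym (sum-zero {f = λ σ → f σ ℕ.* 0} {S} (All.tabulate λ {σ} _ → ℕ.*-zeroʳ (f σ)))
sum-by-state f {S} S! {τ ∷ L} (τ∈ ∷ ps) = sym (begin
  sum (map (λ σ → f σ ℕ.* (indicator (σ ≟ˢ τ) ℕ.+ count σ L)) S)
    ≡⟨ cong sum (List.map-cong (λ σ → ℕ.*-distribˡ-+ (f σ) (indicator (σ ≟ˢ τ)) (count σ L)) S) ⟩
  sum (map (λ σ → f σ ℕ.* indicator (σ ≟ˢ τ) ℕ.+ f σ ℕ.* count σ L) S)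
    ≡⟨ sum-map-+ (λ σ → f σ ℕ.* indicator (σ ≟ˢ τ)) (λ σ → f σ ℕ.* count σ L) S ⟩
  sum (map (λ σ → f σ ℕ.* indicator (σ ≟ˢ τ)) S) ℕ.+ sum (map (λ σ → f σ ℕ.* count σ L) S)
    ≡⟨ cong₂ ℕ._+_ (sum-indicator f S! τ∈) (sym (sum-by-state f S! ps)) ⟩
  f τ ℕ.+ sum (map f L) ∎)
  where open ≡-Reasoning

dot : ∀ {n} → Vec ℕ n → Vec ℕ n → ℕ
dot []      []      = 0
dot (a ∷ u) (b ∷ v) = a ℕ.* b ℕ.+ dot u v

sum-dot : ∀ (f g : State → ℕ) {n} (S : Vec State n) →
  sum (map (λ σ → f σ ℕ.* g σ) (toList S)) ≡ dot (Vec.map f S) (Vec.map g S)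
sum-dot f g []      = refl
sum-dot f g (σ ∷ S) = cong (f σ ℕ.* g σ ℕ.+_) (sum-dot f g S)

-- The numbers of unused directions and of descents for the types 1, A, B, …, K.
states : Vec State 10
states = (3 , 1) ∷ (2 , 2) ∷ (2 , 1) ∷ (1 , 3) ∷ (1 , 2) ∷ (1 , 1) ∷ (0 , 4) ∷ (0 , 3) ∷ (0 , 2) ∷ (0 , 1) ∷ []

states-unique : Unique (toList states)
states-unique = toWitness {a? = uniqueˢ? (toList states)} _

-- The entry in row τ and column σ is the number of vertices of type τ one level above
-- a vertex of type σ to which it is joined.
matrix : Vec (Vec ℕ 10) 10
matrix =
  (1 ∷ 0 ∷ 0 ∷ 0 ∷ 0 ∷ 0 ∷ 0 ∷ 0 ∷ 0 ∷ 0 ∷ []) ∷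
  (3 ∷ 2 ∷ 2 ∷ 0 ∷ 0 ∷ 0 ∷ 0 ∷ 0 ∷ 0 ∷ 0 ∷ []) ∷
  (0 ∷ 1 ∷ 2 ∷ 0 ∷ 0 ∷ 0 ∷ 0 ∷ 0 ∷ 0 ∷ 0 ∷ []) ∷
  (0 ∷ 2 ∷ 0 ∷ 3 ∷ 2 ∷ 0 ∷ 0 ∷ 0 ∷ 0 ∷ 0 ∷ []) ∷
  (0 ∷ 0 ∷ 2 ∷ 3 ∷ 4 ∷ 5 ∷ 0 ∷ 0 ∷ 0 ∷ 0 ∷ []) ∷
  (0 ∷ 0 ∷ 0 ∷ 3 ∷ 4 ∷ 6 ∷ 0 ∷ 0 ∷ 0 ∷ 0 ∷ []) ∷
  (0 ∷ 0 ∷ 0 ∷ 1 ∷ 0 ∷ 0 ∷ 4 ∷ 2 ∷ 0 ∷ 0 ∷ []) ∷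
  (0 ∷ 0 ∷ 0 ∷ 0 ∷ 1 ∷ 0 ∷ 6 ∷ 6 ∷ 5 ∷ 0 ∷ []) ∷
  (0 ∷ 0 ∷ 0 ∷ 0 ∷ 0 ∷ 1 ∷ 12 ∷ 12 ∷ 12 ∷ 12 ∷ []) ∷
  (0 ∷ 0 ∷ 0 ∷ 0 ∷ 0 ∷ 0 ∷ 94 ∷ 97 ∷ 101 ∷ 107 ∷ []) ∷ []

opaque
  unfolding orbit

  matrix-correct : Vec.map (λ τ → Vec.map (count τ) (Vec.map (std-successorsIn roots) states)) states ≡ matrix
  matrix-correct = toWitness {a? = check roots} _
    where
    compare : ∀ Ls → Dec (Vec.map (λ τ → Vec.map (count τ) Ls) states ≡ matrix)
    compare Ls = Vec.≡-dec (Vec.≡-dec ℕ._≟_) (Vec.map (λ τ → Vec.map (count τ) Ls) states) matrix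
    check : ∀ xs → Dec (Vec.map (λ τ → Vec.map (count τ) (Vec.map (std-successorsIn xs) states)) states ≡ matrix)
    check xs = compare (Vec.map (std-successorsIn xs) states)

  level-1 : Vec.map (λ τ → count τ (map state (words 1))) states ≡ 4 ∷ 0 ∷ 0 ∷ 0 ∷ 0 ∷ 0 ∷ 0 ∷ 0 ∷ 0 ∷ 0 ∷ []
  level-1 = toWitness {a? = check (map state (words 1))} _
    where
    check : ∀ L → Dec (Vec.map (λ τ → count τ L) states ≡ 4 ∷ 0 ∷ 0 ∷ 0 ∷ 0 ∷ 0 ∷ 0 ∷ 0 ∷ 0 ∷ 0 ∷ [])
    check L = Vec.≡-dec ℕ._≟_ (Vec.map (λ τ → count τ L) states) _

transfer : Vec ℕ 10 → Vec ℕ 10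
transfer v = Vec.map (λ row → dot row v) matrix

levels : ℕ → Vec ℕ 10
levels zero    = 4 ∷ 0 ∷ 0 ∷ 0 ∷ 0 ∷ 0 ∷ 0 ∷ 0 ∷ 0 ∷ 0 ∷ []
levels (suc m) = transfer (levels m)

counts : ℕ → Vec ℕ 10
counts n = Vec.map (λ τ → count τ (map state (words n))) states

state∈states : ∀ {n w} → Word (suc n) w → state w ∈ toList states
state∈states {w = s ∷ w} (mk red al _) = All.lookup (All.lookup table (∈-upTo⁺ d<4)) (∈-upTo⁺ j<4) d+j≤4
  where
  d = length (filter (adj? s) (desc w))
  j = length (unused (s ∷ w))
  d+j≤4 : suc d ℕ.+ j ≤ 4
  d+j≤4 = subst (_≤ 4) (List.length-++ (desc (s ∷ w)))
    (proj₁ (homogeneous (desc-unused-clique red al (desc-clique (Reduced⇒Root red)) (λ x∈ → x∈))))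
  d<4 : d ℕ.< 4
  d<4 = ℕ.≤-trans (ℕ.m≤m+n (suc d) j) d+j≤4
  j<4 : j ℕ.< 4
  j<4 = ℕ.≤-trans (s≤s (ℕ.m≤n+m j d)) d+j≤4
  table : All (λ d → All (λ j → suc d ℕ.+ j ≤ 4 → (j , suc d) ∈ toList states) (upTo 4)) (upTo 4)
  table = toWitness {a? = all? (λ d → all? (λ j → (suc d ℕ.+ j ℕ.≤? 4) →-dec ((j , suc d) ∈ˢ? toList states)) (upTo 4)) (upTo 4)} _

words-states : ∀ n → All (_∈ toList states) (map state (words (suc n)))
words-states n = All.map⁺ (All.tabulate λ {w} w∈ →
  state∈states (Equivalence.to (proj₂ (words-enumerate (suc n)) w) w∈))

count-step : ∀ τ n → count τ (map state (words (suc (suc n)))) ≡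
  dot (Vec.map (count τ) (Vec.map std-successors states)) (counts (suc n))
count-step τ n = begin
  sum (map δ (map state (concat (map extensions ws))))        ≡⟨ cong sum (List.map-∘ (concat (map extensions ws))) ⟨
  sum (map (δ ∘ state) (concat (map extensions ws)))          ≡⟨ sum-map-concat (δ ∘ state) extensions ws ⟩
  sum (map (λ w → sum (map (δ ∘ state) (extensions w))) ws)   ≡⟨ cong sum (List.map-cong-local (All.tabulate local)) ⟩
  sum (map (λ w → count τ (std-successors (state w))) ws)     ≡⟨ cong sum (List.map-∘ ws) ⟩
  sum (map (count τ ∘ std-successors) (map state ws))         ≡⟨ sum-by-state (count τ ∘ std-successors) states-unique (words-states n) ⟩
  sum (map (λ σ → count τ (std-successors σ) ℕ.* count σ (map state ws)) (toList states))
    ≡⟨ sum-dot (count τ ∘ std-successors) (λ σ → count σ (map state ws)) states ⟩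
  dot (Vec.map (count τ ∘ std-successors) states) (counts (suc n))
    ≡⟨ cong (λ row → dot row (counts (suc n))) (Vec.map-∘ (count τ) std-successors states) ⟩
  dot (Vec.map (count τ) (Vec.map std-successors states)) (counts (suc n)) ∎
  where
  open ≡-Reasoning
  δ : State → ℕ
  δ σ = indicator (τ ≟ˢ σ)
  ws = words (suc n)
  local : ∀ {w} → w ∈ ws → sum (map (δ ∘ state) (extensions w)) ≡ count τ (std-successors (state w))
  local {w} w∈ = let mk red al _ = Equivalence.to (proj₂ (words-enumerate (suc n)) w) w∈ in
    trans (cong sum (List.map-∘ (extensions w))) (sum-↭ (map-↭ δ (extension-states red al)))

map-dot : ∀ {m n} (f : State → Vec ℕ n) (v : Vec ℕ n) (S : Vec State m) →
  Vec.map (λ τ → dot (f τ) v) S ≡ Vec.map (λ row → dot row v) (Vec.map f S)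
map-dot f v []      = refl
map-dot f v (τ ∷ S) = cong (dot (f τ) v ∷_) (map-dot f v S)

counts-correct : ∀ m → counts (suc m) ≡ levels m
counts-correct zero    = level-1
counts-correct (suc m) = begin
  counts (suc (suc m))
    ≡⟨ Vec.map-cong (λ τ → count-step τ m) states ⟩
  Vec.map (λ τ → dot (Vec.map (count τ) (Vec.map std-successors states)) (counts (suc m))) states
    ≡⟨ map-dot (λ τ → Vec.map (count τ) (Vec.map std-successors states)) (counts (suc m)) states ⟩
  Vec.map (λ row → dot row (counts (suc m))) (Vec.map (λ τ → Vec.map (count τ) (Vec.map std-successors states)) states)
    ≡⟨ cong₂ (λ M v → Vec.map (λ row → dot row v) M) matrix-correct (counts-correct m) ⟩
  transfer (levels m) ∎
  where open ≡-Reasoning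

members : Class → Vec ℕ 10
members c = Vec.map (λ σ → indicator (inClass? c σ)) states

-- Level 0 is separate: its only vertex `V₀` has the state `(4 , 0)`, outside `states`, and its
-- degree 4 belongs to no type.
level-sum : Class → ℕ → ℕ
level-sum (type _) zero    = 0
level-sum all      zero    = 1
level-sum c        (suc m) = dot (members c) (levels m)

level-sum-correct : ∀ u c n → length (LevelSums.class-words u c n) ≡ level-sum c n
level-sum-correct u (type A) zero = refl
level-sum-correct u (type B) zero = refl
level-sum-correct u (type C) zero = refl
level-sum-correct u (type D) zero = refl
level-sum-correct u (type E) zero = refl
level-sum-correct u (type F) zero = refl
level-sum-correct u (type G) zero = refl
level-sum-correct u (type H) zero = refl
level-sum-correct u (type K) zero = refl
level-sum-correct u all      zero = refl
level-sum-correct u c (suc m) = trans go (level-sum-suc c)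
  where
  level-sum-suc : ∀ c → dot (members c) (levels m) ≡ level-sum c (suc m)
  level-sum-suc (type _) = refl
  level-sum-suc all      = refl
  open ≡-Reasoning
  ws = words (suc m)
  go : length (LevelSums.class-words u c (suc m)) ≡ dot (members c) (levels m)
  go = begin
    length (filter (λ w → inClass? c (state w)) ws)              ≡⟨ length-filter (λ w → inClass? c (state w)) ws ⟩
    sum (map (λ w → indicator (inClass? c (state w))) ws)        ≡⟨ cong sum (List.map-∘ ws) ⟩
    sum (map (indicator ∘ inClass? c) (map state ws))            ≡⟨ sum-by-state (indicator ∘ inClass? c) states-unique (words-states m) ⟩
    sum (map (λ σ → indicator (inClass? c σ) ℕ.* count σ (map state ws)) (toList states))
      ≡⟨ sum-dot (indicator ∘ inClass? c) (λ σ → count σ (map state ws)) states ⟩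
    dot (members c) (counts (suc m))                             ≡⟨ cong (dot (members c)) (counts-correct m) ⟩
    dot (members c) (levels m)                                   ∎

-- Recurrences as identities of row vectors

combine : ∀ {m n} → Vec ℕ m → Vec (Vec ℕ n) m → Vec ℕ n
combine []      []         = Vec.replicate _ 0
combine (a ∷ u) (row ∷ rs) = Vec.zipWith (λ b c → a ℕ.* b ℕ.+ c) row (combine u rs)

dot-combine : ∀ {m n} (u : Vec ℕ m) (M : Vec (Vec ℕ n) m) v → dot u (Vec.map (λ row → dot row v) M) ≡ dot (combine u M) v
dot-combine [] [] v = sym (zeros v)
  where
  zeros : ∀ {n} (v : Vec ℕ n) → dot (Vec.replicate n 0) v ≡ 0
  zeros []      = refl
  zeros (_ ∷ v) = zeros v
dot-combine (a ∷ u) (row ∷ M) v = trans (cong (a ℕ.* dot row v ℕ.+_) (dot-combine u M v)) (linear row (combine u M) v)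
  where
  lemma : ∀ a b x c p q → a ℕ.* (b ℕ.* x ℕ.+ p) ℕ.+ (c ℕ.* x ℕ.+ q) ≡ (a ℕ.* b ℕ.+ c) ℕ.* x ℕ.+ (a ℕ.* p ℕ.+ q)
  lemma = ℕSolver.solve-∀
  linear : ∀ {n} (r s v : Vec ℕ n) → a ℕ.* dot r v ℕ.+ dot s v ≡ dot (Vec.zipWith (λ b c → a ℕ.* b ℕ.+ c) r s) v
  linear []      []      []      = trans (ℕ.+-identityʳ (a ℕ.* 0)) (ℕ.*-zeroʳ a)
  linear (b ∷ r) (c ∷ s) (x ∷ v) = trans (lemma a b x c (dot r v) (dot s v)) (cong ((a ℕ.* b ℕ.+ c) ℕ.* x ℕ.+_) (linear r s v))

-- The row vector `u` times the k-th power of `matrix`. Moving the powers from the unknown level to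
-- the row leaves closed vectors that can be computed.
pull : ℕ → Vec ℕ 10 → Vec ℕ 10
pull zero    u = u
pull (suc k) u = pull k (combine u matrix)

dot-levels : ∀ k u m → dot u (levels (k ℕ.+ m)) ≡ dot (pull k u) (levels m)
dot-levels zero    u m = refl
dot-levels (suc k) u m = trans (dot-combine u matrix (levels (k ℕ.+ m))) (dot-levels k (combine u matrix) m)

dotℤ : ∀ {n} → Vec ℤ n → Vec ℕ n → ℤ
dotℤ []      []      = + 0
dotℤ (a ∷ u) (b ∷ v) = a * + b + dotℤ u v

dotℤ-+ : ∀ {n} (u v : Vec ℕ n) → + dot u v ≡ dotℤ (Vec.map +_ u) v
dotℤ-+ []      []      = refl
dotℤ-+ (a ∷ u) (b ∷ v) = cong₂ _+_ (ℤ.pos-* a b) (dotℤ-+ u v)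

infix  7 _⋆_
infixl 6 _:+_ _:-_

-- Syntax of the right-hand sides with two readings: `eval` unfolds to the displayed expression,
-- `coefficients` forms the same combination of row vectors.
data Form : Set where
  _⋆_       : ℤ → ℕ → Form
  _:+_ _:-_ : Form → Form → Form

eval : (ℕ → ℤ) → Form → ℤ
eval x (a ⋆ i)  = a * x i
eval x (f :+ g) = eval x f + eval x g
eval x (f :- g) = eval x f - eval x g

Within : ℕ → Form → Set
Within N (a ⋆ i)  = True (i ℕ.≤? N)
Within N (f :+ g) = Within N f × Within N g
Within N (f :- g) = Within N f × Within N g

coefficients : ∀ {n} → (ℕ → Vec ℤ n) → Form → Vec ℤ n
coefficients X (a ⋆ i)  = Vec.map (a *_) (X i)
coefficients X (f :+ g) = Vec.zipWith _+_ (coefficients X f) (coefficients X g)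
coefficients X (f :- g) = Vec.zipWith _-_ (coefficients X f) (coefficients X g)

eval-linear : ∀ {N n} (x : ℕ → ℤ) (X : ℕ → Vec ℤ n) v → (∀ {i} → i ≤ N → x i ≡ dotℤ (X i) v) →
  ∀ f → Within N f → eval x f ≡ dotℤ (coefficients X f) v
eval-linear x X v x≡ (a ⋆ i) i≤N = trans (cong (a *_) (x≡ (toWitness i≤N))) (scaled (X i) v)
  where
  lemma : ∀ a b c d → a * (b * c + d) ≡ a * b * c + a * d
  lemma = solve-∀
  scaled : ∀ {n} (u : Vec ℤ n) v → a * dotℤ u v ≡ dotℤ (Vec.map (a *_) u) v
  scaled []      []      = ℤ.*-zeroʳ a
  scaled (b ∷ u) (c ∷ v) = trans (lemma a b (+ c) (dotℤ u v)) (cong (_+_ (a * b * + c)) (scaled u v))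
eval-linear x X v x≡ (f :+ g) (f≤ , g≤) =
  trans (cong₂ _+_ (eval-linear x X v x≡ f f≤) (eval-linear x X v x≡ g g≤))
        (add (coefficients X f) (coefficients X g) v)
  where
  lemma : ∀ a b c p q → a * c + p + (b * c + q) ≡ (a + b) * c + (p + q)
  lemma = solve-∀
  add : ∀ {n} (u w : Vec ℤ n) v → dotℤ u v + dotℤ w v ≡ dotℤ (Vec.zipWith _+_ u w) v
  add []      []      []      = refl
  add (a ∷ u) (b ∷ w) (c ∷ v) =
    trans (lemma a b (+ c) (dotℤ u v) (dotℤ w v)) (cong (_+_ ((a + b) * + c)) (add u w v))
eval-linear x X v x≡ (f :- g) (f≤ , g≤) =
  trans (cong₂ _-_ (eval-linear x X v x≡ f f≤) (eval-linear x X v x≡ g g≤))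
        (subtract (coefficients X f) (coefficients X g) v)
  where
  lemma : ∀ a b c p q → a * c + p - (b * c + q) ≡ (a - b) * c + (p - q)
  lemma = solve-∀
  subtract : ∀ {n} (u w : Vec ℤ n) v → dotℤ u v - dotℤ w v ≡ dotℤ (Vec.zipWith _-_ u w) v
  subtract []      []      []      = refl
  subtract (a ∷ u) (b ∷ w) (c ∷ v) =
    trans (lemma a b (+ c) (dotℤ u v) (dotℤ w v)) (cong (_+_ ((a - b) * + c)) (subtract u w v))

pulled : ℕ → Class → ℕ → Vec ℤ 10
pulled N c i = Vec.map +_ (pull (N ∸ i) (members c))

-- With `n = suc N + m` every term is a fixed row vector applied to `levels m`, so one identity of
-- row vectors proves all cases. The bound is `suc N` because `levels` starts at level 1.
recurrence : ∀ N f → Within N f → ∀ c → pulled N c 0 ≡ coefficients (pulled N c) f →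
  ∀ n → n ≥ suc N → let x = λ i → + level-sum c (n ∸ i) in x 0 ≡ eval x f
recurrence N f f≤N c eq n n≥ with m , refl ← ℕ.m≤n⇒∃[o]m+o≡n n≥ =
  trans (x≡ z≤n) (trans (cong (λ u → dotℤ u (levels m)) eq) (sym (eval-linear x (pulled N c) (levels m) x≡ f f≤N)))
  where
  x : ℕ → ℤ
  x i = + level-sum c (suc (N ℕ.+ m) ∸ i)
  level-sum-suc : ∀ c k → level-sum c (suc k) ≡ dot (members c) (levels k)
  level-sum-suc (type _) k = refl
  level-sum-suc all      k = refl
  x≡ : ∀ {i} → i ≤ N → x i ≡ dotℤ (pulled N c i) (levels m)
  x≡ {i} i≤N = begin
    + level-sum c (suc (N ℕ.+ m) ∸ i)          ≡⟨ cong (+_ ∘ level-sum c) (trans (ℕ.+-∸-comm m (ℕ.≤-trans i≤N (ℕ.n≤1+n N))) (cong (ℕ._+ m) (ℕ.+-∸-assoc 1 i≤N))) ⟩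
    + level-sum c (suc (N ∸ i ℕ.+ m))          ≡⟨ cong +_ (level-sum-suc c _) ⟩
    + dot (members c) (levels (N ∸ i ℕ.+ m))   ≡⟨ cong +_ (dot-levels (N ∸ i) (members c) m) ⟩
    + dot (pull (N ∸ i) (members c)) (levels m) ≡⟨ dotℤ-+ (pull (N ∸ i) (members c)) (levels m) ⟩
    dotℤ (pulled N c i) (levels m)             ∎
    where open ≡-Reasoning

-- From the characteristic polynomial of `matrix`; `form₆` and `form₃` come from those of its
-- leading blocks of sizes 6 and 3. Rows supported on such a block remain so under multiplication by
-- `matrix`.
form₁₀ : Form
form₁₀ = + 147 ⋆ 1 :- + 3635 ⋆ 2 :+ + 36277 ⋆ 3 :- + 175292 ⋆ 4
         :+ + 445156 ⋆ 5 :- + 608920 ⋆ 6 :+ + 438532 ⋆ 7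
         :- + 151320 ⋆ 8 :+ + 19344 ⋆ 9 :- + 288 ⋆ 10

form₆ : Form
form₆ = + 18 ⋆ 1 :- + 99 ⋆ 2 :+ + 226 ⋆ 3 :- + 224 ⋆ 4 :+ + 92 ⋆ 5 :- + 12 ⋆ 6

form₃ : Form
form₃ = + 5 ⋆ 1 :- + 6 ⋆ 2 :+ + 2 ⋆ 3

holds? : ∀ N f c → Dec (pulled N c 0 ≡ coefficients (pulled N c) f)
holds? N f c = Vec.≡-dec ℤ._≟_ (pulled N c 0) (coefficients (pulled N c) f)

coefficients₁₀ : ∀ c → pulled 10 c 0 ≡ coefficients (pulled 10 c) form₁₀
coefficients₁₀ (type A) = toWitness {a? = holds? 10 form₁₀ (type A)} _
coefficients₁₀ (type B) = toWitness {a? = holds? 10 form₁₀ (type B)} _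
coefficients₁₀ (type C) = toWitness {a? = holds? 10 form₁₀ (type C)} _
coefficients₁₀ (type D) = toWitness {a? = holds? 10 form₁₀ (type D)} _
coefficients₁₀ (type E) = toWitness {a? = holds? 10 form₁₀ (type E)} _
coefficients₁₀ (type F) = toWitness {a? = holds? 10 form₁₀ (type F)} _
coefficients₁₀ (type G) = toWitness {a? = holds? 10 form₁₀ (type G)} _
coefficients₁₀ (type H) = toWitness {a? = holds? 10 form₁₀ (type H)} _
coefficients₁₀ (type K) = toWitness {a? = holds? 10 form₁₀ (type K)} _
coefficients₁₀ all      = toWitness {a? = holds? 10 form₁₀ all} _

coefficients₆ : ∀ c → c ∈ type A ∷ type B ∷ type C ∷ type D ∷ type E ∷ [] →
  pulled 6 c 0 ≡ coefficients (pulled 6 c) form₆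
coefficients₆ _ = All.lookup (toWitness {a? = all? (holds? 6 form₆) (type A ∷ type B ∷ type C ∷ type D ∷ type E ∷ [])} _)

coefficients₃ : ∀ c → c ∈ type A ∷ type B ∷ [] → pulled 3 c 0 ≡ coefficients (pulled 3 c) form₃
coefficients₃ _ = All.lookup (toWitness {a? = all? (holds? 3 form₃) (type A ∷ type B ∷ [])} _)

initial≟ : ∀ c xs → Dec (map (level-sum c) (applyUpTo suc 10) ≡ xs)
initial≟ c xs = List.≡-dec ℕ._≟_ (map (level-sum c) (applyUpTo suc 10)) xs

level-sums : ∀ {V₀ Q₀} → Incident vertex hypercube V₀ Q₀ → ∀ c n → Simplex.LevelSum V₀ Q₀ c n (level-sum c n)
level-sums (u , V₀≡ , Q₀≡) c n =
  subst₂ (λ V Q → Simplex.LevelSum V Q c n (level-sum c n))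
    (trans (cong (act u) c₀≡) V₀≡) (trans (cong (act u) corner-std-4) Q₀≡)
    (subst (Simplex.LevelSum (Frame.V u []) (Frame.Cube u [] (std 4)) c n) (level-sum-correct u c n) (LevelSums.levelSum u c n))

theorem4 : (V₀ Q₀ : Point) → Incident vertex hypercube V₀ Q₀ →
    Σ[ x̂ ∈ (Class → ℕ → ℕ) ]
    ( (∀ (c : Class) (n : ℕ) → Simplex.LevelSum V₀ Q₀ c n (x̂ c n))
    × (∀ c n → n ≥ 11 →
    let x = λ i → + x̂ c (n ∸ i) in
    x 0 ≡ + 147 * x 1 - + 3635 * x 2 + + 36277 * x 3 - + 175292 * x 4
    + + 445156 * x 5 - + 608920 * x 6 + + 438532 * x 7
    - + 151320 * x 8 + + 19344 * x 9 - + 288 * x 10)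
    × (let initial = λ c → map (x̂ c) (applyUpTo suc 10) in
    initial (type A) ≡ 0 ∷ 12 ∷ 36 ∷ 108 ∷ 348 ∷ 1164 ∷ 3948 ∷ 13452 ∷ 45900 ∷ 156684 ∷ []
    × initial (type B) ≡ 0 ∷ 0 ∷ 12 ∷ 60 ∷ 228 ∷ 804 ∷ 2772 ∷ 9492 ∷ 32436 ∷ 110772 ∷ []
    × initial (type C) ≡ 0 ∷ 0 ∷ 24 ∷ 144 ∷ 840 ∷ 5808 ∷ 48552 ∷ 458736 ∷ 4588008 ∷ 46916592 ∷ []
    × initial (type D) ≡ 0 ∷ 0 ∷ 0 ∷ 96 ∷ 1296 ∷ 14400 ∷ 152592 ∷ 1592448 ∷ 16530384 ∷ 171272832 ∷ []
    × initial (type E) ≡ 0 ∷ 0 ∷ 0 ∷ 72 ∷ 1248 ∷ 15192 ∷ 166176 ∷ 1753080 ∷ 18264480 ∷ 189472440 ∷ []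
    × initial (type F) ≡ 0 ∷ 0 ∷ 0 ∷ 24 ∷ 240 ∷ 2280 ∷ 26880 ∷ 667944 ∷ 51411168 ∷ 5797305000 ∷ []
    × initial (type G) ≡ 0 ∷ 0 ∷ 0 ∷ 0 ∷ 240 ∷ 5976 ∷ 255936 ∷ 24140328 ∷ 2793536160 ∷ 331243298952 ∷ []
    × initial (type H) ≡ 0 ∷ 0 ∷ 0 ∷ 0 ∷ 360 ∷ 38400 ∷ 4458168 ∷ 528618816 ∷ 62831416920 ∷ 7469847072960 ∷ []
    × initial (type K) ≡ 0 ∷ 0 ∷ 0 ∷ 0 ∷ 2256 ∷ 323592 ∷ 39296736 ∷ 4682378232 ∷ 556809369792 ∷ 66200381333976 ∷ []
    × initial all ≡ 4 ∷ 16 ∷ 76 ∷ 508 ∷ 7060 ∷ 407620 ∷ 44411764 ∷ 5239632532 ∷ 622525195252 ∷ 74007676940212 ∷ [])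
    × (∀ c n → c ∈ type A ∷ type B ∷ type C ∷ type D ∷ type E ∷ [] → n ≥ 7 →
    let x = λ i → + x̂ c (n ∸ i) in
    x 0 ≡ + 18 * x 1 - + 99 * x 2 + + 226 * x 3 - + 224 * x 4 + + 92 * x 5 - + 12 * x 6)
    × (∀ c n → c ∈ type A ∷ type B ∷ [] → n ≥ 4 →
    let x = λ i → + x̂ c (n ∸ i) in
    x 0 ≡ + 5 * x 1 - + 6 * x 2 + + 2 * x 3))
theorem4 V₀ Q₀ incident =
  level-sum ,
  level-sums incident ,
  (λ c n n≥ → recurrence 10 form₁₀ _ c (coefficients₁₀ c) n n≥) ,
  (toWitness {a? = initial≟ (type A) _} _ ,
   toWitness {a? = initial≟ (type B) _} _ ,
   toWitness {a? = initial≟ (type C) _} _ ,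
   toWitness {a? = initial≟ (type D) _} _ ,
   toWitness {a? = initial≟ (type E) _} _ ,
   toWitness {a? = initial≟ (type F) _} _ ,
   toWitness {a? = initial≟ (type G) _} _ ,
   toWitness {a? = initial≟ (type H) _} _ ,
   toWitness {a? = initial≟ (type K) _} _ ,
   toWitness {a? = initial≟ all _} _) ,
  (λ c n c∈ n≥ → recurrence 6 form₆ _ c (coefficients₆ c c∈) n n≥) ,
  (λ c n c∈ n≥ → recurrence 3 form₃ _ c (coefficients₃ c c∈) n n≥)
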